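{- Let $n$ be a positive integer and $1\le i,j\le n$. Then $$m_n^{n,n}(i,j)=\frac{1}{n^2}\sum_{d\mid n} d^{n/d}\,(n/d)!\,\phi(d)^2\,\frac{\mu\!\left(\frac{d}{\gcd(i,d)}\right)\mu\!\left(\frac{d}{\gcd(j,d)}\right)}{\phi\!\left(\frac{d}{\gcd(i,d)}\right)\phi\!\left(\frac{d}{\gcd(j,d)}\right)},$$ where $\mu$ is the number-theoretic Möbius function and $\phi$ is Euler's totient function.
   Context: $S_n$ is the symmetric group on $[n]$. For $\pi=a_1\cdots a_n\in S_n$, $\mathrm{maj}\,\pi=\sum_{a_i>a_{i+1}} i$. For positive integers $k,l$ and nonnegative integers $i,j$, $m_n^{k,l}(i,j)=\#\{\pi\in S_n:\ \mathrm{maj}\,\pi\equiv i \pmod k,\ \mathrm{maj}\,\pi^{ -1}\equiv j\pmod l\}$. -}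

module Defs where

open import Data.Bool using (Bool; true; false; _∧_; _∨_; not; if_then_else_)
open import Data.Nat using (ℕ; zero; suc; _+_; _*_; _∸_; _^_; _≡ᵇ_; _<ᵇ_; _!)
open import Data.Nat.DivMod using (_/_; _%_)
open import Data.Nat.GCD using (gcd)
open import Data.Nat.Primality using (prime?)
open import Data.List using (List; []; _∷_; map; filter; length; concatMap; foldr)
open import Data.Bool.ListAction using (all; any)
open import Data.Integer as ℤ using (ℤ; +_)
open import Data.Rational as ℚ using (ℚ)
open import Relation.Nullary.Decidable using (does)

oneTo : ℕ → List ℕ
oneTo zero    = []
oneTo (suc n) = go 1 (suc n)
  where
  go : ℕ → ℕ → List ℕ
  go k zero    = []
  go k (suc m) = k ∷ go (suc k) m

_∈ᵇ_ : ℕ → List ℕ → Bool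
k ∈ᵇ xs = any (λ x → k ≡ᵇ x) xs

-- natural division with the (never used) convention m div 0 = 0
_div_ : ℕ → ℕ → ℕ
m div zero  = 0
m div suc k = m / suc k

_∣ᵇ_ : ℕ → ℕ → Bool
zero  ∣ᵇ n = n ≡ᵇ 0
suc d ∣ᵇ n = (n % suc d) ≡ᵇ 0

-- The symmetric group S_n, with permutations in one-line notation
-- a₁ a₂ ⋯ aₙ, a word over [n] = {1,…,n}.

words : (n k : ℕ) → List (List ℕ)
words n zero    = [] ∷ []
words n (suc k) = concatMap (λ w → map (λ a → a ∷ w) (oneTo n)) (words n k)

-- a word of length n over [n] is a permutation iff every letter of [n] occurs
isPerm : ℕ → List ℕ → Bool
isPerm n w = all (λ k → k ∈ᵇ w) (oneTo n)

S : ℕ → List (List ℕ)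
S n = filter (λ w → Data.Bool._≟_ (isPerm n w) true) (words n n)

majFrom : ℕ → List ℕ → ℕ
majFrom i []           = 0
majFrom i (a ∷ [])     = 0
majFrom i (a ∷ b ∷ xs) = (if b <ᵇ a then i else 0) + majFrom (suc i) (b ∷ xs)

maj : List ℕ → ℕ
maj w = majFrom 1 w

pos : ℕ → List ℕ → ℕ
pos k []       = 0
pos k (x ∷ xs) = if k ≡ᵇ x then 1 else suc (pos k xs)

inv : ℕ → List ℕ → List ℕ
inv n w = map (λ k → pos k w) (oneTo n)

m : (n k l i j : ℕ) → ℕ
m n zero    l i j = 0   -- k, l are positive in the paper; never used with 0
m n (suc k) zero i j = 0
m n (suc k) (suc l) i j =
  length (filter (λ w → Data.Bool._≟_
            ((maj w % suc k ≡ᵇ i % suc k) ∧ (maj (inv n w) % suc l ≡ᵇ j % suc l)) true)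
          (S n))

φ : ℕ → ℕ
φ n = length (filter (λ k → Data.Nat._≟_ (gcd k n) 1) (oneTo n))

primeDivisors : ℕ → List ℕ
primeDivisors n =
  filter (λ p → Data.Bool._≟_ (does (prime? p) ∧ (p ∣ᵇ n)) true) (oneTo n)

μ : ℕ → ℤ
μ n = if any (λ p → (p * p) ∣ᵇ n) (primeDivisors n)
      then + 0
      else (ℤ.- (+ 1)) ℤ.^ length (primeDivisors n)

-- p / q as a rational (q = 0 never occurs in the statement; mapped to 0)
infixl 5 _÷ℕ_
_÷ℕ_ : ℤ → ℕ → ℚ
p ÷ℕ zero  = ℚ.0ℚ
p ÷ℕ suc q = p ℚ./ suc q

Σℚ : List ℚ → ℚ
Σℚ = foldr ℚ._+_ ℚ.0ℚ

divisors : ℕ → List ℕ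
divisors n = filter (λ d → Data.Bool._≟_ (d ∣ᵇ n) true) (oneTo n)

rhs : (n i j : ℕ) → ℚ
rhs n i j =
  ℚ._*_ ((+ 1) ÷ℕ (n * n))
    (Σℚ (map (λ d →
       let a = d div gcd i d
           b = d div gcd j d
       in ((+ (d ^ (n div d) * (n div d) ! * (φ d * φ d))) ℤ.* μ a ℤ.* μ b)
            ÷ℕ (φ a * φ b))
     (divisors n)))

{-# OPTIONS --safe #-}
module Submission where

-- Everything takes place over ℤ; roots of unity are replaced by the property
-- Primitive d of integer functions.  The Ramanujan sums C d (in Hölder's form)
-- have this property, and Σ_{d∣n} C d i = n [n ∣ i], so that
--   n² m(i,j) = Σ_{d,e∣n} Σ_π C d (maj π - i) C e (maj π⁻¹ - j).
-- For primitive f and g of orders d ≥ e the inner sum is evaluated as follows.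
-- Inclusion–exclusion over the inverse descents of π expresses
-- Σ_π f(maj π) g(maj π⁻¹) through sums of f(maj w) over all words w of a given
-- content.  Cut such a word into blocks of length d: rotating a block shifts
-- maj, modulo d, by its number of cyclic descents, so only words with constant
-- blocks contribute.  The operator coefficients kill every content except
-- (d, d, …, d), which survives only for e = d; it is the content of (n/d)! words
-- with constant blocks and has coefficient (∏_{0<a<d} (1 - ζᵃ))^(n/d) = d^(n/d).
-- The case d < e follows by passing to inverse permutations.

-- Every evaluation is linear in f and in g, so the only facts about a primitive d-th root of unity
-- ζ that enter are ζᵈ = 1 and Σ_c ζ^(ck) = 0 for 0 < k < d. Why the coefficients kill the other
-- contents: possible inverse descents are treated from n - 1 down to 1. At a, either the descent is
-- forced, which applies the shift yᵃ to g, or the letters a and a + 1 are merged, which applies 1 -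
-- yᵃ. A branch is therefore a composition of n whose proper partial sums are the forced positions.
-- Constant blocks allow only parts divisible by d, so only multiples of d can be forced. If g has
-- period d and some part exceeds d, then a multiple a of d was merged and 1 - yᵃ annihilates g;
-- this leaves the parts d, ..., d. If g has period e < d, then e itself was merged and 1 - yᵉ
-- annihilates g, so nothing is left. The argument needs the larger order on the side of maj, which
-- is why the opposite case goes through inverses.

open import Defs
open import Algebra.Bundles using (CommutativeRing)
open import Algebra.Structures using (IsCommutativeRing)
open import Data.Bool using (Bool; true; false; if_then_else_; T; _∧_)
open import Data.Bool.ListAction using (any)
open import Data.Empty using (⊥-elim)
open import Data.Integer using (ℤ; +_; 0ℤ; 1ℤ; -1ℤ)
import Data.Integer as ℤ
import Data.Integer.Properties as ℤ
open import Data.Integer.Tactic.RingSolver using (solve-∀)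
open import Data.List using (List; []; _∷_; _++_; map; length; concatMap; applyUpTo; upTo; filter; replicate)
import Data.List.Properties as List
open import Data.List.Membership.Propositional using (_∈_; lose; find)
open import Data.List.Membership.Propositional.Properties using (∈-map⁺; ∈-map⁻; ∈-upTo⁺; ∈-upTo⁻; ∈-filter⁺; ∈-filter⁻)
open import Data.List.Relation.Unary.All as All using (All; []; _∷_)
import Data.List.Relation.Unary.All.Properties as All
open import Data.List.Relation.Unary.Any.Properties using (any⁺; any⁻)
open import Data.Nat
open import Data.Nat.Coprimality as Coprimality using (Coprime; coprime-divisor; coprime⇒gcd≡1; gcd≡1⇒coprime)
open import Data.Nat.DivMod hiding (_div_)
open import Data.Nat.Divisibility
open import Data.Nat.GCD
open import Data.Nat.Induction using (<-rec)
open import Data.Nat.ListAction using (product)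
open import Data.Nat.Primality
open import Data.Nat.Primality.Factorisation using (factorise; module PrimeFactorisation)
open import Data.Nat.Properties
open import Data.Nat.Solver using (module +-*-Solver)
open import Data.Product using (_×_; _,_; proj₁; proj₂; ∃)
open import Data.Rational using (ℚ)
import Data.Rational as ℚ
import Data.Rational.Properties as ℚ
open import Data.Rational.Unnormalised using (mkℚᵘ; *≡*)
import Data.Rational.Unnormalised.Properties as ℚᵘ
open import Data.Sum using (inj₁; inj₂)
open import Data.Unit using (tt)
open import Function using (_∘_; id)
open import Level using (0ℓ)
open import Relation.Binary.Definitions using (tri<; tri≈; tri>)
open import Relation.Binary.PropositionalEquality
open import Relation.Nullary using (¬_; Dec; yes; no; does)
open import Relation.Nullary.Decidable using (_×-dec_; ¬?)

-- The integer operations of the library unfold on variables, which blocks the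
-- inference of implicit arguments.
infixl 6 _+ᶻ_ _-ᶻ_
infixl 7 _*ᶻ_
opaque
  _+ᶻ_ _*ᶻ_ _-ᶻ_ : ℤ → ℤ → ℤ
  _+ᶻ_ = ℤ._+_
  _*ᶻ_ = ℤ._*_
  _-ᶻ_ = ℤ._-_

opaque
  unfolding _+ᶻ_

  isCommutativeRing : IsCommutativeRing _≡_ _+ᶻ_ _*ᶻ_ ℤ.-_ 0ℤ 1ℤ
  isCommutativeRing = ℤ.+-*-isCommutativeRing

  +-interchange : ∀ a b c d → (a +ᶻ b) +ᶻ (c +ᶻ d) ≡ (a +ᶻ c) +ᶻ (b +ᶻ d)
  +-interchange = solve-∀

  suc-*ᶻ : ∀ n c → + suc n *ᶻ c ≡ + n *ᶻ c +ᶻ c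
  suc-*ᶻ n c = trans (ℤ.*-distribʳ-+ c 1ℤ (+ n)) (trans (ℤ.+-comm (1ℤ ℤ.* c) (+ n ℤ.* c)) (cong (ℤ._+_ (+ n ℤ.* c)) (ℤ.*-identityˡ c)))

ℤ-commutativeRing : CommutativeRing 0ℓ 0ℓ
ℤ-commutativeRing = record { isCommutativeRing = isCommutativeRing }

module R = CommutativeRing ℤ-commutativeRing

private variable
  X Y : Set

-- The list 1, ..., n as an image of an initial segment

applyUpTo-cong : {f g : ℕ → X} → (∀ i → f i ≡ g i) → ∀ n → applyUpTo f n ≡ applyUpTo g n
applyUpTo-cong eq zero    = refl
applyUpTo-cong eq (suc n) = cong₂ _∷_ (eq 0) (applyUpTo-cong (eq ∘ suc) n)

mutual
  -- The local function of oneTo has no name outside Defs: the metavariable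
  -- below is solved by it when oneTo-2+ is checked.
  oneTo-go : ∀ p k n → _ ≡ applyUpTo (λ i → k + i) n
  oneTo-2+ : ∀ n → oneTo (2 + n) ≡ 1 ∷ 2 ∷ applyUpTo (λ i → 3 + i) n
  oneTo-2+ n with suc n | 3
  ... | p | k = cong (λ l → 1 ∷ 2 ∷ l) (oneTo-go p k n)
  oneTo-go p k zero    = refl
  oneTo-go p k (suc n) = cong₂ _∷_ (sym (+-identityʳ k))
    (trans (oneTo-go p (suc k) n) (applyUpTo-cong (λ i → sym (+-suc k i)) n))

oneTo≡ : ∀ n → oneTo n ≡ map suc (upTo n)
oneTo≡ 0 = refl
oneTo≡ 1 = refl
oneTo≡ (suc (suc n)) = trans (oneTo-2+ n) (sym (List.map-applyUpTo id suc (2 + n)))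

-- Finite sums

sumL : List X → (X → ℤ) → ℤ
sumL []       f = 0ℤ
sumL (x ∷ xs) f = f x +ᶻ sumL xs f

sumN : ℕ → (ℕ → ℤ) → ℤ
sumN n = sumL (upTo n)

sum₁ : ℕ → (ℕ → ℤ) → ℤ
sum₁ n f = sumN n (f ∘ suc)

sumL-cong : {f g : X → ℤ} (xs : List X) → (∀ x → f x ≡ g x) → sumL xs f ≡ sumL xs g
sumL-cong []       eq = refl
sumL-cong (x ∷ xs) eq = cong₂ _+ᶻ_ (eq x) (sumL-cong xs eq)

sumL-zero : (xs : List X) → sumL xs (λ _ → 0ℤ) ≡ 0ℤ
sumL-zero []       = refl
sumL-zero (x ∷ xs) = trans (R.+-identityˡ _) (sumL-zero xs)

sumL-+ : (xs : List X) (f g : X → ℤ) → sumL xs (λ x → f x +ᶻ g x) ≡ sumL xs f +ᶻ sumL xs g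
sumL-+ []       f g = sym (R.+-identityˡ 0ℤ)
sumL-+ (x ∷ xs) f g = trans (cong (_ +ᶻ_) (sumL-+ xs f g)) (+-interchange (f x) (g x) _ _)

sumL-*ˡ : ∀ c (xs : List X) (f : X → ℤ) → sumL xs (λ x → c *ᶻ f x) ≡ c *ᶻ sumL xs f
sumL-*ˡ c []       f = sym (R.zeroʳ c)
sumL-*ˡ c (x ∷ xs) f = trans (cong (_ +ᶻ_) (sumL-*ˡ c xs f)) (sym (R.distribˡ c _ _))

sumL-*ʳ : ∀ c (xs : List X) (f : X → ℤ) → sumL xs (λ x → f x *ᶻ c) ≡ sumL xs f *ᶻ c
sumL-*ʳ c xs f = trans (sumL-cong xs (λ x → R.*-comm (f x) c))
  (trans (sumL-*ˡ c xs f) (R.*-comm c _))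

sumL-swap : (xs : List X) (ys : List Y) (f : X → Y → ℤ) →
  sumL xs (λ x → sumL ys (f x)) ≡ sumL ys (λ y → sumL xs (λ x → f x y))
sumL-swap []       ys f = sym (sumL-zero ys)
sumL-swap (x ∷ xs) ys f = trans (cong (_ +ᶻ_) (sumL-swap xs ys f)) (sym (sumL-+ ys (f x) _))

sumL-++ : (xs ys : List X) (f : X → ℤ) → sumL (xs ++ ys) f ≡ sumL xs f +ᶻ sumL ys f
sumL-++ []       ys f = sym (R.+-identityˡ _)
sumL-++ (x ∷ xs) ys f = trans (cong (f x +ᶻ_) (sumL-++ xs ys f)) (sym (R.+-assoc (f x) _ _))

sumL-map : (g : X → Y) (xs : List X) (f : Y → ℤ) → sumL (map g xs) f ≡ sumL xs (f ∘ g)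
sumL-map g []       f = refl
sumL-map g (x ∷ xs) f = cong (f (g x) +ᶻ_) (sumL-map g xs f)

sumL-concatMap : (g : X → List Y) (xs : List X) (f : Y → ℤ) →
  sumL (concatMap g xs) f ≡ sumL xs (λ x → sumL (g x) f)
sumL-concatMap g []       f = refl
sumL-concatMap g (x ∷ xs) f =
  trans (sumL-++ (g x) _ f) (cong (_ +ᶻ_) (sumL-concatMap g xs f))

sumL-oneTo : ∀ n f → sumL (oneTo n) f ≡ sum₁ n f
sumL-oneTo n f = trans (cong (λ l → sumL l f) (oneTo≡ n)) (sumL-map suc (upTo n) f)

sumN-front : ∀ n f → sumN (suc n) f ≡ f 0 +ᶻ sum₁ n f
sumN-front n f = cong (f 0 +ᶻ_)
  (trans (cong (λ l → sumL l f) (sym (List.map-upTo suc n))) (sumL-map suc (upTo n) f))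

sumN-suc : ∀ n f → sumN (suc n) f ≡ sumN n f +ᶻ f n
sumN-suc n f = trans (cong (λ l → sumL l f) (sym (List.upTo-∷ʳ n)))
  (trans (sumL-++ (upTo n) (n ∷ []) f) (cong (sumN n f +ᶻ_) (R.+-identityʳ _)))

sumN-cong : ∀ n {f g : ℕ → ℤ} → (∀ i → i < n → f i ≡ g i) → sumN n f ≡ sumN n g
sumN-cong zero    eq = refl
sumN-cong (suc n) {f} {g} eq = trans (sumN-suc n f)
  (trans (cong₂ _+ᶻ_ (sumN-cong n (λ i i<n → eq i (m<n⇒m<1+n i<n))) (eq n (n<1+n n)))
         (sym (sumN-suc n g)))

sumN-const : ∀ n c → sumN n (λ _ → c) ≡ + n *ᶻ c
sumN-const zero    c = sym (R.zeroˡ c)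
sumN-const (suc n) c = trans (sumN-suc n _)
  (trans (cong (_+ᶻ c) (sumN-const n c)) (sym (suc-*ᶻ n c)))

sumN-+ : ∀ n k f → sumN (n + k) f ≡ sumN n f +ᶻ sumN k (λ i → f (n + i))
sumN-+ n zero    f = trans (cong (λ l → sumN l f) (+-identityʳ n)) (sym (R.+-identityʳ _))
sumN-+ n (suc k) f = trans (cong (λ l → sumN l f) (+-suc n k))
  (trans (sumN-suc (n + k) f) (trans (cong (_+ᶻ f (n + k)) (sumN-+ n k f))
  (trans (R.+-assoc (sumN n f) _ _) (cong (sumN n f +ᶻ_) (sym (sumN-suc k (λ i → f (n + i))))))))

sumN-* : ∀ n k f → sumN (n * k) f ≡ sumN n (λ i → sumN k (λ j → f (i * k + j)))
sumN-* zero    k f = refl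
sumN-* (suc n) k f = trans (sumN-+ k (n * k) f)
  (trans (cong (sumN k f +ᶻ_) (trans (sumN-* n k (λ i → f (k + i)))
     (sumL-cong (upTo n) (λ i → sumL-cong (upTo k) (λ j → cong f (sym (+-assoc k (i * k) j)))))))
   (sym (sumN-front n (λ i → sumN k (λ j → f (i * k + j))))))

sum₁-cong : ∀ n {f g : ℕ → ℤ} → (∀ i → 1 ≤ i → i ≤ n → f i ≡ g i) → sum₁ n f ≡ sum₁ n g
sum₁-cong n eq = sumN-cong n (λ i i<n → eq (suc i) (s≤s z≤n) i<n)

-- Indicators and Kronecker deltas

⟦_⟧ : {P : Set} → Dec P → ℤ
⟦ P? ⟧ = if does P? then 1ℤ else 0ℤ

⟦⟧-yes : {P : Set} (P? : Dec P) → P → ⟦ P? ⟧ ≡ 1ℤ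
⟦⟧-yes (yes _) p = refl
⟦⟧-yes (no ¬p) p = ⊥-elim (¬p p)

⟦⟧-no : {P : Set} (P? : Dec P) → ¬ P → ⟦ P? ⟧ ≡ 0ℤ
⟦⟧-no (yes p) ¬p = ⊥-elim (¬p p)
⟦⟧-no (no _)  ¬p = refl

⟦⟧-cong : {P Q : Set} (P? : Dec P) (Q? : Dec Q) → (P → Q) → (Q → P) → ⟦ P? ⟧ ≡ ⟦ Q? ⟧
⟦⟧-cong (yes p) Q? f g = sym (⟦⟧-yes Q? (f p))
⟦⟧-cong (no ¬p) Q? f g = sym (⟦⟧-no Q? (¬p ∘ g))

⟦⟧-× : {P Q : Set} (P? : Dec P) (Q? : Dec Q) → ⟦ P? ×-dec Q? ⟧ ≡ ⟦ P? ⟧ *ᶻ ⟦ Q? ⟧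
⟦⟧-× (yes p) Q? = sym (R.*-identityˡ ⟦ Q? ⟧)
⟦⟧-× (no ¬p) Q? = sym (R.zeroˡ ⟦ Q? ⟧)

⟦⟧*-cong : {P : Set} (P? : Dec P) {x y : ℤ} → (P → x ≡ y) → ⟦ P? ⟧ *ᶻ x ≡ ⟦ P? ⟧ *ᶻ y
⟦⟧*-cong (yes p) eq = cong (1ℤ *ᶻ_) (eq p)
⟦⟧*-cong (no ¬p) {x} {y} eq = trans (R.zeroˡ x) (sym (R.zeroˡ y))

yes-* : {P : Set} (P? : Dec P) → P → ∀ x → ⟦ P? ⟧ *ᶻ x ≡ x
yes-* P? p x = trans (cong (_*ᶻ x) (⟦⟧-yes P? p)) (R.*-identityˡ x)

no-* : {P : Set} (P? : Dec P) → ¬ P → ∀ x → ⟦ P? ⟧ *ᶻ x ≡ 0ℤ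
no-* P? p x = trans (cong (_*ᶻ x) (⟦⟧-no P? p)) (R.zeroˡ x)

sumN-none : ∀ n a (f : ℕ → ℤ) → n ≤ a → sumN n (λ i → ⟦ i ≟ a ⟧ *ᶻ f i) ≡ 0ℤ
sumN-none n a f n≤a = trans
  (sumN-cong n (λ i i<n → no-* (i ≟ a) (<⇒≢ (<-≤-trans i<n n≤a)) (f i)))
  (sumL-zero (upTo n))

sumN-δ : ∀ n a (f : ℕ → ℤ) → a < n → sumN n (λ i → ⟦ i ≟ a ⟧ *ᶻ f i) ≡ f a
sumN-δ (suc n) a f a<1+n with a ≟ n
... | yes refl = trans (sumN-suc n _) (trans (cong₂ _+ᶻ_ (sumN-none n n f ≤-refl) (yes-* (n ≟ n) refl (f n))) (R.+-identityˡ _))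
... | no a≢n   = trans (sumN-suc n _) (trans (cong₂ _+ᶻ_ (sumN-δ n a f (≤∧≢⇒< (≤-pred a<1+n) a≢n)) (no-* (n ≟ a) (a≢n ∘ sym) (f n))) (R.+-identityʳ _))

sum₁-δ : ∀ n a (f : ℕ → ℤ) → 1 ≤ a → a ≤ n → sum₁ n (λ i → ⟦ i ≟ a ⟧ *ᶻ f i) ≡ f a
sum₁-δ n (suc a) f _ a<n = trans
  (sumL-cong (upTo n) (λ i → cong (_*ᶻ f (suc i)) (⟦⟧-cong (suc i ≟ suc a) (i ≟ a) suc-injective (cong suc))))
  (sumN-δ n a (f ∘ suc) a<n)

-- Words over [n]

InRange : ℕ → ℕ → Set
InRange n x = 1 ≤ x × x ≤ n

IsWord : ℕ → ℕ → List ℕ → Set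
IsWord n k w = length w ≡ k × All (InRange n) w

sumW : ℕ → ℕ → (List ℕ → ℤ) → ℤ
sumW n k = sumL (words n k)

sumW-snoc : ∀ n k Φ → sumW n (suc k) Φ ≡ sumW n k (λ w → sum₁ n (λ a → Φ (a ∷ w)))
sumW-snoc n k Φ = trans (sumL-concatMap (λ w → map (λ a → a ∷ w) (oneTo n)) (words n k) Φ)
  (sumL-cong (words n k) (λ w → trans (sumL-map (λ a → a ∷ w) (oneTo n) Φ) (sumL-oneTo n _)))

-- In `words` the first letter is chosen in the inner loop; exchanging the sums puts it outside, as
-- inductions on a word require.
sumW-cons : ∀ n k Φ → sumW n (suc k) Φ ≡ sum₁ n (λ a → sumW n k (λ w → Φ (a ∷ w)))
sumW-cons n k Φ = trans (sumW-snoc n k Φ) (sumL-swap (words n k) (upTo n) _)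

sumW-cong : ∀ n k {Φ Ψ} → (∀ w → IsWord n k w → Φ w ≡ Ψ w) → sumW n k Φ ≡ sumW n k Ψ
sumW-cong n zero    eq = cong (_+ᶻ 0ℤ) (eq [] (refl , []))
sumW-cong n (suc k) {Φ} {Ψ} eq = trans (sumW-cons n k Φ) (trans
  (sum₁-cong n (λ a 1≤a a≤n → sumW-cong n k (λ w (l , r) → eq (a ∷ w) (cong suc l , (1≤a , a≤n) ∷ r))))
  (sym (sumW-cons n k Ψ)))

_≟ʷ_ : (u w : List ℕ) → Dec (u ≡ w)
_≟ʷ_ = List.≡-dec _≟_

sumW-δ : ∀ n k u Φ → IsWord n k u → sumW n k (λ w → ⟦ w ≟ʷ u ⟧ *ᶻ Φ w) ≡ Φ u
sumW-δ n zero    [] Φ _ = trans (R.+-identityʳ _) (R.*-identityˡ _)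
sumW-δ n (suc k) (b ∷ u) Φ (l , (1≤b , b≤n) ∷ r) = trans (sumW-cons n k _) (trans
  (sumL-cong (upTo n) (λ a → trans (sumL-cong (words n k) (λ w → split (suc a) w)) (sumL-*ˡ _ (words n k) _)))
  (trans (sum₁-δ n b (λ a → sumW n k (λ w → ⟦ w ≟ʷ u ⟧ *ᶻ Φ (a ∷ w))) 1≤b b≤n)
         (sumW-δ n k u (λ w → Φ (b ∷ w)) (suc-injective l , r))))
  where
  split : ∀ a w → ⟦ (a ∷ w) ≟ʷ (b ∷ u) ⟧ *ᶻ Φ (a ∷ w) ≡ ⟦ a ≟ b ⟧ *ᶻ (⟦ w ≟ʷ u ⟧ *ᶻ Φ (a ∷ w))
  split a w = trans (cong (_*ᶻ Φ (a ∷ w)) (trans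
      (⟦⟧-cong ((a ∷ w) ≟ʷ (b ∷ u)) ((a ≟ b) ×-dec (w ≟ʷ u)) (λ e → List.∷-injective e) (λ (e , e′) → cong₂ _∷_ e e′))
      (⟦⟧-× (a ≟ b) (w ≟ʷ u))))
    (R.*-assoc ⟦ a ≟ b ⟧ _ _)

-- A weight-preserving bijection between P-words and Q-words: insert the Kronecker delta of `w′` and
-- `ψ w`, then sum over `w` first; `ψ′` singles out the one `w` that remains.
sumW-reindex : ∀ n k {P Q : List ℕ → Set} (P? : ∀ w → Dec (P w)) (Q? : ∀ w → Dec (Q w)) (ψ ψ′ : List ℕ → List ℕ) (Φ Ψ : List ℕ → ℤ) →
  (∀ w → IsWord n k w → P w → IsWord n k (ψ w) × Q (ψ w) × ψ′ (ψ w) ≡ w × Φ w ≡ Ψ (ψ w)) →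
  (∀ w → IsWord n k w → Q w → IsWord n k (ψ′ w) × P (ψ′ w) × ψ (ψ′ w) ≡ w) →
  sumW n k (λ w → ⟦ P? w ⟧ *ᶻ Φ w) ≡ sumW n k (λ w → ⟦ Q? w ⟧ *ᶻ Ψ w)
sumW-reindex n k P? Q? ψ ψ′ Φ Ψ to from = trans (sumW-cong n k expand)
  (trans (sumL-swap (words n k) (words n k) _) (sumW-cong n k collapse))
  where
  expand : ∀ w → IsWord n k w → ⟦ P? w ⟧ *ᶻ Φ w ≡ sumW n k (λ w′ → ⟦ P? w ⟧ *ᶻ (⟦ w′ ≟ʷ ψ w ⟧ *ᶻ Ψ w′))
  expand w isW = trans (⟦⟧*-cong (P? w) (λ p → let (ψW , q , e , eq) = to w isW p in
      trans eq (sym (sumW-δ n k (ψ w) Ψ ψW))))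
    (sym (sumL-*ˡ ⟦ P? w ⟧ (words n k) _))
  collapse : ∀ w′ → IsWord n k w′ → sumW n k (λ w → ⟦ P? w ⟧ *ᶻ (⟦ w′ ≟ʷ ψ w ⟧ *ᶻ Ψ w′)) ≡ ⟦ Q? w′ ⟧ *ᶻ Ψ w′
  collapse w′ isW′ with Q? w′
  ... | yes q = let (W , p , e) = from w′ isW′ q in trans
        (sumW-cong n k (λ w isW → trans (sym (R.*-assoc ⟦ P? w ⟧ _ _)) (cong (_*ᶻ Ψ w′) (trans
           (sym (⟦⟧-× (P? w) (w′ ≟ʷ ψ w)))
           (⟦⟧-cong (P? w ×-dec (w′ ≟ʷ ψ w)) (w ≟ʷ ψ′ w′)
             (λ (pw , e′) → trans (sym (proj₁ (proj₂ (proj₂ (to w isW pw))))) (cong ψ′ (sym e′)))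
             (λ { refl → p , sym e }))))))
        (trans (sumW-δ n k (ψ′ w′) (λ _ → Ψ w′) W) (sym (R.*-identityˡ _)))
  ... | no ¬q = trans (sumW-cong n k vanish) (trans (sumL-zero (words n k)) (sym (R.zeroˡ (Ψ w′))))
    where
    vanish : ∀ w → IsWord n k w → ⟦ P? w ⟧ *ᶻ (⟦ w′ ≟ʷ ψ w ⟧ *ᶻ Ψ w′) ≡ 0ℤ
    vanish w isW = trans (sym (R.*-assoc ⟦ P? w ⟧ _ _)) (trans (cong (_*ᶻ Ψ w′) (sym (⟦⟧-× (P? w) (w′ ≟ʷ ψ w))))
      (no-* (P? w ×-dec (w′ ≟ʷ ψ w)) (λ { (pw , refl) → ¬q (proj₁ (proj₂ (to w isW pw))) }) (Ψ w′)))

-- Totient and Möbius function along a prime factor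

opaque
  unfolding _+ᶻ_

  +-homo : ∀ a b → + (a + b) ≡ + a +ᶻ + b
  +-homo = ℤ.pos-+

  *-homo : ∀ a b → + (a * b) ≡ + a *ᶻ + b
  *-homo = ℤ.pos-*

  *ᶻ-cancelʳ : ∀ a b c .{{_ : NonZero c}} → a *ᶻ + c ≡ b *ᶻ + c → a ≡ b
  *ᶻ-cancelʳ a b (suc c) = ℤ.*-cancelʳ-≡ a b (+ suc c)

  +ᶻ-∸ : ∀ a c → (a +ᶻ c) -ᶻ c ≡ a
  +ᶻ-∸ = solve-∀

  +ᶻ-cancelʳ : ∀ a b c → a +ᶻ c ≡ b +ᶻ c → a ≡ b
  +ᶻ-cancelʳ a b c eq = trans (sym (+ᶻ-∸ a c)) (trans (cong (_-ᶻ c) eq) (+ᶻ-∸ b c))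

  pred-*ᶻ : ∀ c x → (c -ᶻ 1ℤ) *ᶻ x +ᶻ x ≡ c *ᶻ x
  pred-*ᶻ = solve-∀

length-filter : ∀ {A : Set} {P : A → Set} (P? : ∀ x → Dec (P x)) (xs : List A) →
  + length (filter P? xs) ≡ sumL xs (λ x → ⟦ P? x ⟧)
length-filter P? []       = refl
length-filter P? (x ∷ xs) with does (P? x)
... | true  = trans (+-homo 1 _) (cong (1ℤ +ᶻ_) (length-filter P? xs))
... | false = trans (length-filter P? xs) (sym (R.+-identityˡ _))

sum₁-* : ∀ n k f → sum₁ (n * k) f ≡ sumN n (λ i → sum₁ k (λ j → f (i * k + j)))
sum₁-* n k f = trans (sumN-* n k (f ∘ suc))
  (sumL-cong (upTo n) (λ i → sumL-cong (upTo k) (λ j → cong f (sym (+-suc (i * k) j)))))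

periodic-* : ∀ {f : ℕ → ℤ} d → (∀ s → f (s + d) ≡ f s) → ∀ i s → f (i * d + s) ≡ f s
periodic-* {f} d per zero    s = refl
periodic-* {f} d per (suc i) s = trans (cong f (trans (+-assoc d (i * d) s) (+-comm d (i * d + s))))
  (trans (per (i * d + s)) (periodic-* d per i s))

sum₁-periodic : ∀ n d f → (∀ s → f (s + d) ≡ f s) → sum₁ (n * d) f ≡ + n *ᶻ sum₁ d f
sum₁-periodic n d f per = trans (sum₁-* n d f) (trans
  (sumL-cong (upTo n) (λ i → sumL-cong (upTo d) (λ j → periodic-* d per i (suc j))))
  (sumN-const n (sum₁ d f)))

sum₁-extend : ∀ n k f → (∀ i → n < i → f i ≡ 0ℤ) → sum₁ (n + k) f ≡ sum₁ n f
sum₁-extend n k f vanish = trans (sumN-+ n k (f ∘ suc)) (trans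
  (cong (sum₁ n f +ᶻ_) (trans (sumL-cong (upTo k) (λ i → vanish (suc (n + i)) (s≤s (m≤m+n n i)))) (sumL-zero (upTo k))))
  (R.+-identityʳ _))

sum₁-multiples : ∀ n p .{{_ : NonZero p}} (f : ℕ → ℤ) → sum₁ (n * p) (λ k → ⟦ p ∣? k ⟧ *ᶻ f k) ≡ sum₁ n (λ i → f (i * p))
sum₁-multiples n (suc p) f = trans (sumN-* n (suc p) _) (sumL-cong (upTo n) inner)
  where
  inner : ∀ i → sumN (suc p) (λ j → ⟦ suc p ∣? suc (i * suc p + j) ⟧ *ᶻ f (suc (i * suc p + j))) ≡ f (suc i * suc p)
  inner i = trans (sumN-cong (suc p) (λ j j<p → cong (_*ᶻ f (suc (i * suc p + j)))
      (⟦⟧-cong (suc p ∣? suc (i * suc p + j)) (j ≟ p) (to j j<p) (λ { refl → from }))))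
    (trans (sumN-δ (suc p) p (λ j → f (suc (i * suc p + j))) (n<1+n p)) (cong f last))
    where
    last : suc (i * suc p + p) ≡ suc i * suc p
    last = cong suc (+-comm (i * suc p) p)
    from : suc p ∣ suc (i * suc p + p)
    from = divides (suc i) last
    to : ∀ j → j < suc p → suc p ∣ suc (i * suc p + j) → j ≡ p
    to j j≤p d = ≤-antisym (≤-pred j≤p) (≤-pred (∣⇒≤ (∣m+n∣m⇒∣n (subst (suc p ∣_) (sym (+-suc (i * suc p) j)) d) (n∣m*n i))))

∤⇒coprime : ∀ {p k} → Prime p → ¬ p ∣ k → Coprime p k
∤⇒coprime pr p∤k (d∣p , d∣k) with prime⇒irreducible pr d∣p
... | inj₁ d≡1  = d≡1
... | inj₂ refl = ⊥-elim (p∤k d∣k)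

coprime-∣ : ∀ {a a′ b b′} → a′ ∣ a → b′ ∣ b → Coprime a b → Coprime a′ b′
coprime-∣ a b c (x , y) = c (∣-trans x a , ∣-trans y b)

coprime-*ʳ : ∀ {k p d} → Coprime k p → Coprime k d → Coprime k (p * d)
coprime-*ʳ {k} {p} {d} kp kd {i} (i∣k , i∣pd) =
  kd (i∣k , coprime-divisor {i} {p} {d} (coprime-∣ i∣k ∣-refl kp) i∣pd)

gcd-coprime-* : ∀ {i p} d → Coprime i p → gcd i (p * d) ≡ gcd i d
gcd-coprime-* {i} {p} d c = ∣-antisym
  (gcd-greatest (gcd[m,n]∣m i (p * d)) (coprime-divisor {gcd i (p * d)} {p} {d}
    (coprime-∣ (gcd[m,n]∣m i (p * d)) ∣-refl c) (gcd[m,n]∣n i (p * d))))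
  (gcd-greatest (gcd[m,n]∣m i d) (∣n⇒∣m*n p (gcd[m,n]∣n i d)))

gcd-+ : ∀ s d → gcd (s + d) d ≡ gcd s d
gcd-+ s d = ∣-antisym
  (gcd-greatest (∣m+n∣m⇒∣n (subst (gcd (s + d) d ∣_) (+-comm s d) (gcd[m,n]∣m (s + d) d)) (gcd[m,n]∣n (s + d) d)) (gcd[m,n]∣n (s + d) d))
  (gcd-greatest (∣m∣n⇒∣m+n (gcd[m,n]∣m s d) (gcd[m,n]∣n s d)) (gcd[m,n]∣n s d))

coprime-count : ℕ → ℕ → ℤ
coprime-count n d = sum₁ n (λ k → ⟦ gcd k d ≟ 1 ⟧)

φ≡count : ∀ n → + φ n ≡ coprime-count n n
φ≡count n = trans (length-filter (λ k → gcd k n ≟ 1) (oneTo n)) (sumL-oneTo n _)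

count-* : ∀ p d → coprime-count (p * d) d ≡ + p *ᶻ + φ d
count-* p d = trans (sum₁-periodic p d (λ k → ⟦ gcd k d ≟ 1 ⟧) (λ s → cong (λ g → ⟦ g ≟ 1 ⟧) (gcd-+ s d)))
  (cong (+ p *ᶻ_) (sym (φ≡count d)))

-- For p ∣ d, being coprime to p d and to d is the same condition; it has period d, and p periods
-- fill the range up to p d.
φ-prime-∣ : ∀ {p d} → Prime p → p ∣ d → + φ (p * d) ≡ + p *ᶻ + φ d
φ-prime-∣ {p} {d} pr p∣d = trans (φ≡count (p * d)) (trans
  (sumL-cong (upTo (p * d)) (λ k′ → let k = suc k′ in ⟦⟧-cong (gcd k (p * d) ≟ 1) (gcd k d ≟ 1)
     (λ e → coprime⇒gcd≡1 {k} {d} (coprime-∣ ∣-refl (n∣m*n p) (gcd≡1⇒coprime {k} {p * d} e)))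
     (λ e → let c = gcd≡1⇒coprime {k} {d} e in coprime⇒gcd≡1 {k} {p * d} (coprime-*ʳ (coprime-∣ ∣-refl p∣d c) c))))
  (count-* p d))

-- Of the p φ(d) numbers up to p d that are coprime to d, the ones to discard are the multiples p k
-- with k coprime to d; there are φ(d) of them.
φ-prime-∤ : ∀ {p d} → Prime p → ¬ p ∣ d → + φ (p * d) ≡ (+ p -ᶻ 1ℤ) *ᶻ + φ d
φ-prime-∤ {p} {d} pr p∤d = +ᶻ-cancelʳ _ _ (+ φ d) (trans split (sym (pred-*ᶻ (+ p) (+ φ d))))
  where
  cop : Coprime d p
  cop = Coprimality.sym (∤⇒coprime pr p∤d)
  multiples : + φ d ≡ sum₁ (p * d) (λ k → ⟦ p ∣? k ⟧ *ᶻ ⟦ gcd k d ≟ 1 ⟧)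
  multiples = sym (trans (cong (λ N → sum₁ N (λ k → ⟦ p ∣? k ⟧ *ᶻ ⟦ gcd k d ≟ 1 ⟧)) (*-comm p d))
    (trans (sum₁-multiples d p {{prime⇒nonZero pr}} (λ k → ⟦ gcd k d ≟ 1 ⟧))
    (trans (sumL-cong (upTo d) (λ k → cong (λ g → ⟦ g ≟ 1 ⟧)
        (trans (cong (λ x → gcd x d) (*-comm (suc k) p)) (trans (gcd-comm (p * suc k) d)
          (trans (gcd-coprime-* (suc k) cop) (gcd-comm d (suc k)))))))
      (sym (φ≡count d)))))
  pointwise : ∀ k → ⟦ gcd k (p * d) ≟ 1 ⟧ +ᶻ ⟦ p ∣? k ⟧ *ᶻ ⟦ gcd k d ≟ 1 ⟧ ≡ ⟦ gcd k d ≟ 1 ⟧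
  pointwise k with p ∣? k
  ... | yes p∣k = trans (cong₂ _+ᶻ_ (⟦⟧-no (gcd k (p * d) ≟ 1) (λ e →
          ¬prime[1] (subst Prime (gcd≡1⇒coprime {k} {p * d} e (p∣k , m∣m*n d)) pr))) (R.*-identityˡ _)) (R.+-identityˡ _)
  ... | no p∤k = trans (cong₂ _+ᶻ_ (cong (λ g → ⟦ g ≟ 1 ⟧) (gcd-coprime-* d (Coprimality.sym (∤⇒coprime pr p∤k)))) (R.zeroˡ _)) (R.+-identityʳ _)
  split : + φ (p * d) +ᶻ + φ d ≡ + p *ᶻ + φ d
  split = trans (cong₂ _+ᶻ_ (φ≡count (p * d)) multiples) (trans (sym (sumL-+ (upTo (p * d)) _ _))
    (trans (sumL-cong (upTo (p * d)) (λ k → pointwise (suc k))) (count-* p d)))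

prime-induction : (P : ℕ → Set) → P 1 → (∀ {p n} → Prime p → NonZero n → P n → P (p * n)) → ∀ n .{{_ : NonZero n}} → P n
prime-induction P p1 step n = subst P (sym (isFactorisation f)) (go (factorsPrime f))
  where
  open PrimeFactorisation
  f = factorise n
  go : ∀ {ps} → All Prime ps → P (product ps)
  go []         = p1
  go (pr ∷ prs) = step pr (productOfPrimes≢0 prs) (go prs)

opaque
  unfolding _+ᶻ_

  -ᶻ1-suc : ∀ q x → (+ suc q -ᶻ 1ℤ) *ᶻ x ≡ + q *ᶻ x
  -ᶻ1-suc q x = refl

-- The factor is p or p - 1. Its existence is enough for `φ-nonZero` and `φ-∣`.
φ-prime : ∀ {p d} → Prime p → ∃ λ c → NonZero c × φ (p * d) ≡ c * φ d
φ-prime {p} {d} pr with p ∣? d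
... | yes p∣d = p , prime⇒nonZero pr , ℤ.+-injective (trans (φ-prime-∣ pr p∣d) (sym (*-homo p (φ d))))
... | no  p∤d = pred-case p pr p∤d
  where
  pred-case : ∀ p → Prime p → ¬ p ∣ d → ∃ λ c → NonZero c × φ (p * d) ≡ c * φ d
  pred-case 0 pr _ = ⊥-elim (¬prime[0] pr)
  pred-case 1 pr _ = ⊥-elim (¬prime[1] pr)
  pred-case (suc (suc q)) pr p∤d = suc q , _ , ℤ.+-injective
    (trans (φ-prime-∤ pr p∤d) (trans (-ᶻ1-suc (suc q) (+ φ d)) (sym (*-homo (suc q) (φ d)))))

φ-nonZero : ∀ n .{{_ : NonZero n}} → NonZero (φ n)
φ-nonZero = prime-induction (λ n → NonZero (φ n)) _ step
  where
  step : ∀ {p n} → Prime p → NonZero n → NonZero (φ n) → NonZero (φ (p * n))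
  step {p} {n} pr _ nz with φ-prime {p} {n} pr
  ... | c , c≢0 , eq = subst NonZero (sym eq) (m*n≢0 c (φ n) {{c≢0}} {{nz}})

-- Makes the natural-number quotient in `C` exact.
φ-∣ : ∀ {a} g .{{_ : NonZero g}} → φ a ∣ φ (g * a)
φ-∣ {a} = prime-induction (λ g → φ a ∣ φ (g * a)) (∣-reflexive (cong φ (sym (*-identityˡ a)))) step
  where
  step : ∀ {p n} → Prime p → NonZero n → φ a ∣ φ (n * a) → φ a ∣ φ (p * n * a)
  step {p} {n} pr _ ih with φ-prime {p} {n * a} pr
  ... | c , _ , eq = subst (φ a ∣_) (trans (sym eq) (cong φ (sym (*-assoc p n a)))) (∣n⇒∣m*n c ih)

∈-oneTo⁺ : ∀ {n k} → 1 ≤ k → k ≤ n → k ∈ oneTo n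
∈-oneTo⁺ {n} {suc k} _ k<n = subst (suc k ∈_) (sym (oneTo≡ n)) (∈-map⁺ suc (∈-upTo⁺ k<n))

∈-oneTo⁻ : ∀ {n k} → k ∈ oneTo n → 1 ≤ k × k ≤ n
∈-oneTo⁻ {n} {k} k∈ with ∈-map⁻ suc (subst (k ∈_) (oneTo≡ n) k∈)
... | i , i∈ , refl = s≤s z≤n , ∈-upTo⁻ i∈

T⇒≡ : ∀ {b} → T b → b ≡ true
T⇒≡ {true} _ = refl

∣ᵇ⇒∣ : ∀ d n → (d ∣ᵇ n) ≡ true → d ∣ n
∣ᵇ⇒∣ zero    zero eq = ∣-refl
∣ᵇ⇒∣ (suc d) n    eq = m%n≡0⇒n∣m n (suc d) (≡ᵇ⇒≡ (n % suc d) 0 (subst T (sym eq) tt))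

∣⇒∣ᵇ : ∀ d n → d ∣ n → (d ∣ᵇ n) ≡ true
∣⇒∣ᵇ zero    n d∣n = T⇒≡ (≡⇒≡ᵇ n 0 (0∣⇒≡0 d∣n))
∣⇒∣ᵇ (suc d) n d∣n rewrite n∣m⇒m%n≡0 n (suc d) d∣n = refl

IsPrimeDivisor : ℕ → ℕ → Set
IsPrimeDivisor n p = Prime p × p ∣ n

isPrimeDivisor? : ∀ n p → Dec (IsPrimeDivisor n p)
isPrimeDivisor? n p = prime? p ×-dec p ∣? n

primeDivisorᵇ⇒ : ∀ n p → (does (prime? p) ∧ (p ∣ᵇ n)) ≡ true → IsPrimeDivisor n p
primeDivisorᵇ⇒ n p eq with prime? p
primeDivisorᵇ⇒ n p eq | yes pr = pr , ∣ᵇ⇒∣ p n eq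

⇒primeDivisorᵇ : ∀ n p → IsPrimeDivisor n p → (does (prime? p) ∧ (p ∣ᵇ n)) ≡ true
⇒primeDivisorᵇ n p (pr , p∣n) with prime? p
... | yes _  = ∣⇒∣ᵇ p n p∣n
... | no ¬pr = ⊥-elim (¬pr pr)

∈-primeDivisors⁺ : ∀ {n p} .{{_ : NonZero n}} → IsPrimeDivisor n p → p ∈ primeDivisors n
∈-primeDivisors⁺ {n} {p} (pr , p∣n) = ∈-filter⁺ (λ p → Data.Bool._≟_ (does (prime? p) ∧ (p ∣ᵇ n)) true)
  (∈-oneTo⁺ (>-nonZero⁻¹ p {{prime⇒nonZero pr}}) (∣⇒≤ p∣n)) (⇒primeDivisorᵇ n p (pr , p∣n))

∈-primeDivisors⁻ : ∀ {n p} → p ∈ primeDivisors n → IsPrimeDivisor n p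
∈-primeDivisors⁻ {n} {p} p∈ = primeDivisorᵇ⇒ n p
  (proj₂ (∈-filter⁻ (λ p → Data.Bool._≟_ (does (prime? p) ∧ (p ∣ᵇ n)) true) {xs = oneTo n} p∈))

hasSquare : ℕ → Bool
hasSquare n = any (λ p → (p * p) ∣ᵇ n) (primeDivisors n)

square⇒ : ∀ {n q} .{{_ : NonZero n}} → Prime q → q * q ∣ n → hasSquare n ≡ true
square⇒ {n} {q} pr q²∣n = T⇒≡ (any⁺ (λ p → (p * p) ∣ᵇ n)
  (lose (∈-primeDivisors⁺ (pr , m*n∣⇒m∣ q q q²∣n)) (subst T (sym (∣⇒∣ᵇ (q * q) n q²∣n)) tt)))

⇒square : ∀ {n} → hasSquare n ≡ true → ∃ λ q → Prime q × q * q ∣ n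
⇒square {n} eq with find (any⁻ (λ p → (p * p) ∣ᵇ n) (primeDivisors n) (subst T (sym eq) tt))
... | q , q∈ , t = q , proj₁ (∈-primeDivisors⁻ {n} q∈) , ∣ᵇ⇒∣ (q * q) n (T⇒≡ t)

μ-square : ∀ {n q} .{{_ : NonZero n}} → Prime q → q * q ∣ n → μ n ≡ 0ℤ
μ-square {n} pr q²∣n = cong (λ b → if b then 0ℤ else -1ℤ ℤ.^ length (primeDivisors n)) (square⇒ pr q²∣n)

-- The slack `k` allows the prime divisors of a and of p a to be counted over one common range.
ω≡sum : ∀ n k .{{_ : NonZero n}} → + length (primeDivisors n) ≡ sum₁ (n + k) (λ v → ⟦ isPrimeDivisor? n v ⟧)
ω≡sum n k = trans (length-filter (λ p → Data.Bool._≟_ (does (prime? p) ∧ (p ∣ᵇ n)) true) (oneTo n)) (trans (sumL-oneTo n _) (trans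
  (sumL-cong (upTo n) (λ v → ⟦⟧-cong (Data.Bool._≟_ (does (prime? (suc v)) ∧ (suc v ∣ᵇ n)) true) (isPrimeDivisor? n (suc v))
    (primeDivisorᵇ⇒ n (suc v)) (⇒primeDivisorᵇ n (suc v))))
  (sym (sum₁-extend n k (λ v → ⟦ isPrimeDivisor? n v ⟧) (λ v n<v → ⟦⟧-no (isPrimeDivisor? n v) (λ (_ , v∣n) → <⇒≱ n<v (∣⇒≤ v∣n)))))))

prime∣prime : ∀ {p q} → Prime p → Prime q → p ∣ q → p ≡ q
prime∣prime pp pq p∣q with prime⇒irreducible pq p∣q
... | inj₁ refl = ⊥-elim (¬prime[1] pp)
... | inj₂ e    = e

ω-prime-∤ : ∀ {p a} .{{_ : NonZero a}} → Prime p → ¬ p ∣ a → length (primeDivisors (p * a)) ≡ suc (length (primeDivisors a))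
ω-prime-∤ {p} {a} pr p∤a = ℤ.+-injective (trans (ω≡sum (p * a) 0 {{m*n≢0 p a {{prime⇒nonZero pr}}}})
  (trans (cong (λ N → sum₁ N (λ v → ⟦ isPrimeDivisor? (p * a) v ⟧)) (trans (+-identityʳ (p * a)) (sym N≡)))
  (trans (sumL-cong (upTo N) (λ v → pointwise (suc v)))
  (trans (sumL-+ (upTo N) _ _)
  (trans (cong₂ _+ᶻ_ (sum₁-δ N p (λ _ → 1ℤ) (>-nonZero⁻¹ p {{prime⇒nonZero pr}}) (≤-trans (m≤m*n p a) (≤-reflexive (sym N≡)))) (sym (ω≡sum a (p * a ∸ a))))
    (sym (+-homo 1 (length (primeDivisors a)))))))))
  where
  N = a + (p * a ∸ a)
  N≡ : N ≡ p * a
  N≡ = m+[n∸m]≡n (m≤n*m a p {{prime⇒nonZero pr}})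
  pointwise : ∀ v → ⟦ isPrimeDivisor? (p * a) v ⟧ ≡ ⟦ v ≟ p ⟧ *ᶻ 1ℤ +ᶻ ⟦ isPrimeDivisor? a v ⟧
  pointwise v with v ≟ p
  ... | yes refl = trans (⟦⟧-yes (isPrimeDivisor? (p * a) v) (pr , m∣m*n a))
        (sym (trans (cong₂ _+ᶻ_ (yes-* (v ≟ p) refl 1ℤ) (⟦⟧-no (isPrimeDivisor? a v) (λ (_ , v∣a) → p∤a v∣a))) (R.+-identityʳ 1ℤ)))
  ... | no v≢p = trans (⟦⟧-cong (isPrimeDivisor? (p * a) v) (isPrimeDivisor? a v) to (λ (vp , v∣a) → vp , ∣n⇒∣m*n p v∣a))
        (sym (trans (cong (_+ᶻ ⟦ isPrimeDivisor? a v ⟧) (no-* (v ≟ p) v≢p 1ℤ)) (R.+-identityˡ _)))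
    where
    to : IsPrimeDivisor (p * a) v → IsPrimeDivisor a v
    to (vp , v∣pa) with euclidsLemma p a vp v∣pa
    ... | inj₁ v∣p = ⊥-elim (v≢p (prime∣prime vp pr v∣p))
    ... | inj₂ v∣a = vp , v∣a

-- If q² ∣ p a for a prime q, then q = p would force p ∣ a; hence q² is coprime to p and already
-- divides a.
hasSquare-prime-∤ : ∀ {p a} .{{_ : NonZero a}} → Prime p → ¬ p ∣ a → hasSquare (p * a) ≡ hasSquare a
hasSquare-prime-∤ {p} {a} pr p∤a with hasSquare a in ea | hasSquare (p * a) in epa
... | true  | true  = refl
... | false | false = refl
... | true  | false with ⇒square {a} ea
...   | q , pq , q²∣a = trans (sym epa) (square⇒ {{m*n≢0 p a {{prime⇒nonZero pr}}}} pq (∣n⇒∣m*n p q²∣a))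
hasSquare-prime-∤ {p} {a} pr p∤a | false | true with ⇒square {p * a} epa
...   | q , pq , q²∣pa = trans (sym (square⇒ {a} pq (coprime-divisor {q * q} {p} {a} (Coprimality.sym cop) q²∣pa))) ea
  where
  q≢p : ¬ q ≡ p
  q≢p refl = p∤a (*-cancelˡ-∣ p {{prime⇒nonZero pr}} q²∣pa)
  cop₁ : Coprime p q
  cop₁ = ∤⇒coprime pr (λ p∣q → q≢p (sym (prime∣prime pr pq p∣q)))
  cop : Coprime p (q * q)
  cop = coprime-*ʳ cop₁ cop₁

μ-prime-∤ : ∀ {p a} .{{_ : NonZero a}} → Prime p → ¬ p ∣ a → μ (p * a) ≡ ℤ.- μ a
μ-prime-∤ {p} {a} pr p∤a = trans
  (cong₂ (λ b l → if b then 0ℤ else -1ℤ ℤ.^ l) (hasSquare-prime-∤ pr p∤a) (ω-prime-∤ pr p∤a))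
  (sign (hasSquare a) (length (primeDivisors a)))
  where
  sign : ∀ b l → (if b then 0ℤ else -1ℤ ℤ.^ suc l) ≡ ℤ.- (if b then 0ℤ else -1ℤ ℤ.^ l)
  sign true  l = refl
  sign false l = ℤ.-1*i≡-i (-1ℤ ℤ.^ l)

-- Ramanujan sums in Hölder's form

cofactor : ℕ → ℕ → ℕ
cofactor d i = d div gcd i d

C : ℕ → ℕ → ℤ
C d i = + (φ d div φ (cofactor d i)) *ᶻ μ (cofactor d i)

*-div : ∀ g a .{{_ : NonZero g}} → (g * a) div g ≡ a
*-div (suc g) a = trans (/-congˡ {suc g} (*-comm (suc g) a)) (m*n/n≡m a (suc g))

gcd-nonZero : ∀ i d .{{_ : NonZero d}} → NonZero (gcd i d)
gcd-nonZero i d {{d≢0}} = ≢-nonZero (λ e → ≢-nonZero⁻¹ d (gcd[m,n]≡0⇒n≡0 i {d} e))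

cofactor-unique : ∀ {d i g a} .{{_ : NonZero d}} → gcd i d ≡ g → d ≡ g * a → cofactor d i ≡ a
cofactor-unique {d} {i} {g} {a} refl e = trans (cong (_div gcd i d) e) (*-div (gcd i d) a {{gcd-nonZero i d}})

cofactor-* : ∀ d i .{{_ : NonZero d}} → d ≡ gcd i d * cofactor d i
cofactor-* d i with gcd[m,n]∣n i d
... | divides q e = trans e (trans (*-comm q (gcd i d))
      (cong (gcd i d *_) (sym (cofactor-unique {d} {i} refl (trans e (*-comm q (gcd i d)))))))

cofactor-nonZero : ∀ d i .{{_ : NonZero d}} → NonZero (cofactor d i)
cofactor-nonZero d i {{d≢0}} = ≢-nonZero (λ e → ≢-nonZero⁻¹ d (trans (cofactor-* d i) (trans (cong (gcd i d *_) e) (*-zeroʳ (gcd i d)))))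

-- Hölder's formula with the denominator cleared, which is legitimate because `φ-∣` makes the
-- quotient exact. Together with `C-unique` it serves to compute `C` without division.
C-φ : ∀ d i .{{_ : NonZero d}} → C d i *ᶻ + φ (cofactor d i) ≡ + φ d *ᶻ μ (cofactor d i)
C-φ d i with φ-∣ {cofactor d i} (gcd i d) {{gcd-nonZero i d}}
... | divides q e = trans (R.*-assoc _ _ _) (trans (cong (+ (φ d div φ a) *ᶻ_) (R.*-comm _ _)) (trans (sym (R.*-assoc _ _ _))
  (cong (_*ᶻ μ a) (trans (sym (*-homo (φ d div φ a) (φ a))) (cong +_ quot)))))
  where
  a = cofactor d i
  e′ : φ d ≡ q * φ a
  e′ = trans (cong φ (cofactor-* d i)) e
  quot : (φ d div φ a) * φ a ≡ φ d
  quot = trans (cong (λ x → (x div φ a) * φ a) (trans e′ (*-comm q (φ a))))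
    (trans (cong (_* φ a) (*-div (φ a) q {{φ-nonZero a {{cofactor-nonZero d i}}}})) (sym e′))

C-unique : ∀ {d i a x} .{{_ : NonZero d}} → cofactor d i ≡ a → x *ᶻ + φ a ≡ + φ d *ᶻ μ a → x ≡ C d i
C-unique {d} {i} {a} {x} refl eq = *ᶻ-cancelʳ x (C d i) (φ a) {{φ-nonZero a {{cofactor-nonZero d i}}}} (trans eq (sym (C-φ d i)))

C-cong : ∀ {d i j} → gcd i d ≡ gcd j d → C d i ≡ C d j
C-cong {d} = cong (λ g → + (φ d div φ (d div g)) *ᶻ μ (d div g))

C-+ : ∀ d s → C d (s + d) ≡ C d s
C-+ d s = C-cong {d} {s + d} {s} (gcd-+ s d)

opaque
  unfolding _+ᶻ_

  neg-shuffle : ∀ c x y z → x *ᶻ z ≡ y → (ℤ.- x) *ᶻ (c *ᶻ z) ≡ c *ᶻ (ℤ.- y)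
  neg-shuffle c x y z refl = identity c x z
    where
    identity : ∀ c x z → (ℤ.- x) ℤ.* (c ℤ.* z) ≡ c ℤ.* (ℤ.- (x ℤ.* z))
    identity = solve-∀

  *-neg : ∀ x y → x *ᶻ (ℤ.- y) ≡ ℤ.- (x *ᶻ y)
  *-neg x y = sym (ℤ.neg-distribʳ-* x y)

module _ {p d : ℕ} {{_ : NonZero d}} (pr : Prime p) where

  private
    pd≢0 : NonZero (p * d)
    pd≢0 = m*n≢0 p d {{prime⇒nonZero pr}}

  -- The gcd absorbs the factor p, so the cofactor stays the same and only φ(d) gains the factor p -
  -- 1.
  C-∤-∣ : ∀ i → ¬ p ∣ d → p ∣ i → C (p * d) i ≡ (+ p -ᶻ 1ℤ) *ᶻ C d i
  C-∤-∣ i p∤d p∣i@(divides i′ i≡) = sym (C-unique {p * d} {i} {{pd≢0}} (cofactor-unique {p * d} {i} {{pd≢0}} gcd≡ fact)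
    (trans (R.*-assoc _ _ _) (trans (cong (_ *ᶻ_) (C-φ d i)) (trans (sym (R.*-assoc _ _ _))
      (cong (_*ᶻ μ (cofactor d i)) (sym (φ-prime-∤ pr p∤d)))))))
    where
    i≡pi′ : i ≡ p * i′
    i≡pi′ = trans i≡ (*-comm i′ p)
    gcd≡ : gcd i (p * d) ≡ p * gcd i d
    gcd≡ = trans (cong (λ x → gcd x (p * d)) i≡pi′) (trans (sym (c*gcd[m,n]≡gcd[cm,cn] p i′ d))
      (cong (p *_) (trans (gcd-comm i′ d) (trans (sym (gcd-coprime-* i′ (Coprimality.sym (∤⇒coprime pr p∤d))))
        (trans (gcd-comm d (p * i′)) (cong (λ x → gcd x d) (sym i≡pi′)))))))
    fact : p * d ≡ p * gcd i d * cofactor d i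
    fact = trans (cong (p *_) (cofactor-* d i)) (sym (*-assoc p _ _))

  private
    module _ {i} (p∤i : ¬ p ∣ i) where
      cofactor-p∤i : cofactor (p * d) i ≡ p * cofactor d i
      cofactor-p∤i = cofactor-unique {p * d} {i} {{pd≢0}} (gcd-coprime-* d (Coprimality.sym (∤⇒coprime pr p∤i)))
        (trans (cong (p *_) (cofactor-* d i)) (trans (sym (*-assoc p (gcd i d) (cofactor d i)))
          (trans (cong (_* cofactor d i) (*-comm p (gcd i d))) (*-assoc (gcd i d) p (cofactor d i)))))

  -- The cofactor absorbs p: both totients gain p - 1, which cancels, and the Möbius value changes
  -- sign.
  C-∤-∤ : ∀ i → ¬ p ∣ d → ¬ p ∣ i → C (p * d) i ≡ ℤ.- C d i
  C-∤-∤ i p∤d p∤i = sym (C-unique {p * d} {i} {{pd≢0}} (cofactor-p∤i p∤i)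
    (trans (cong (ℤ.- C d i *ᶻ_) (φ-prime-∤ pr p∤a))
    (trans (neg-shuffle (+ p -ᶻ 1ℤ) (C d i) _ _ (C-φ d i))
    (trans (cong ((+ p -ᶻ 1ℤ) *ᶻ_) (sym (*-neg (+ φ d) (μ a))))
    (trans (sym (R.*-assoc _ _ _)) (cong₂ _*ᶻ_ (sym (φ-prime-∤ pr p∤d)) (sym (μ-prime-∤ {{cofactor-nonZero d i}} pr p∤a))))))))
    where
    a = cofactor d i
    p∤a : ¬ p ∣ a
    p∤a p∣a = p∤d (subst (p ∣_) (sym (cofactor-* d i)) (∣n⇒∣m*n (gcd i d) p∣a))

  -- The gcd is scaled by p and the cofactor is unchanged, while φ(p d) = p φ(d) because p ∣ d.
  C-∣-∣ : ∀ i → p ∣ d → C (p * d) (p * i) ≡ + p *ᶻ C d i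
  C-∣-∣ i p∣d = sym (C-unique {p * d} {p * i} {{pd≢0}} (cofactor-unique {p * d} {p * i} {{pd≢0}} (sym (c*gcd[m,n]≡gcd[cm,cn] p i d)) fact)
    (trans (R.*-assoc _ _ _) (trans (cong (_ *ᶻ_) (C-φ d i)) (trans (sym (R.*-assoc _ _ _))
      (cong (_*ᶻ μ (cofactor d i)) (sym (φ-prime-∣ pr p∣d)))))))
    where
    fact : p * d ≡ p * gcd i d * cofactor d i
    fact = trans (cong (p *_) (cofactor-* d i)) (sym (*-assoc p _ _))

  -- The cofactor of d already contains p, since the gcd with i does not; that of p d then contains
  -- p² and its Möbius value is 0.
  C-∣-∤ : ∀ i → p ∣ d → ¬ p ∣ i → C (p * d) i ≡ 0ℤ
  C-∣-∤ i p∣d p∤i = trans (cong (+ (φ (p * d) div φ (cofactor (p * d) i)) *ᶻ_)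
      (trans (cong μ (cofactor-p∤i p∤i)) (μ-square {{m*n≢0 p a {{prime⇒nonZero pr}} {{cofactor-nonZero d i}}}} pr (*-monoʳ-∣ p p∣a))))
    (R.zeroʳ _)
    where
    a = cofactor d i
    p∣a : p ∣ a
    p∣a with euclidsLemma (gcd i d) a pr (subst (p ∣_) (cofactor-* d i) p∣d)
    ... | inj₁ p∣g = ⊥-elim (p∤i (∣-trans p∣g (gcd[m,n]∣m i d)))
    ... | inj₂ p∣a = p∣a

  -- Multiplicativity in disguise: for p ∤ d the left side is (c_p(i) + c_1(i)) c_d(i), and the sum
  -- of the i-th powers of all p-th roots of unity is p or 0.
  C-∤ : ∀ i → ¬ p ∣ d → C (p * d) i +ᶻ C d i ≡ + p *ᶻ ⟦ p ∣? i ⟧ *ᶻ C d i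
  C-∤ i p∤d with p ∣? i
  ... | yes p∣i = trans (cong (_+ᶻ C d i) (C-∤-∣ i p∤d p∣i)) (trans (pred-*ᶻ (+ p) (C d i)) (cong (_*ᶻ C d i) (sym (R.*-identityʳ (+ p)))))
  ... | no p∤i = trans (cong (_+ᶻ C d i) (C-∤-∤ i p∤d p∤i)) (trans (R.-‿inverseˡ (C d i)) (sym (trans (cong (_*ᶻ C d i) (R.zeroʳ (+ p))) (R.zeroˡ _))))

-- Periods of integer functions and sums over residues

gcd-periodic : ∀ (f : ℕ → ℤ) a b → (∀ s → f (s + a) ≡ f s) → (∀ s → f (s + b) ≡ f s) → ∀ s → f (s + gcd a b) ≡ f s
gcd-periodic f a b pa pb s with Bézout.identity (gcd-GCD a b)
... | Bézout.+- x y eq = trans (sym (periodic-* b pb y (s + gcd a b))) (trans (cong f shuffle) (periodic-* a pa x s))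
  where
  shuffle : y * b + (s + gcd a b) ≡ x * a + s
  shuffle = trans (cong (λ z → y * b + z) (+-comm s (gcd a b))) (trans (sym (+-assoc (y * b) (gcd a b) s))
    (cong (_+ s) (trans (+-comm (y * b) (gcd a b)) eq)))
... | Bézout.-+ x y eq = trans (sym (periodic-* a pa x (s + gcd a b))) (trans (cong f shuffle) (periodic-* b pb y s))
  where
  shuffle : x * a + (s + gcd a b) ≡ y * b + s
  shuffle = trans (cong (λ z → x * a + z) (+-comm s (gcd a b))) (trans (sym (+-assoc (x * a) (gcd a b) s))
    (cong (_+ s) (trans (+-comm (x * a) (gcd a b)) eq)))

sumN-shift₁ : ∀ n f → f n ≡ f 0 → sumN n (f ∘ suc) ≡ sumN n f
sumN-shift₁ n f eq = +ᶻ-cancelʳ _ _ (f 0) (trans (R.+-comm _ _) (trans (sym (sumN-front n f))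
  (trans (sumN-suc n f) (cong (sumN n f +ᶻ_) eq))))

sumN-shift : ∀ n f → (∀ s → f (s + n) ≡ f s) → ∀ t → sumN n (λ s → f (s + t)) ≡ sumN n f
sumN-shift n f per zero    = sumL-cong (upTo n) (λ s → cong f (+-identityʳ s))
sumN-shift n f per (suc t) = trans (sumL-cong (upTo n) (λ s → cong f (+-suc s t)))
  (trans (sumN-shift₁ n (λ s → f (s + t)) (trans (cong f (+-comm n t)) (per t))) (sumN-shift n f per t))

-- As a function of s the sum has the periods p and d, hence the period gcd(p, d) = 1, and is
-- constant. Its mean over p consecutive values is 1, since for each fixed k exactly one of them
-- makes the argument a multiple of p.
multiple-once : ∀ {p d} → Prime p → ¬ p ∣ d → ∀ s → sumN p (λ k → ⟦ p ∣? (s + k * d) ⟧) ≡ 1ℤ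
multiple-once {p} {d} pr p∤d s = *ᶻ-cancelʳ _ _ p {{prime⇒nonZero pr}} (trans (R.*-comm _ _) (trans (sym (sumN-const p (h s))) (trans
    (sumL-cong (upTo p) (λ t → sym (trans (cong h (+-comm t s)) (constant t))))
    (trans (sumN-shift p h h-p s) (trans (sumL-swap (upTo p) (upTo p) _) (trans (sumL-cong (upTo p) once) (trans (sumN-const p 1ℤ) (R.*-comm _ _))))))))
  where
  ind : ℕ → ℤ
  ind s = ⟦ p ∣? s ⟧
  ind-p : ∀ s → ind (s + p) ≡ ind s
  ind-p s = ⟦⟧-cong (p ∣? (s + p)) (p ∣? s) (λ q → ∣m+n∣m⇒∣n (subst (p ∣_) (+-comm s p) q) ∣-refl) (λ q → ∣m∣n⇒∣m+n q ∣-refl)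
  h : ℕ → ℤ
  h s = sumN p (λ k → ind (s + k * d))
  h-p : ∀ s → h (s + p) ≡ h s
  h-p s = sumL-cong (upTo p) (λ k → trans (cong ind (trans (+-assoc s p (k * d)) (trans (cong (λ z → s + z) (+-comm p (k * d))) (sym (+-assoc s (k * d) p))))) (ind-p (s + k * d)))
  h-d : ∀ s → h (s + d) ≡ h s
  h-d s = trans (sumL-cong (upTo p) (λ k → cong ind (+-assoc s d (k * d))))
    (sumN-shift₁ p (λ k → ind (s + k * d)) (trans (cong ind (trans (cong (λ z → s + z) (*-comm p d)) (+-comm s (d * p)))) (trans (periodic-* p ind-p d s) (cong ind (sym (+-identityʳ s))))))
  h-1 : ∀ s → h (s + 1) ≡ h s
  h-1 s = trans (cong (λ g → h (s + g)) (sym (coprime⇒gcd≡1 {p} {d} (∤⇒coprime pr p∤d)))) (gcd-periodic h p d h-p h-d s)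
  constant : ∀ t → h (s + t) ≡ h s
  constant zero    = cong h (+-identityʳ s)
  constant (suc t) = trans (cong h (trans (cong (λ z → s + z) (sym (+-comm t 1))) (sym (+-assoc s t 1)))) (trans (h-1 (s + t)) (constant t))
  once : ∀ k → sumN p (λ t → ind (t + k * d)) ≡ 1ℤ
  once k = trans (sumN-shift p ind ind-p (k * d)) (trans
    (sumN-cong p (λ t t<p → trans (⟦⟧-cong (p ∣? t) (t ≟ 0) (small t t<p) (λ { refl → p ∣0 })) (sym (R.*-identityʳ _))))
    (sumN-δ p 0 (λ _ → 1ℤ) (>-nonZero⁻¹ p {{prime⇒nonZero pr}})))
    where
    small : ∀ t → t < p → p ∣ t → t ≡ 0
    small zero    _   _   = refl
    small (suc t) t<p p∣t = ⊥-elim (<⇒≱ t<p (∣⇒≤ p∣t))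

-- Sums over divisors

sumD : ℕ → (ℕ → ℤ) → ℤ
sumD n F = sum₁ n (λ d → ⟦ d ∣? n ⟧ *ᶻ F d)

sumD-bound : ∀ n N .{{_ : NonZero n}} F → n ≤ N → sum₁ N (λ d → ⟦ d ∣? n ⟧ *ᶻ F d) ≡ sumD n F
sumD-bound n N F n≤N = trans (cong (λ N → sum₁ N (λ d → ⟦ d ∣? n ⟧ *ᶻ F d)) (sym (m+[n∸m]≡n n≤N)))
  (sum₁-extend n (N ∸ n) _ (λ d n<d → no-* (d ∣? n) (λ d∣n → <⇒≱ n<d (∣⇒≤ d∣n)) (F d)))

-- A divisor of p n₀ either divides n₀, or is p d with d ∣ n₀ and p d ∤ n₀.
sumD-prime : ∀ {p n₀} .{{_ : NonZero n₀}} → Prime p → ∀ F →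
  sumD (p * n₀) F ≡ sumD n₀ F +ᶻ sumD n₀ (λ d → ⟦ ¬? (p * d ∣? n₀) ⟧ *ᶻ F (p * d))
sumD-prime {p} {n₀} pr F = trans (sumL-cong (upTo (p * n₀)) (λ d → split (suc d))) (trans (sumL-+ (upTo (p * n₀)) _ _)
  (cong₂ _+ᶻ_ (sumD-bound n₀ (p * n₀) F (m≤n*m n₀ p {{p≢0}}))
    (trans (cong (λ N → sum₁ N (λ d → ⟦ p ∣? d ⟧ *ᶻ G d)) (*-comm p n₀)) (trans (sum₁-multiples n₀ p {{p≢0}} G)
      (sumL-cong (upTo n₀) (λ d → new (suc d)))))))
  where
  p≢0 = prime⇒nonZero pr
  G : ℕ → ℤ
  G d = ⟦ d ∣? (p * n₀) ⟧ *ᶻ (⟦ ¬? (d ∣? n₀) ⟧ *ᶻ F d)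
  p∣new : ∀ {d} → d ∣ p * n₀ → ¬ d ∣ n₀ → p ∣ d
  p∣new {d} d∣pn d∤n with p ∣? d
  ... | yes p∣d = p∣d
  ... | no p∤d  = ⊥-elim (d∤n (coprime-divisor {d} {p} {n₀} (Coprimality.sym (∤⇒coprime pr p∤d)) d∣pn))
  split : ∀ d → ⟦ d ∣? (p * n₀) ⟧ *ᶻ F d ≡ ⟦ d ∣? n₀ ⟧ *ᶻ F d +ᶻ ⟦ p ∣? d ⟧ *ᶻ G d
  split d with d ∣? n₀
  ... | yes d∣n = trans (yes-* (d ∣? (p * n₀)) (∣n⇒∣m*n p d∣n) (F d)) (sym (trans (cong₂ _+ᶻ_ (R.*-identityˡ (F d))
          (trans (cong (⟦ p ∣? d ⟧ *ᶻ_) (trans (cong (⟦ d ∣? (p * n₀) ⟧ *ᶻ_) (R.zeroˡ (F d))) (R.zeroʳ _))) (R.zeroʳ _))) (R.+-identityʳ (F d))))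
  ... | no d∤n with d ∣? (p * n₀)
  ...   | yes d∣pn = sym (trans (cong₂ _+ᶻ_ (R.zeroˡ (F d)) (yes-* (p ∣? d) (p∣new d∣pn d∤n) _)) (trans (R.+-identityˡ _) (cong (1ℤ *ᶻ_) (R.*-identityˡ (F d)))))
  ...   | no d∤pn = trans (R.zeroˡ (F d)) (sym (trans (cong₂ _+ᶻ_ (R.zeroˡ (F d)) (trans (cong (⟦ p ∣? d ⟧ *ᶻ_) (R.zeroˡ _)) (R.zeroʳ _))) (R.+-identityˡ 0ℤ)))
  new : ∀ d → G (d * p) ≡ ⟦ d ∣? n₀ ⟧ *ᶻ (⟦ ¬? (p * d ∣? n₀) ⟧ *ᶻ F (p * d))
  new d = trans (cong G (*-comm d p)) (cong (_*ᶻ (⟦ ¬? (p * d ∣? n₀) ⟧ *ᶻ F (p * d)))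
    (⟦⟧-cong ((p * d) ∣? (p * n₀)) (d ∣? n₀) (*-cancelˡ-∣ p {{p≢0}}) (*-monoʳ-∣ p)))

opaque
  unfolding _+ᶻ_

  arrange₁ : ∀ p a n b → p *ᶻ a *ᶻ (n *ᶻ b) ≡ p *ᶻ n *ᶻ (b *ᶻ a)
  arrange₁ = solve-∀

  arrange₂ : ∀ x y p z w → x ≡ y → p *ᶻ z ≡ w → y +ᶻ (w -ᶻ x) ≡ p *ᶻ z
  arrange₂ x y p z w refl refl = identity x (p ℤ.* z)
    where
    identity : ∀ x w → x ℤ.+ (w ℤ.- x) ≡ w
    identity = solve-∀

  *ᶻ-distribˡ-∸ : ∀ p a b → p *ᶻ (a -ᶻ b) ≡ p *ᶻ a -ᶻ p *ᶻ b
  *ᶻ-distribˡ-∸ = solve-∀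

  add-sub : ∀ x y z → x ≡ y +ᶻ z → z ≡ x -ᶻ y
  add-sub x y z refl = identity y z
    where
    identity : ∀ y z → z ≡ (y ℤ.+ z) ℤ.- y
    identity = solve-∀

  x-x≡0 : ∀ x → x -ᶻ x ≡ 0ℤ
  x-x≡0 = ℤ.+-inverseʳ

prime-split : ∀ n .{{_ : NonZero n}} → n ≢ 1 → ∃ λ p → ∃ λ n₀ → Prime p × n ≡ p * n₀
prime-split n n≢1 with factorise n
... | record { factors = [] ; isFactorisation = e } = ⊥-elim (n≢1 e)
... | record { factors = p ∷ ps ; isFactorisation = e ; factorsPrime = pr ∷ _ } = p , product ps , pr , e

nonZero-factorʳ : ∀ {n} p {n₀} .{{_ : NonZero n}} → n ≡ p * n₀ → NonZero n₀
nonZero-factorʳ {n} p {n₀} e = ≢-nonZero (λ n₀≡0 → ≢-nonZero⁻¹ n (trans e (trans (cong (p *_) n₀≡0) (*-zeroʳ p))))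

factor-< : ∀ {p n₀} .{{_ : NonZero n₀}} → Prime p → n₀ < p * n₀
factor-< {p} {n₀} pr = subst (n₀ <_) (*-comm n₀ p) (m<m*n n₀ p (nonTrivial⇒n>1 p {{prime⇒nonTrivial pr}}))

-- Orthogonality of characters modulo n: the left side is the sum of ζⁱ over all n-th roots of
-- unity, grouped by their order.
Complete : ℕ → Set
Complete n = ∀ i → sumD n (λ d → C d i) ≡ + n *ᶻ ⟦ n ∣? i ⟧

module _ {p n₀ : ℕ} {{_ : NonZero n₀}} (pr : Prime p) where

  private
    p≢0 = prime⇒nonZero pr

  -- The divisors of p n₀ come in pairs d, p d with d ∣ n₀, and by `C-∤` each pair contributes p
  -- [p ∣ i] times the term of d.
  complete-∤ : ¬ p ∣ n₀ → Complete n₀ → Complete (p * n₀)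
  complete-∤ p∤n ih i = trans (sumD-prime pr (λ d → C d i)) (trans (R.+-comm _ _)
    (trans (sym (sumL-+ (upTo n₀) _ _)) (trans (sumL-cong (upTo n₀) (λ d → pointwise (suc d)))
    (trans (sumL-*ˡ (+ p *ᶻ ⟦ p ∣? i ⟧) (upTo n₀) _) (trans (cong (+ p *ᶻ ⟦ p ∣? i ⟧ *ᶻ_) (ih i))
    (trans (arrange₁ (+ p) ⟦ p ∣? i ⟧ (+ n₀) ⟦ n₀ ∣? i ⟧) (cong₂ _*ᶻ_ (sym (*-homo p n₀)) both)))))))
    where
    both : ⟦ n₀ ∣? i ⟧ *ᶻ ⟦ p ∣? i ⟧ ≡ ⟦ (p * n₀) ∣? i ⟧
    both = trans (sym (⟦⟧-× (n₀ ∣? i) (p ∣? i))) (⟦⟧-cong ((n₀ ∣? i) ×-dec (p ∣? i)) ((p * n₀) ∣? i) to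
      (λ q → m*n∣⇒n∣ p n₀ q , m*n∣⇒m∣ p n₀ q))
      where
      to : n₀ ∣ i × p ∣ i → p * n₀ ∣ i
      to (divides q e , p∣i) = subst (p * n₀ ∣_) (sym e) (*-monoˡ-∣ n₀ (coprime-divisor {p} {n₀} {q} (∤⇒coprime pr p∤n) (subst (p ∣_) (trans e (*-comm q n₀)) p∣i)))
    pointwise : ∀ d → ⟦ d ∣? n₀ ⟧ *ᶻ (⟦ ¬? (p * d ∣? n₀) ⟧ *ᶻ C (p * d) i) +ᶻ ⟦ d ∣? n₀ ⟧ *ᶻ C d i ≡ + p *ᶻ ⟦ p ∣? i ⟧ *ᶻ (⟦ d ∣? n₀ ⟧ *ᶻ C d i)
    pointwise d with d ∣? n₀
    ... | yes d∣n@(divides q e) = trans (cong₂ _+ᶻ_ (trans (R.*-identityˡ _) (yes-* (¬? (p * d ∣? n₀)) (λ pd∣n → p∤n (m*n∣⇒m∣ p d pd∣n)) _)) (R.*-identityˡ _))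
          (trans (C-∤ {p} {d} {{nonZero-factorʳ q e}} pr i (λ p∣d → p∤n (∣-trans p∣d d∣n))) (cong (+ p *ᶻ ⟦ p ∣? i ⟧ *ᶻ_) (sym (R.*-identityˡ _))))
    ... | no d∤n = trans (cong₂ _+ᶻ_ (R.zeroˡ _) (R.zeroˡ _)) (trans (R.+-identityˡ 0ℤ) (sym (trans (cong (+ p *ᶻ ⟦ p ∣? i ⟧ *ᶻ_) (R.zeroˡ _)) (R.zeroʳ _))))

  module _ {n₁} (n₀≡ : n₀ ≡ p * n₁) where

    private
      n₁≢0 : NonZero n₁
      n₁≢0 = nonZero-factorʳ p n₀≡

      new-p∣d : ∀ {d} → d ∣ n₀ → ¬ p * d ∣ n₀ → p ∣ d
      new-p∣d {d} d∣n pd∤n with p ∣? d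
      ... | yes p∣d = p∣d
      ... | no p∤d  = ⊥-elim (pd∤n (subst (p * d ∣_) (sym n₀≡) (*-monoʳ-∣ p
              (coprime-divisor {d} {p} {n₁} (Coprimality.sym (∤⇒coprime pr p∤d)) (subst (d ∣_) n₀≡ d∣n)))))

      d≢0 : ∀ {d} → d ∣ n₀ → NonZero d
      d≢0 (divides q e) = nonZero-factorʳ q e

    -- A new divisor p d has p ∣ d, so its term is 0 when p ∤ i; the old divisors sum to 0 because p
    -- ∣ n₀ excludes n₀ ∣ i.
    complete-∣-∤ : Complete n₀ → ∀ i → ¬ p ∣ i → sumD (p * n₀) (λ d → C d i) ≡ + (p * n₀) *ᶻ ⟦ (p * n₀) ∣? i ⟧
    complete-∣-∤ ih i p∤i = trans (sumD-prime pr (λ d → C d i)) (trans (cong₂ _+ᶻ_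
        (trans (ih i) (trans (cong (+ n₀ *ᶻ_) (⟦⟧-no (n₀ ∣? i) (λ q → p∤i (∣-trans (subst (p ∣_) (sym n₀≡) (m∣m*n n₁)) q)))) (R.zeroʳ _)))
        (trans (sumL-cong (upTo n₀) (λ d → vanish (suc d))) (sumL-zero (upTo n₀))))
      (trans (R.+-identityˡ 0ℤ) (sym (trans (cong (+ (p * n₀) *ᶻ_) (⟦⟧-no ((p * n₀) ∣? i) (λ q → p∤i (m*n∣⇒m∣ p n₀ q)))) (R.zeroʳ _)))))
      where
      vanish : ∀ d → ⟦ d ∣? n₀ ⟧ *ᶻ (⟦ ¬? (p * d ∣? n₀) ⟧ *ᶻ C (p * d) i) ≡ 0ℤ
      vanish d with d ∣? n₀
      ... | no _ = R.zeroˡ _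
      ... | yes d∣n with p * d ∣? n₀
      ...   | yes _    = trans (cong (1ℤ *ᶻ_) (R.zeroˡ _)) (R.zeroʳ _)
      ...   | no pd∤n = trans (R.*-identityˡ _) (trans (R.*-identityˡ _) (C-∣-∤ {p} {d} {{d≢0 d∣n}} pr i (new-p∣d d∣n pd∤n) p∤i))

    -- By `C-∣-∣` the new divisors contribute p times the sum of `C d i` over the divisors d of n₀
    -- that do not divide n₁, that is p n₀ [n₀ ∣ i] - p n₁ [n₁ ∣ i]. The subtracted term cancels the
    -- old divisors, which contribute n₀ [n₀ ∣ p i].
    complete-∣-∣ : Complete n₀ → Complete n₁ → ∀ i → sumD (p * n₀) (λ d → C d (p * i)) ≡ + (p * n₀) *ᶻ ⟦ (p * n₀) ∣? (p * i) ⟧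
    complete-∣-∣ ih₀ ih₁ i = trans (sumD-prime pr (λ d → C d (p * i))) (trans (cong₂ _+ᶻ_ (ih₀ (p * i))
        (trans (sumL-cong (upTo n₀) (λ d → pointwise (suc d))) (trans (sumL-*ˡ (+ p) (upTo n₀) _)
          (trans (cong (+ p *ᶻ_) difference) (*ᶻ-distribˡ-∸ (+ p) _ _)))))
      (trans (arrange₂ _ _ (+ p) (+ n₀ *ᶻ ⟦ n₀ ∣? i ⟧) _ lower refl)
        (trans (sym (R.*-assoc _ _ _)) (cong₂ _*ᶻ_ (sym (*-homo p n₀)) (⟦⟧-cong (n₀ ∣? i) ((p * n₀) ∣? (p * i)) (*-monoʳ-∣ p) (*-cancelˡ-∣ p {{p≢0}}))))))
      where
      pointwise : ∀ d → ⟦ d ∣? n₀ ⟧ *ᶻ (⟦ ¬? (p * d ∣? n₀) ⟧ *ᶻ C (p * d) (p * i)) ≡ + p *ᶻ (⟦ d ∣? n₀ ⟧ *ᶻ (⟦ ¬? (p * d ∣? n₀) ⟧ *ᶻ C d i))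
      pointwise d with d ∣? n₀
      ... | no _ = trans (R.zeroˡ _) (sym (trans (cong (+ p *ᶻ_) (R.zeroˡ _)) (R.zeroʳ _)))
      ... | yes d∣n with p * d ∣? n₀
      ...   | yes _ = trans (trans (cong (1ℤ *ᶻ_) (R.zeroˡ _)) (R.zeroʳ _)) (sym (trans (cong (+ p *ᶻ_) (trans (cong (1ℤ *ᶻ_) (R.zeroˡ _)) (R.zeroʳ _))) (R.zeroʳ _)))
      ...   | no pd∤n = trans (R.*-identityˡ _) (trans (R.*-identityˡ _) (trans (C-∣-∣ {p} {d} {{d≢0 d∣n}} pr i (new-p∣d d∣n pd∤n))
                (cong (+ p *ᶻ_) (sym (trans (R.*-identityˡ _) (R.*-identityˡ _))))))
      multiples : ∀ d → ⟦ d ∣? n₀ ⟧ *ᶻ C d i ≡ ⟦ d ∣? n₁ ⟧ *ᶻ C d i +ᶻ ⟦ d ∣? n₀ ⟧ *ᶻ (⟦ ¬? (p * d ∣? n₀) ⟧ *ᶻ C d i)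
      multiples d with d ∣? n₀ | p * d ∣? n₀
      ... | no d∤n  | _ = sym (trans (cong₂ _+ᶻ_ (no-* (d ∣? n₁) (λ q → d∤n (subst (d ∣_) (sym n₀≡) (∣n⇒∣m*n p q))) _) (R.zeroˡ _)) (trans (R.+-identityˡ 0ℤ) (sym (R.zeroˡ _))))
      ... | yes d∣n | yes pd∣n = sym (trans (cong₂ _+ᶻ_ (yes-* (d ∣? n₁) (*-cancelˡ-∣ p {{p≢0}} (subst (p * d ∣_) n₀≡ pd∣n)) _) (trans (cong (1ℤ *ᶻ_) (R.zeroˡ _)) (R.zeroʳ _)))
            (trans (R.+-identityʳ _) (sym (R.*-identityˡ _))))
      ... | yes d∣n | no pd∤n = sym (trans (cong₂ _+ᶻ_ (no-* (d ∣? n₁) (λ q → pd∤n (subst (p * d ∣_) (sym n₀≡) (*-monoʳ-∣ p q))) _) (cong (1ℤ *ᶻ_) (R.*-identityˡ _)))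
            (R.+-identityˡ _))
      difference : sumD n₀ (λ d → ⟦ ¬? (p * d ∣? n₀) ⟧ *ᶻ C d i) ≡ + n₀ *ᶻ ⟦ n₀ ∣? i ⟧ -ᶻ + n₁ *ᶻ ⟦ n₁ ∣? i ⟧
      difference = add-sub _ _ _ (trans (sym (ih₀ i)) (trans (sumL-cong (upTo n₀) (λ d → multiples (suc d))) (trans (sumL-+ (upTo n₀) _ _)
        (cong (_+ᶻ sumD n₀ (λ d → ⟦ ¬? (p * d ∣? n₀) ⟧ *ᶻ C d i)) (trans (sumD-bound n₁ n₀ {{n₁≢0}} (λ d → C d i) (subst (n₁ ≤_) (sym n₀≡) (m≤n*m n₁ p {{p≢0}}))) (ih₁ i))))))
      lower : + p *ᶻ (+ n₁ *ᶻ ⟦ n₁ ∣? i ⟧) ≡ + n₀ *ᶻ ⟦ n₀ ∣? (p * i) ⟧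
      lower = trans (sym (R.*-assoc _ _ _)) (cong₂ _*ᶻ_ (trans (sym (*-homo p n₁)) (cong +_ (sym n₀≡)))
        (⟦⟧-cong (n₁ ∣? i) (n₀ ∣? (p * i)) (λ q → subst (_∣ p * i) (sym n₀≡) (*-monoʳ-∣ p q)) (λ q → *-cancelˡ-∣ p {{p≢0}} (subst (_∣ p * i) n₀≡ q))))

-- Strong induction, because for p² ∣ n the step uses both n / p and n / p².
complete : ∀ n .{{_ : NonZero n}} → Complete n
complete n = <-rec (λ n → NonZero n → Complete n) step n (>-nonZero (>-nonZero⁻¹ n))
  where
  step : ∀ n → (∀ {k} → k < n → NonZero k → Complete k) → NonZero n → Complete n
  step n rec n≢0 with n ≟ 1
  ... | yes refl = λ i → trans (R.+-identityʳ _) (trans (R.*-identityˡ _) (trans (C-1 i) (sym (trans (R.*-identityˡ _) (⟦⟧-yes (1 ∣? i) (1∣ i))))))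
    where
    C-1 : ∀ i → C 1 i ≡ 1ℤ
    C-1 i = sym (C-unique {1} {i} {1} (cofactor-unique {1} {i} {1} {1} (∣1⇒≡1 (gcd[m,n]∣n i 1)) refl) refl)
  ... | no n≢1 with prime-split n {{n≢0}} n≢1
  ...   | p , n₀ , pr , refl with nonZero-factorʳ {p * n₀} p {{n≢0}} refl
  ...     | n₀≢0 with p ∣? n₀
  ...       | no p∤n = complete-∤ {{n₀≢0}} pr p∤n (rec (factor-< {{n₀≢0}} pr) n₀≢0)
  ...       | yes (divides n₁ e) = go
    where
    n₀≡ : n₀ ≡ p * n₁
    n₀≡ = trans e (*-comm n₁ p)
    n₁≢0 : NonZero n₁
    n₁≢0 = nonZero-factorʳ p {{n₀≢0}} n₀≡
    c₀ : Complete n₀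
    c₀ = rec (factor-< {{n₀≢0}} pr) n₀≢0
    c₁ : Complete n₁
    c₁ = rec (<-trans (subst (n₁ <_) (sym n₀≡) (factor-< {{n₁≢0}} pr)) (factor-< {{n₀≢0}} pr)) n₁≢0
    go : Complete (p * n₀)
    go i with p ∣? i
    ... | no p∤i = complete-∣-∤ {{n₀≢0}} pr n₀≡ c₀ i p∤i
    ... | yes (divides i′ e) = subst (λ i → sumD (p * n₀) (λ d → C d i) ≡ + (p * n₀) *ᶻ ⟦ (p * n₀) ∣? i ⟧) (trans (*-comm p i′) (sym e))
            (complete-∣-∣ {{n₀≢0}} pr n₀≡ c₀ c₁ i′)

-- Ramanujan sums are primitive functions

-- For ζ of order p d, ζᵈ is a primitive p-th root of unity, whose powers sum to 0. Without ζ: if p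
-- ∤ d, add p copies of `C d s`; by `C-∤` only the single k with p ∣ s + k d remains, and it
-- contributes the amount added. If p ∣ d, every term vanishes for p ∤ s, and otherwise p is divided
-- out of s and d.
C-prime-sum : ∀ {p} → Prime p → ∀ d .{{_ : NonZero d}} s → sumN p (λ k → C (p * d) (s + k * d)) ≡ 0ℤ
C-prime-sum {p} pr d = <-rec (λ d → NonZero d → ∀ s → sumN p (λ k → C (p * d) (s + k * d)) ≡ 0ℤ) step d (>-nonZero (>-nonZero⁻¹ d))
  where
  step : ∀ d → (∀ {k} → k < d → NonZero k → ∀ s → sumN p (λ j → C (p * k) (s + j * k)) ≡ 0ℤ) → NonZero d → ∀ s → sumN p (λ k → C (p * d) (s + k * d)) ≡ 0ℤ
  step d rec d≢0 s with p ∣? d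
  ... | no p∤d = +ᶻ-cancelʳ _ _ (+ p *ᶻ C d s) (trans
        (cong (sumN p (λ k → C (p * d) (s + k * d)) +ᶻ_) (trans (sym (sumN-const p (C d s))) (sumL-cong (upTo p) (λ k → sym (C-shift k)))))
        (trans (sym (sumL-+ (upTo p) _ _)) (trans
          (sumL-cong (upTo p) (λ k → trans (C-∤ {{d≢0}} pr (s + k * d) p∤d) (trans (cong (+ p *ᶻ ⟦ p ∣? (s + k * d) ⟧ *ᶻ_) (C-shift k))
             (trans (R.*-assoc _ _ _) (trans (cong (+ p *ᶻ_) (R.*-comm _ _)) (sym (R.*-assoc _ _ _)))))))
          (trans (sumL-*ˡ (+ p *ᶻ C d s) (upTo p) _) (trans (cong (+ p *ᶻ C d s *ᶻ_) (multiple-once pr p∤d s))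
            (trans (R.*-identityʳ _) (sym (R.+-identityˡ _))))))))
    where
    C-shift : ∀ k → C d (s + k * d) ≡ C d s
    C-shift k = trans (cong (C d) (+-comm s (k * d))) (periodic-* {C d} d (C-+ d) k s)
  ... | yes p∣d@(divides d′ e) with p ∣? s
  ...   | no p∤s = trans (sumL-cong (upTo p) (λ k → C-∣-∤ {{d≢0}} pr (s + k * d) p∣d
            (λ q → p∤s (∣m+n∣m⇒∣n (subst (p ∣_) (+-comm s (k * d)) q) (∣n⇒∣m*n k p∣d))))) (sumL-zero (upTo p))
  ...   | yes (divides s′ e′) = trans (sumL-cong (upTo p) (λ k → trans (cong (C (p * d)) (arg k)) (trans (C-∣-∣ {{d≢0}} pr (s′ + k * d′) p∣d)
            (cong (λ x → + p *ᶻ C x (s′ + k * d′)) d≡))))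
          (trans (sumL-*ˡ (+ p) (upTo p) _) (trans (cong (+ p *ᶻ_) (rec d′<d d′≢0 s′)) (R.zeroʳ _)))
    where
    d≡ : d ≡ p * d′
    d≡ = trans e (*-comm d′ p)
    d′≢0 : NonZero d′
    d′≢0 = nonZero-factorʳ p {{d≢0}} d≡
    d′<d : d′ < d
    d′<d = subst (d′ <_) (sym d≡) (factor-< {{d′≢0}} pr)
    arg : ∀ k → s + k * d ≡ p * (s′ + k * d′)
    arg k = trans (cong₂ _+_ (trans e′ (*-comm s′ p)) (trans (cong (k *_) d≡) (trans (sym (*-assoc k p d′)) (trans (cong (_* d′) (*-comm k p)) (*-assoc p k d′)))))
      (sym (*-distribˡ-+ p s′ (k * d′)))

-- Stands for "f is a combination of the functions s ↦ ζˢ with ζ a primitive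
-- d-th root of unity".
record Primitive (d : ℕ) (f : ℕ → ℤ) : Set where
  field
    periodic : ∀ s → f (s + d) ≡ f s
    cancel   : ∀ k → 0 < k → k < d → ∀ s → sumN d (λ c → f (s + c * k)) ≡ 0ℤ

open Primitive

primitive-shift : ∀ {d f} t → Primitive d f → Primitive d (λ s → f (s + t))
primitive-shift {d} {f} t P .periodic s = trans (cong f (trans (+-assoc s d t) (trans (cong (λ z → s + z) (+-comm d t)) (sym (+-assoc s t d))))) (periodic P (s + t))
primitive-shift {d} {f} t P .cancel k 0<k k<d s = trans
  (sumL-cong (upTo d) (λ c → cong f (trans (+-assoc s (c * k) t) (trans (cong (λ z → s + z) (+-comm (c * k) t)) (sym (+-assoc s t (c * k)))))))
  (cancel P k 0<k k<d (s + t))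

-- The sum in `cancel` has, as a function of s, the periods k and d, hence gcd(k, d). As k < d, some
-- prime p divides d / gcd(k, d), so d / p is a period too. Averaging over the p shifts by multiples
-- of d / p produces the vanishing sums of `C-prime-sum`.
primitive-C : ∀ d .{{_ : NonZero d}} → Primitive d (C d)
primitive-C d .periodic = C-+ d
primitive-C d .cancel k 0<k k<d s with gcd[m,n]∣n k d
... | divides q d≡qg with prime-split q {{nonZero-factorʳ (gcd k d) (trans d≡qg (*-comm q (gcd k d)))}} q≢1
  where
  q≢1 : q ≢ 1
  q≢1 refl = <⇒≱ k<d (∣⇒≤ {{>-nonZero 0<k}} (subst (_∣ k) (trans (sym (*-identityˡ (gcd k d))) (sym d≡qg)) (gcd[m,n]∣m k d)))
... | p , q₀ , pr , refl = *ᶻ-cancelʳ _ _ p {{prime⇒nonZero pr}} (trans (R.*-comm _ _) (trans (sym (sumN-const p (U s)))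
      (trans (sumL-cong (upTo p) (λ j → sym (trans (cong U (+-comm s (j * d₁))) (periodic-* d₁ U-d₁ j s))))
      (trans (sumL-swap (upTo p) (upTo d) _) (trans (sumL-cong (upTo d) (λ c → trans
          (sumL-cong (upTo p) (λ j → cong₂ C d≡pd₁ (trans (+-assoc s (j * d₁) (c * k)) (trans (cong (λ z → s + z) (+-comm (j * d₁) (c * k))) (sym (+-assoc s (c * k) (j * d₁)))))))
          (C-prime-sum pr d₁ {{d₁≢0}} (s + c * k))))
      (trans (sumL-zero (upTo d)) (sym (R.zeroˡ _))))))))
  where
  d₁ = q₀ * gcd k d
  d≡pd₁ : d ≡ p * d₁
  d≡pd₁ = trans d≡qg (*-assoc p q₀ (gcd k d))
  d₁≢0 : NonZero d₁
  d₁≢0 = nonZero-factorʳ p d≡pd₁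
  U : ℕ → ℤ
  U s = sumN d (λ c → C d (s + c * k))
  U-d : ∀ s → U (s + d) ≡ U s
  U-d s = sumL-cong (upTo d) (λ c → trans (cong (C d) (trans (+-assoc s d (c * k)) (trans (cong (λ z → s + z) (+-comm d (c * k))) (sym (+-assoc s (c * k) d))))) (C-+ d (s + c * k)))
  U-k : ∀ s → U (s + k) ≡ U s
  U-k s = trans (sumL-cong (upTo d) (λ c → cong (C d) (+-assoc s k (c * k))))
    (sumN-shift₁ d (λ c → C d (s + c * k)) (trans (cong (C d) (trans (cong (λ z → s + z) (*-comm d k)) (+-comm s (k * d))))
       (trans (periodic-* {C d} d (C-+ d) k s) (cong (C d) (sym (+-identityʳ s))))))
  U-d₁ : ∀ s → U (s + d₁) ≡ U s
  U-d₁ s = trans (cong U (+-comm s d₁)) (periodic-* (gcd k d) (gcd-periodic U k d U-k U-d) q₀ s)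

-- Rotation of words

count : ℕ → List ℕ → ℕ
count v []      = 0
count v (x ∷ w) = (if v ≡ᵇ x then 1 else 0) + count v w

SameCounts : List ℕ → List ℕ → Set
SameCounts u w = ∀ v → count v u ≡ count v w

count-++ : ∀ v u w → count v (u ++ w) ≡ count v u + count v w
count-++ v []      w = refl
count-++ v (x ∷ u) w = trans (cong (λ z → (if v ≡ᵇ x then 1 else 0) + z) (count-++ v u w)) (sym (+-assoc (if v ≡ᵇ x then 1 else 0) (count v u) (count v w)))

rot : List ℕ → List ℕ
rot []      = []
rot (a ∷ w) = w ++ a ∷ []

rot-counts : ∀ u → SameCounts (rot u) u
rot-counts []      v = refl
rot-counts (a ∷ u) v = trans (count-++ v u (a ∷ [])) (trans (+-comm (count v u) _) (cong (λ z → z + count v u) (+-identityʳ (if v ≡ᵇ a then 1 else 0))))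

rot^ : ℕ → List ℕ → List ℕ
rot^ zero    u = u
rot^ (suc c) u = rot^ c (rot u)

rot^-counts : ∀ c u → SameCounts (rot^ c u) u
rot^-counts zero    u v = refl
rot^-counts (suc c) u v = trans (rot^-counts c (rot u) v) (rot-counts u v)

length-rot : ∀ u → length (rot u) ≡ length u
length-rot []      = refl
length-rot (a ∷ u) = trans (List.length-++ u) (+-comm (length u) 1)

sumW-∷ʳ : ∀ n k Φ → sumW n (suc k) Φ ≡ sum₁ n (λ a → sumW n k (λ w → Φ (w ++ a ∷ [])))
sumW-∷ʳ n zero    Φ = sumW-cons n 0 Φ
sumW-∷ʳ n (suc k) Φ = trans (sumW-cons n (suc k) Φ) (trans
  (sumL-cong (upTo n) (λ b → sumW-∷ʳ n k (λ w → Φ (suc b ∷ w))))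
  (trans (sumL-swap (upTo n) (upTo n) _)
    (sumL-cong (upTo n) (λ a → sym (sumW-cons n k (λ w → Φ (w ++ suc a ∷ [])))))))

sumW-rot : ∀ n k Φ → sumW n k (λ u → Φ (rot u)) ≡ sumW n k Φ
sumW-rot n zero    Φ = refl
sumW-rot n (suc k) Φ = trans (sumW-cons n k _) (sym (sumW-∷ʳ n k Φ))

sumW-rot^ : ∀ n k c Φ → sumW n k (λ u → Φ (rot^ c u)) ≡ sumW n k Φ
sumW-rot^ n k zero    Φ = refl
sumW-rot^ n k (suc c) Φ = trans (sumW-rot n k (λ u → Φ (rot^ c u))) (sumW-rot^ n k c Φ)

-- Major index and cyclic descents under rotation

descent : ℕ → ℕ → ℕ
descent a b = if b <ᵇ a then 1 else 0

des : List ℕ → ℕ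
des []          = 0
des (a ∷ [])    = 0
des (a ∷ b ∷ w) = descent a b + des (b ∷ w)

majFrom-∷∷ : ∀ i a b w → majFrom i (a ∷ b ∷ w) ≡ descent a b * i + majFrom (suc i) (b ∷ w)
majFrom-∷∷ i a b w with b <ᵇ a
... | true  = cong (λ z → z + majFrom (suc i) (b ∷ w)) (sym (+-identityʳ i))
... | false = refl

majFrom-suc : ∀ i w → majFrom (suc i) w ≡ majFrom i w + des w
majFrom-suc i []          = refl
majFrom-suc i (a ∷ [])    = refl
majFrom-suc i (a ∷ b ∷ w) = trans (majFrom-∷∷ (suc i) a b w) (trans (cong (λ z → descent a b * suc i + z) (majFrom-suc (suc i) (b ∷ w)))
  (trans (arrange (descent a b) i _ _) (cong (λ z → z + (descent a b + des (b ∷ w))) (sym (majFrom-∷∷ i a b w)))))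
  where
  open +-*-Solver
  arrange : ∀ e i x y → e * suc i + (x + y) ≡ e * i + x + (e + y)
  arrange = solve 4 (λ e i x y → e :* (con 1 :+ i) :+ (x :+ y) := e :* i :+ x :+ (e :+ y)) refl

-- The witness is the descent from the last letter of `b ∷ w` to `a`. One witness must serve `des`
-- and `majFrom` at every offset, since `maj-rot` combines the two.
snoc-maj : ∀ a b w → ∃ λ e → des (b ∷ w ++ a ∷ []) ≡ des (b ∷ w) + e × (∀ i → majFrom i (b ∷ w ++ a ∷ []) ≡ majFrom i (b ∷ w) + e * (i + length w))
snoc-maj a b []      = descent b a , +-comm (descent b a) 0 , λ i → trans (majFrom-∷∷ i b a []) (trans (+-identityʳ _) (cong (descent b a *_) (sym (+-identityʳ i))))
snoc-maj a b (c ∷ w) with snoc-maj a c w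
... | e , eq , eqm = e , trans (cong (λ z → descent b c + z) eq) (sym (+-assoc (descent b c) _ e)) , λ i →
      trans (majFrom-∷∷ i b c (w ++ a ∷ [])) (trans (cong (λ z → descent b c * i + z) (eqm (suc i))) (trans (sym (+-assoc (descent b c * i) _ _))
        (cong₂ _+_ (sym (majFrom-∷∷ i b c w)) (cong (e *_) (sym (+-suc i (length w)))))))

cdes : List ℕ → ℕ
cdes []      = 0
cdes (a ∷ w) = des (a ∷ w ++ a ∷ [])

des-snoc : ∀ u a b → des (u ++ a ∷ b ∷ []) ≡ des (u ++ a ∷ []) + descent a b
des-snoc []          a b = +-identityʳ _
des-snoc (x ∷ [])    a b = trans (cong (λ z → descent x a + z) (+-identityʳ _)) (cong (λ z → z + descent a b) (sym (+-identityʳ (descent x a))))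
des-snoc (x ∷ y ∷ u) a b = trans (cong (λ z → descent x y + z) (des-snoc (y ∷ u) a b)) (sym (+-assoc (descent x y) _ _))

cdes-rot : ∀ u → cdes (rot u) ≡ cdes u
cdes-rot []          = refl
cdes-rot (a ∷ [])    = refl
cdes-rot (a ∷ b ∷ w) = trans (cong des (List.++-assoc (b ∷ w) (a ∷ []) (b ∷ []))) (trans (des-snoc (b ∷ w) a b) (+-comm _ (descent a b)))

-- Each cyclic descent moves one place to the left, a descent at place 1 dropping out. The
-- wrap-around descent, counted at place 0 before, reappears at place `length u` - 1; hence e is
-- that descent.
maj-rot : ∀ u → ∃ λ e → maj (rot u) + cdes u ≡ maj u + e * length u
maj-rot []          = 0 , refl
maj-rot (a ∷ [])    = des (a ∷ a ∷ []) , trans (sym (*-identityʳ _)) refl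
maj-rot (a ∷ b ∷ w) with snoc-maj a b w
... | e , eq , eqm = e , trans (cong₂ _+_ (eqm 1) (cong (λ z → descent a b + z) eq))
      (trans (arrange (majFrom 1 (b ∷ w)) e (length w) (descent a b) (des (b ∷ w)))
        (cong (λ z → z + e * suc (suc (length w))) (sym (trans (majFrom-∷∷ 1 a b w) (cong₂ _+_ (*-identityʳ (descent a b)) (majFrom-suc 1 (b ∷ w)))))))
  where
  open +-*-Solver
  arrange : ∀ x e l y z → x + e * (1 + l) + (y + (z + e)) ≡ y + (x + z) + e * suc (suc l)
  arrange = solve 5 (λ x e l y z → x :+ e :* (con 1 :+ l) :+ (y :+ (z :+ e)) := y :+ (x :+ z) :+ e :* (con 2 :+ l)) refl

descent≤1 : ∀ a b → descent a b ≤ 1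
descent≤1 a b with b <ᵇ a
... | true  = ≤-refl
... | false = z≤n

descent≡0 : ∀ {a b} → descent a b ≡ 0 → a ≤ b
descent≡0 {a} {b} eq with b <ᵇ a in e
... | false = ≮⇒≥ (λ b<a → subst T e (<⇒<ᵇ b<a))

descent≡1 : ∀ {a b} → descent a b ≡ 1 → b < a
descent≡1 {a} {b} eq with b <ᵇ a in e
... | true = <ᵇ⇒< b a (subst T (sym e) tt)

des≡0 : ∀ a w b → des (a ∷ w ++ b ∷ []) ≡ 0 → All (λ x → a ≤ x × x ≤ b) w × a ≤ b
des≡0 a []      b eq = [] , descent≡0 (m+n≡0⇒m≡0 (descent a b) eq)
des≡0 a (c ∷ w) b eq with des≡0 c w b (m+n≡0⇒n≡0 (descent a c) eq)
... | all , c≤b = (a≤c , c≤b) ∷ All.map (λ (c≤x , x≤b) → ≤-trans a≤c c≤x , x≤b) all , ≤-trans a≤c c≤b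
  where
  a≤c : a ≤ c
  a≤c = descent≡0 (m+n≡0⇒m≡0 (descent a c) eq)

des-≤ : ∀ a w b → des (a ∷ w ++ b ∷ []) ≤ suc (length w)
des-≤ a []      b = subst (_≤ 1) (sym (+-identityʳ _)) (descent≤1 a b)
des-≤ a (c ∷ w) b = +-mono-≤ (descent≤1 a c) (des-≤ c w b)

des≡length : ∀ a w b → des (a ∷ w ++ b ∷ []) ≡ suc (length w) → b < a
des≡length a []      b eq = descent≡1 (trans (sym (+-identityʳ _)) eq)
des≡length a (c ∷ w) b eq = <-trans (des≡length c w b full) (descent≡1 one)
  where
  full : des (c ∷ w ++ b ∷ []) ≡ suc (length w)
  full = ≤-antisym (des-≤ c w b) (≤-pred (≤-trans (≤-reflexive (sym eq)) (+-monoˡ-≤ _ (descent≤1 a c))))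
  one : descent a c ≡ 1
  one = +-cancelʳ-≡ (suc (length w)) (descent a c) 1 (trans (cong (λ z → descent a c + z) (sym full)) eq)

All≡⇒replicate : ∀ {a : ℕ} {w} → All (_≡ a) w → w ≡ replicate (length w) a
All≡⇒replicate []         = refl
All≡⇒replicate (refl ∷ p) = cong (_ ∷_) (All≡⇒replicate p)

-- Without a cyclic descent the letters increase weakly all the way around the cycle, hence are
-- equal.
cdes>0 : ∀ a w → w ≢ replicate (length w) a → 0 < cdes (a ∷ w)
cdes>0 a w nc = n≢0⇒n>0 (λ e → nc (All≡⇒replicate (All.map (λ (l , u) → ≤-antisym u l) (proj₁ (des≡0 a w a e)))))

-- If every cyclic step were a descent, going around once would give a < a.
cdes<length : ∀ a w → cdes (a ∷ w) < length (a ∷ w)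
cdes<length a w = ≤∧≢⇒< (des-≤ a w a) (λ e → <-irrefl refl (des≡length a w a e))

rot-replicate : ∀ d a → rot (replicate d a) ≡ replicate d a
rot-replicate zero          a = refl
rot-replicate (suc zero)    a = refl
rot-replicate (suc (suc d)) a = cong (a ∷_) (rot-replicate (suc d) a)

rot^-replicate : ∀ c d a → rot^ c (replicate d a) ≡ replicate d a
rot^-replicate zero    d a = refl
rot^-replicate (suc c) d a = trans (cong (rot^ c) (rot-replicate d a)) (rot^-replicate c d a)

majFrom-replicate : ∀ i d a → majFrom i (replicate d a) ≡ 0
majFrom-replicate i zero          a = refl
majFrom-replicate i (suc zero)    a = refl
majFrom-replicate i (suc (suc d)) a = trans (majFrom-∷∷ i a a (replicate d a))
  (cong₂ (λ x y → x * i + y) (cong (λ b → if b then 1 else 0) (irrefl a)) (majFrom-replicate (suc i) (suc d) a))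
  where
  irrefl : ∀ a → (a <ᵇ a) ≡ false
  irrefl zero    = refl
  irrefl (suc a) = irrefl a

periodic-multiple : ∀ {d f} → Primitive d f → ∀ e s → f (s + e * d) ≡ f s
periodic-multiple {d} {f} P e s = trans (cong f (+-comm s (e * d))) (periodic-* {f} d (periodic P) e s)

-- Here `k` represents - `cdes u` modulo the length.
maj-rot^ : ∀ {f k} u → Primitive (length u) f → cdes u + k ≡ length u → ∀ c s → f (maj (rot^ c u) + s) ≡ f (maj u + s + c * k)
maj-rot^ {f} {k} u P k≡ zero    s = cong f (sym (+-identityʳ (maj u + s)))
maj-rot^ {f} {k} u P k≡ (suc c) s = trans
  (maj-rot^ (rot u) (subst (λ l → Primitive l f) (sym (length-rot u)) P) (trans (cong (λ z → z + k) (cdes-rot u)) (trans k≡ (sym (length-rot u)))) c s)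
  -- One period, `cdes u + k`, is added to the argument so that subtracting `cdes u` becomes adding
  -- `k`.
  (trans (sym (periodic P _)) (trans (cong f arrange) (trans (periodic-multiple P e (maj u + s + suc c * k)) refl)))
  where
  e = proj₁ (maj-rot u)
  arrange : maj (rot u) + s + c * k + length u ≡ maj u + s + suc c * k + e * length u
  arrange = trans (cong (λ z → maj (rot u) + s + c * k + z) (sym k≡)) (trans (shuffle₁ (maj (rot u)) s (c * k) (cdes u) k)
    (trans (cong (λ z → z + (s + (k + c * k))) (proj₂ (maj-rot u))) (shuffle₂ (maj u) (e * length u) s (k + c * k))))
    where
    open +-*-Solver
    shuffle₁ : ∀ x s y z k → x + s + y + (z + k) ≡ x + z + (s + (k + y))
    shuffle₁ = solve 5 (λ x s y z k → x :+ s :+ y :+ (z :+ k) := x :+ z :+ (s :+ (k :+ y))) refl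
    shuffle₂ : ∀ x y s z → x + y + (s + z) ≡ x + s + z + y
    shuffle₂ = solve 4 (λ x y s z → x :+ y :+ (s :+ z) := x :+ s :+ z :+ y) refl

-- Weights of this kind are constant on rotation orbits. Unlike the indicators of one fixed content,
-- they form a class closed under fixing the letters of a block, which the induction over blocks
-- needs.
Symmetric : (List ℕ → ℤ) → Set
Symmetric I = ∀ u w → SameCounts u w → I u ≡ I w

-- Rotating a non-constant word of length d shifts maj by a fixed amount
-- strictly between 0 and d modulo d, so its orbit contributes nothing.
block-sum : ∀ n d .{{_ : NonZero d}} {f I} → Primitive d f → Symmetric I → ∀ s →
  sumW n d (λ u → I u *ᶻ f (maj u + s)) ≡ sum₁ n (λ a → I (replicate d a) *ᶻ f s)
-- Multiplying by the length makes room for a sum over all rotations, under each of which the sum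
-- over words is invariant.
block-sum n (suc d) {f} {I} P sym-I s = *ᶻ-cancelʳ _ _ (suc d) (trans (R.*-comm _ _) (trans (sym (sumN-const (suc d) _))
  (trans (sumL-cong (upTo (suc d)) (λ c → sym (sumW-rot^ n (suc d) c Φ)))
  (trans (sumL-swap (upTo (suc d)) (words n (suc d)) _)
  (trans (sumW-cong n (suc d) {Ψ = Ψ} orbit)
  (trans (sumW-cons n d Ψ) (trans (sum₁-cong n (λ a 1≤a a≤n → trans
      (sumW-δ n d (replicate d a) (λ w → + suc d *ᶻ Φ (a ∷ w)) (List.length-replicate d , replicate⁺ d (1≤a , a≤n)))
      (cong (λ z → + suc d *ᶻ (I (replicate (suc d) a) *ᶻ f (z + s))) (majFrom-replicate 1 (suc d) a))))
  (trans (sumL-*ˡ (+ suc d) (upTo n) _) (R.*-comm _ _)))))))))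
  where
  Φ : List ℕ → ℤ
  Φ u = I u *ᶻ f (maj u + s)
  Ψ : List ℕ → ℤ
  Ψ []      = 0ℤ
  Ψ (a ∷ w) = ⟦ w ≟ʷ replicate d a ⟧ *ᶻ (+ suc d *ᶻ Φ (a ∷ w))
  replicate⁺ : ∀ {A : Set} {Q : A → Set} k {x} → Q x → All Q (replicate k x)
  replicate⁺ zero    q = []
  replicate⁺ (suc k) q = q ∷ replicate⁺ k q
  orbit : ∀ u → IsWord n (suc d) u → sumN (suc d) (λ c → Φ (rot^ c u)) ≡ Ψ u
  orbit (a ∷ w) (l , _) with w ≟ʷ replicate d a
  ... | yes refl = trans (sumL-cong (upTo (suc d)) (λ c → cong Φ (rot^-replicate c (suc d) a)))
        (trans (sumN-const (suc d) _) (sym (R.*-identityˡ _)))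
  ... | no w≢ = trans (sumL-cong (upTo (suc d)) (λ c → cong₂ _*ᶻ_ (sym-I _ _ (rot^-counts c (a ∷ w)))
            (maj-rot^ (a ∷ w) (subst (λ l → Primitive l f) (sym l) P) k≡ c s)))
        (trans (sumL-*ˡ (I (a ∷ w)) (upTo (suc d)) _) (trans (cong (I (a ∷ w) *ᶻ_) (cancel P k 0<k k<d (maj (a ∷ w) + s)))
          (trans (R.zeroʳ _) (sym (R.zeroˡ _)))))
    where
    κ = cdes (a ∷ w)
    k = suc d ∸ κ
    κ<d : κ < suc d
    κ<d = subst (κ <_) l (cdes<length a w)
    0<κ : 0 < κ
    0<κ = cdes>0 a w (λ e → w≢ (trans e (cong (λ z → replicate z a) (suc-injective l))))
    k≡ : κ + k ≡ length (a ∷ w)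
    k≡ = trans (m+[n∸m]≡n (<⇒≤ κ<d)) (sym l)
    0<k : 0 < k
    0<k = m<n⇒0<n∸m κ<d
    k<d : k < suc d
    k<d = ∸-monoʳ-< {suc d} 0<κ (<⇒≤ κ<d)

-- Cutting words into blocks

-- The witness is the descent across the junction, 0 if one side is empty. With the first letter at
-- place `suc i`, the junction lies at place `i + length u`.
majFrom-++ : ∀ i u w → ∃ λ e → majFrom (suc i) (u ++ w) ≡ majFrom (suc i) u + majFrom (suc i + length u) w + e * (i + length u)
majFrom-++ i []          w       = 0 , sym (trans (+-identityʳ _) (cong (λ z → majFrom z w) (+-identityʳ (suc i))))
majFrom-++ i (x ∷ [])    []      = 0 , refl
majFrom-++ i (x ∷ [])    (y ∷ w) = descent x y , trans (majFrom-∷∷ (suc i) x y w) (trans (+-comm _ (majFrom (2 + i) (y ∷ w)))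
  (cong₂ (λ z z′ → majFrom z (y ∷ w) + descent x y * z′) (cong suc (+-comm 1 i)) (+-comm 1 i)))
majFrom-++ i (x ∷ y ∷ u) w       with majFrom-++ (suc i) (y ∷ u) w
... | e , eq = e , trans (majFrom-∷∷ (suc i) x y (u ++ w)) (trans (cong (λ z → descent x y * suc i + z) eq)
      (trans (arrange (descent x y * suc i) (majFrom (2 + i) (y ∷ u)) (majFrom (2 + i + suc (length u)) w) (e * (suc i + suc (length u))))
        (cong₂ _+_ (cong₂ _+_ (sym (majFrom-∷∷ (suc i) x y u)) (cong (λ z → majFrom z w) (cong suc (sym (+-suc i (suc (length u)))))))
          (cong (e *_) (sym (+-suc i (suc (length u))))))))
  where
  open +-*-Solver
  arrange : ∀ x y z t → x + (y + z + t) ≡ x + y + z + t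
  arrange = solve 4 (λ x y z t → x :+ (y :+ z :+ t) := x :+ y :+ z :+ t) refl

majFrom-+ : ∀ k w → majFrom (1 + k) w ≡ maj w + des w * k
majFrom-+ zero    w = trans (sym (+-identityʳ (maj w))) (cong (λ z → maj w + z) (sym (*-zeroʳ (des w))))
majFrom-+ (suc k) w = trans (majFrom-suc (suc k) w) (trans (cong (λ z → z + des w) (majFrom-+ k w))
  (trans (+-assoc (maj w) _ _) (cong (λ z → maj w + z) (trans (+-comm (des w * k) (des w)) (sym (*-suc (des w) k))))))

-- Modulo `length u` both corrections vanish: the junction descent sits at place `length u`, and
-- each descent of `w` is moved by `length u`.
maj-++ : ∀ {f} u w → Primitive (length u) f → ∀ s → f (maj (u ++ w) + s) ≡ f (maj u + (maj w + s))
maj-++ {f} u w P s with majFrom-++ 0 u w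
... | e , eq = trans (cong f (trans (cong (λ z → z + s) (trans eq (cong (λ z → maj u + z + e * length u) (majFrom-+ (length u) w))))
      (arrange (maj u) (maj w) (des w) (length u) e s))) (periodic-multiple P (des w + e) (maj u + (maj w + s)))
  where
  open +-*-Solver
  arrange : ∀ x y z l e s → x + (y + z * l) + e * l + s ≡ x + (y + s) + (z + e) * l
  arrange = solve 6 (λ x y z l e s → x :+ (y :+ z :* l) :+ e :* l :+ s := x :+ (y :+ s) :+ (z :+ e) :* l) refl

sumW-++ : ∀ n k l Φ → sumW n (k + l) Φ ≡ sumW n k (λ u → sumW n l (λ w → Φ (u ++ w)))
sumW-++ n zero    l Φ = sym (R.+-identityʳ _)
sumW-++ n (suc k) l Φ = trans (sumW-cons n (k + l) Φ) (trans (sumL-cong (upTo n) (λ a → sumW-++ n k l (λ w → Φ (suc a ∷ w))))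
  (sym (sumW-cons n k (λ u → sumW n l (λ w → Φ (u ++ w))))))

stretch : ℕ → List ℕ → List ℕ
stretch d []      = []
stretch d (a ∷ u) = replicate d a ++ stretch d u

symmetric-++ : ∀ {I} u → Symmetric I → Symmetric (λ w → I (u ++ w))
symmetric-++ u sym-I w w′ same = sym-I _ _ (λ v → trans (count-++ v u w) (trans (cong (λ z → count v u + z) (same v)) (sym (count-++ v u w′))))

symmetric-++ʳ : ∀ {I} w → Symmetric I → Symmetric (λ u → I (u ++ w))
symmetric-++ʳ w sym-I u u′ same = sym-I _ _ (λ v → trans (count-++ v u w) (trans (cong (λ z → z + count v w) (same v)) (sym (count-++ v u′ w))))

-- The later blocks only shift the argument of f, so for fixed `w` the first block is summed by
-- `block-sum`; the constant block it leaves is absorbed into the weight.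
blocks-sum : ∀ n d .{{_ : NonZero d}} k {f I} → Primitive d f → Symmetric I → ∀ s →
  sumW n (k * d) (λ w → I w *ᶻ f (maj w + s)) ≡ sumW n k (λ u → I (stretch d u)) *ᶻ f s
blocks-sum n d zero {f} {I} P sym-I s = trans (R.+-identityʳ _) (cong (_*ᶻ f s) (sym (R.+-identityʳ (I []))))
blocks-sum n d (suc k) {f} {I} P sym-I s = trans (sumW-++ n d (k * d) _) (trans
  (sumW-cong n d (λ u (l , _) → sumL-cong (words n (k * d)) (λ w → cong (I (u ++ w) *ᶻ_) (maj-++ u w (subst (λ l → Primitive l f) (sym l) P) s))))
  (trans (sumL-swap (words n d) (words n (k * d)) _)
  (trans (sumL-cong (words n (k * d)) (λ w → block-sum n d P (symmetric-++ʳ {I} w sym-I) (maj w + s)))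
  (trans (sumL-swap (words n (k * d)) (upTo n) _)
  (trans (sumL-cong (upTo n) (λ a → blocks-sum n d k P (symmetric-++ {I} (replicate d (suc a)) sym-I) s))
  (trans (sumL-*ʳ (f s) (upTo n) _) (cong (_*ᶻ f s) (sym (sumW-cons n k (λ u → I (stretch d u)))))))))))

-- Merging the letters a and a + 1

≡ᵇ-refl : ∀ x → (x ≡ᵇ x) ≡ true
≡ᵇ-refl x = T⇒≡ (≡⇒≡ᵇ x x refl)

≢⇒≡ᵇ : ∀ {x y} → x ≢ y → (x ≡ᵇ y) ≡ false
≢⇒≡ᵇ {x} {y} x≢y with x ≡ᵇ y in e
... | true  = ⊥-elim (x≢y (≡ᵇ⇒≡ x y (subst T (sym e) tt)))
... | false = refl

<ᵇ-cong : ∀ {a b c d} → (a < b → c < d) → (c < d → a < b) → (a <ᵇ b) ≡ (c <ᵇ d)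
<ᵇ-cong {a} {b} {c} {d} to from with a <ᵇ b in e₁ | c <ᵇ d in e₂
... | true  | true  = refl
... | false | false = refl
... | true  | false = ⊥-elim (subst T e₂ (<⇒<ᵇ (to (<ᵇ⇒< a b (subst T (sym e₁) tt)))))
... | false | true  = ⊥-elim (subst T e₁ (<⇒<ᵇ (from (<ᵇ⇒< c d (subst T (sym e₂) tt)))))

count-here : ∀ v w → count v (v ∷ w) ≡ suc (count v w)
count-here v w = cong (λ b → (if b then 1 else 0) + count v w) (≡ᵇ-refl v)

count-there : ∀ {v x} w → v ≢ x → count v (x ∷ w) ≡ count v w
count-there {v} w v≢x = cong (λ b → (if b then 1 else 0) + count v w) (≢⇒≡ᵇ v≢x)

pos-here : ∀ v w → pos v (v ∷ w) ≡ 1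
pos-here v w = cong (λ b → if b then 1 else suc (pos v w)) (≡ᵇ-refl v)

pos-there : ∀ {v x} w → v ≢ x → pos v (x ∷ w) ≡ suc (pos v w)
pos-there {v} w v≢x = cong (λ b → if b then 1 else suc (pos v w)) (≢⇒≡ᵇ v≢x)

pos>0 : ∀ v w → 0 < count v w → 0 < pos v w
pos>0 v (x ∷ w) occ with v ≡ᵇ x
... | true  = s≤s z≤n
... | false = s≤s z≤n

count≡0⇒ : ∀ v w → count v w ≡ 0 → All (_≢ v) w
count≡0⇒ v []      eq = []
count≡0⇒ v (x ∷ w) eq with v ≟ x
... | yes refl = ⊥-elim (1+n≢0 (trans (sym (count-here v w)) eq))
... | no v≢x   = (v≢x ∘ sym) ∷ count≡0⇒ v w (trans (sym (count-there w v≢x)) eq)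

⇒count≡0 : ∀ v w → All (_≢ v) w → count v w ≡ 0
⇒count≡0 v []      []        = refl
⇒count≡0 v (x ∷ w) (x≢v ∷ p) = trans (count-there w (x≢v ∘ sym)) (⇒count≡0 v w p)

replace : ℕ → ℕ → ℕ → ℕ
replace a b x = if x ≡ᵇ a then b else x

replace-≡ : ∀ a b → replace a b a ≡ b
replace-≡ a b = cong (λ t → if t then b else a) (≡ᵇ-refl a)

replace-≢ : ∀ {a x} b → x ≢ a → replace a b x ≡ x
replace-≢ {a} {x} b x≢a = cong (λ t → if t then b else x) (≢⇒≡ᵇ x≢a)

replace-range : ∀ {n a b} → InRange n b → ∀ {x} → InRange n x → InRange n (replace a b x)
replace-range {a = a} rb {x} rx with x ≡ᵇ a
... | true  = rb
... | false = rx

module Merge (a : ℕ) where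

  private
    b = suc a

    a≢b : a ≢ b
    a≢b = <⇒≢ (n<1+n a)

  merge : List ℕ → List ℕ
  merge = map (replace b a)

  split : List ℕ → List ℕ
  split []      = []
  split (x ∷ w) = if x ≡ᵇ a then a ∷ map (replace a b) w else x ∷ split w

  split-here : ∀ w → split (a ∷ w) ≡ a ∷ map (replace a b) w
  split-here w = cong (λ t → if t then a ∷ map (replace a b) w else a ∷ split w) (≡ᵇ-refl a)

  split-there : ∀ {x} w → x ≢ a → split (x ∷ w) ≡ x ∷ split w
  split-there {x} w x≢a = cong (λ t → if t then a ∷ map (replace a b) w else x ∷ split w) (≢⇒≡ᵇ x≢a)

  -- The words with exactly one `a` and no `b` before it. On these merging is reversible: in the
  -- merged word the first `a` is the original one and all later ones come from `b`.
  data Standard : List ℕ → Set where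
    here  : ∀ {w} → All (_≢ a) w → Standard (a ∷ w)
    there : ∀ {x w} → x ≢ a → x ≢ b → Standard w → Standard (x ∷ w)

  ⇒standard : ∀ w → count a w ≡ 1 → 0 < count b w → ¬ pos b w < pos a w → Standard w
  ⇒standard (x ∷ w) once occ order with x ≟ a
  ... | yes refl = here (count≡0⇒ a w (suc-injective (trans (sym (count-here a w)) once)))
  ... | no x≢a with x ≟ b
  ...   | yes refl = ⊥-elim (order (subst₂ _<_ (sym (pos-here b w)) (sym (pos-there w a≢b))
            (s≤s (pos>0 a w (subst (0 <_) (trans (sym once) (count-there w a≢b)) (s≤s z≤n))))))
  ...   | no x≢b = there x≢a x≢b (⇒standard w (trans (sym (count-there w (x≢a ∘ sym))) once) (subst (0 <_) (count-there w (x≢b ∘ sym)) occ)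
            (λ p → order (subst₂ _<_ (sym (pos-there w (x≢b ∘ sym))) (sym (pos-there w (x≢a ∘ sym))) (s≤s p))))

  standard-once : ∀ {w} → Standard w → count a w ≡ 1
  standard-once {a ∷ w} (here none) = trans (count-here a w) (cong suc (⇒count≡0 a w none))
  standard-once {x ∷ w} (there x≢a x≢b st) = trans (count-there w (x≢a ∘ sym)) (standard-once st)

  standard-order : ∀ {w} → 0 < count b w → Standard w → ¬ pos b w < pos a w
  standard-order {a ∷ w} occ (here none) p = <⇒≱ p (subst₂ _≤_ (sym (pos-here a w)) (sym (pos-there w (a≢b ∘ sym))) (s≤s z≤n))
  standard-order {x ∷ w} occ (there x≢a x≢b st) p = standard-order (subst (0 <_) (count-there w (x≢b ∘ sym)) occ) st
    (≤-pred (subst₂ _<_ (pos-there w (x≢b ∘ sym)) (pos-there w (x≢a ∘ sym)) p))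

  count-merge : ∀ {v} → v ≢ a → v ≢ b → ∀ w → count v (merge w) ≡ count v w
  count-merge v≢a v≢b []      = refl
  count-merge {v} v≢a v≢b (x ∷ w) with x ≟ b
  ... | yes refl = trans (cong (λ z → count v (z ∷ merge w)) (replace-≡ b a)) (trans (count-there (merge w) v≢a)
        (trans (count-merge v≢a v≢b w) (sym (count-there w v≢b))))
  ... | no x≢b = trans (cong (λ z → count v (z ∷ merge w)) (replace-≢ a x≢b)) (cong (λ z → (if v ≡ᵇ x then 1 else 0) + z) (count-merge v≢a v≢b w))

  count-merge-a : ∀ w → count a (merge w) ≡ count a w + count b w
  count-merge-a []      = refl
  count-merge-a (x ∷ w) with x ≟ b
  ... | yes refl = trans (cong (λ z → count a (z ∷ merge w)) (replace-≡ b a)) (trans (count-here a (merge w)) (trans (cong suc (count-merge-a w))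
        (trans (sym (+-suc (count a w) (count b w))) (cong₂ _+_ (sym (count-there w a≢b)) (sym (count-here b w))))))
  ... | no x≢b = trans (cong (λ z → count a (z ∷ merge w)) (replace-≢ a x≢b)) (trans (cong (λ z → (if a ≡ᵇ x then 1 else 0) + z) (count-merge-a w))
        (trans (sym (+-assoc (if a ≡ᵇ x then 1 else 0) (count a w) (count b w))) (cong (λ z → count a (x ∷ w) + z) (sym (count-there w (x≢b ∘ sym))))))

  count-merge-b : ∀ w → count b (merge w) ≡ 0
  count-merge-b []      = refl
  count-merge-b (x ∷ w) with x ≟ b
  ... | yes refl = trans (cong (λ z → count b (z ∷ merge w)) (replace-≡ b a)) (trans (count-there (merge w) (a≢b ∘ sym)) (count-merge-b w))
  ... | no x≢b   = trans (cong (λ z → count b (z ∷ merge w)) (replace-≢ a x≢b)) (trans (count-there (merge w) (x≢b ∘ sym)) (count-merge-b w))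

  map-replace-inverse : ∀ c d w → All (_≢ d) w → map (replace d c) (map (replace c d) w) ≡ w
  map-replace-inverse c d []      []        = refl
  map-replace-inverse c d (x ∷ w) (x≢d ∷ p) = cong₂ _∷_ letter (map-replace-inverse c d w p)
    where
    letter : replace d c (replace c d x) ≡ x
    letter with x ≟ c
    ... | yes refl = trans (cong (replace d c) (replace-≡ c d)) (replace-≡ d c)
    ... | no x≢c   = trans (cong (replace d c) (replace-≢ d x≢c)) (replace-≢ c x≢d)

  split-merge : ∀ {w} → Standard w → split (merge w) ≡ w
  split-merge {a ∷ w} (here none) = trans (cong (λ z → split (z ∷ merge w)) (replace-≢ a a≢b))
    (trans (split-here (merge w)) (cong (a ∷_) (map-replace-inverse b a w none)))
  split-merge {x ∷ w} (there x≢a x≢b st) = trans (cong (λ z → split (z ∷ merge w)) (replace-≢ a x≢b))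
    (trans (split-there (merge w) x≢a) (cong (x ∷_) (split-merge st)))

  merge-split : ∀ w → All (_≢ b) w → merge (split w) ≡ w
  merge-split []      []        = refl
  merge-split (x ∷ w) (x≢b ∷ p) with x ≟ a
  ... | yes refl = trans (cong merge (split-here w)) (cong₂ _∷_ (replace-≢ a a≢b) (map-replace-inverse a b w p))
  ... | no x≢a   = trans (cong merge (split-there w x≢a)) (cong₂ _∷_ (replace-≢ a x≢b) (merge-split w p))

  split-standard : ∀ w → All (_≢ b) w → 0 < count a w → Standard (split w)
  split-standard (x ∷ w) (x≢b ∷ p) occ with x ≟ a
  ... | yes refl = subst Standard (sym (split-here w)) (here (replaced w))
    where
    replaced : ∀ w → All (_≢ a) (map (replace a b) w)
    replaced []      = []
    replaced (x ∷ w) with x ≟ a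
    ... | yes refl = (λ e → a≢b (trans (sym e) (replace-≡ a b))) ∷ replaced w
    ... | no x≢a   = (λ e → x≢a (trans (sym (replace-≢ b x≢a)) e)) ∷ replaced w
  ... | no x≢a = subst Standard (sym (split-there w x≢a)) (there x≢a x≢b (split-standard w p (subst (0 <_) (count-there w (x≢a ∘ sym)) occ)))

  merge-word : ∀ {n k w} → InRange n a → IsWord n k w → IsWord n k (merge w)
  merge-word {w = w} ra (l , r) = trans (List.length-map (replace b a) w) l , All.map⁺ (All.map (replace-range ra) r)

  split-word : ∀ {n k} w → InRange n b → IsWord n k w → IsWord n k (split w)
  split-word w rb (l , r) = trans (len w) l , range w r
    where
    len : ∀ w → length (split w) ≡ length w
    len []      = refl
    len (x ∷ w) with x ≡ᵇ a
    ... | true  = cong suc (List.length-map _ w)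
    ... | false = cong suc (len w)
    range : ∀ w → All (InRange _) w → All (InRange _) (split w)
    range []      []       = []
    range (x ∷ w) (rx ∷ r) with x ≟ a
    ... | yes refl = subst (All (InRange _)) (sym (split-here w)) (rx ∷ All.map⁺ (All.map (replace-range rb) r))
    ... | no x≢a   = subst (All (InRange _)) (sym (split-there w x≢a)) (rx ∷ range w r)

  -- Since a and b are consecutive integers, identifying them affects no comparison with a third
  -- letter; among the pairs of these two, only b followed by a loses a descent.
  descent-merge : ∀ x y → ¬ (x ≡ b × y ≡ a) → descent (replace b a x) (replace b a y) ≡ descent x y
  descent-merge x y ¬ba with x ≟ b | y ≟ b
  ... | yes refl | yes refl = trans (cong₂ descent (replace-≡ b a) (replace-≡ b a)) refl
  ... | yes refl | no y≢b = trans (cong₂ descent (replace-≡ b a) (replace-≢ a y≢b)) (cong (λ t → if t then 1 else 0)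
        (<ᵇ-cong m<n⇒m<1+n (λ y<b → ≤∧≢⇒< (≤-pred y<b) (λ e → ¬ba (refl , e)))))
  ... | no x≢b | yes refl = trans (cong₂ descent (replace-≢ a x≢b) (replace-≡ b a)) (cong (λ t → if t then 1 else 0)
        (<ᵇ-cong (λ a<x → ≤∧≢⇒< a<x (x≢b ∘ sym)) (<-trans (n<1+n a))))
  ... | no x≢b | no y≢b = cong₂ descent (replace-≢ a x≢b) (replace-≢ a y≢b)

  majFrom-merge-∷ : ∀ i x w → All (_≢ a) w → majFrom i (merge (x ∷ w)) ≡ majFrom i (x ∷ w)
  majFrom-merge-∷ i x []      []        = refl
  majFrom-merge-∷ i x (y ∷ w) (y≢a ∷ p) = trans (majFrom-∷∷ i (replace b a x) (replace b a y) (merge w)) (trans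
    (cong₂ (λ e z → e * i + z) (descent-merge x y (λ (_ , e) → y≢a e)) (majFrom-merge-∷ (suc i) y w p)) (sym (majFrom-∷∷ i x y w)))

  -- In a standard word no b is followed by a, the one pair whose descent would be lost.
  majFrom-merge : ∀ i {w} → Standard w → majFrom i (merge w) ≡ majFrom i w
  majFrom-merge i {a ∷ w}     (here none) = majFrom-merge-∷ i a w none
  majFrom-merge i {x ∷ y ∷ w} (there x≢a x≢b st) = trans (majFrom-∷∷ i (replace b a x) (replace b a y) (merge w)) (trans
    (cong₂ (λ e z → e * i + z) (descent-merge x y (λ (e , _) → x≢b e)) (majFrom-merge (suc i) st)) (sym (majFrom-∷∷ i x y w)))

  pos-merge : ∀ {v} → v ≢ a → v ≢ b → ∀ w → pos v (merge w) ≡ pos v w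
  pos-merge v≢a v≢b []      = refl
  pos-merge {v} v≢a v≢b (x ∷ w) with x ≟ b
  ... | yes refl = trans (cong (λ z → pos v (z ∷ merge w)) (replace-≡ b a)) (trans (pos-there (merge w) v≢a)
        (trans (cong suc (pos-merge v≢a v≢b w)) (sym (pos-there w v≢b))))
  ... | no x≢b = trans (cong (λ z → pos v (z ∷ merge w)) (replace-≢ a x≢b)) (cong (λ z → if v ≡ᵇ x then 1 else suc z) (pos-merge v≢a v≢b w))

  pos-merge-a : ∀ {w} → Standard w → pos a (merge w) ≡ pos a w
  pos-merge-a {a ∷ w} (here none) = trans (cong (λ z → pos a (z ∷ merge w)) (replace-≢ a a≢b)) (trans (pos-here a (merge w)) (sym (pos-here a w)))
  pos-merge-a {x ∷ w} (there x≢a x≢b st) = trans (cong (λ z → pos a (z ∷ merge w)) (replace-≢ a x≢b))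
    (trans (pos-there (merge w) (x≢a ∘ sym)) (trans (cong suc (pos-merge-a st)) (sym (pos-there w (x≢a ∘ sym)))))

-- Expansion of the inverse major index

Content : ℕ → (ℕ → ℕ) → List ℕ → Set
Content n κ w = ∀ {i} → i < n → count (suc i) w ≡ κ (suc i)

content? : ∀ n κ w → Dec (Content n κ w)
content? n κ w = allUpTo? (λ i → count (suc i) w ≟ κ (suc i)) n

-- The part of the inverse major index coming from the inverse descents 1, ..., a. It is defined for
-- all words through first occurrences, so that merging larger letters leaves it unchanged.
imaj : ℕ → List ℕ → ℕ
imaj zero    w = 0
imaj (suc a) w = imaj a w + descent (pos (suc a) w) (pos (2 + a) w) * suc a

imaj-cong : ∀ a {u w} → (∀ v → v ≤ suc a → pos v u ≡ pos v w) → imaj a u ≡ imaj a w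
imaj-cong zero    eq = refl
imaj-cong (suc a) eq = cong₂ _+_ (imaj-cong a (λ v v≤ → eq v (m≤n⇒m≤1+n v≤)))
  (cong₂ (λ x y → descent x y * suc a) (eq (suc a) (n≤1+n (suc a))) (eq (2 + a) ≤-refl))

mergeContent : ℕ → (ℕ → ℕ) → ℕ → ℕ
mergeContent a κ v = if v ≡ᵇ a then κ a + κ (suc a) else if v ≡ᵇ suc a then 0 else κ v

mergeContent-a : ∀ a κ → mergeContent a κ a ≡ κ a + κ (suc a)
mergeContent-a a κ = cong (λ t → if t then κ a + κ (suc a) else if a ≡ᵇ suc a then 0 else κ a) (≡ᵇ-refl a)

mergeContent-b : ∀ a κ → mergeContent a κ (suc a) ≡ 0
mergeContent-b a κ = trans (cong (λ t → if t then κ a + κ (suc a) else if a ≡ᵇ a then 0 else κ (suc a)) (≢⇒≡ᵇ {suc a} {a} 1+n≢n))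
  (cong (λ t → if t then 0 else κ (suc a)) (≡ᵇ-refl a))

mergeContent-≢ : ∀ {v} a κ → v ≢ a → v ≢ suc a → mergeContent a κ v ≡ κ v
mergeContent-≢ {v} a κ v≢a v≢b = trans (cong (λ t → if t then κ a + κ (suc a) else if v ≡ᵇ suc a then 0 else κ v) (≢⇒≡ᵇ v≢a))
  (cong (λ t → if t then 0 else κ v) (≢⇒≡ᵇ v≢b))

opaque
  unfolding _+ᶻ_

  split-descent : ∀ x y → y ≡ x +ᶻ 1ℤ *ᶻ (y -ᶻ x)
  split-descent = solve-∀

  +ᶻ-minus-zero : ∀ x y → x ≡ x +ᶻ 0ℤ *ᶻ (y -ᶻ x)
  +ᶻ-minus-zero = solve-∀

  expand-step : ∀ c F x e y → c *ᶻ (F *ᶻ (x +ᶻ e *ᶻ y)) ≡ c *ᶻ (F *ᶻ x) +ᶻ c *ᶻ e *ᶻ (F *ᶻ y)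
  expand-step = solve-∀

module Expansion (n : ℕ) (f : ℕ → ℤ) where

  Z : ℕ → (ℕ → ℕ) → (ℕ → ℤ) → ℤ
  Z a κ g = sumW n n (λ w → ⟦ content? n κ w ⟧ *ᶻ (f (maj w) *ᶻ g (imaj a w)))

  Z-cong : ∀ a κ {g h} → (∀ s → g s ≡ h s) → Z a κ g ≡ Z a κ h
  Z-cong a κ eq = sumL-cong (words n n) (λ w → cong (λ z → ⟦ content? n κ w ⟧ *ᶻ (f (maj w) *ᶻ z)) (eq (imaj a w)))

  Z-content : ∀ a {κ λ′} g → (∀ v → 1 ≤ v → v ≤ n → κ v ≡ λ′ v) → Z a κ g ≡ Z a λ′ g
  Z-content a {κ} {λ′} g eq = sumL-cong (words n n) (λ w → cong (_*ᶻ (f (maj w) *ᶻ g (imaj a w)))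
    (⟦⟧-cong (content? n κ w) (content? n λ′ w) (λ c {i} i<n → trans (c i<n) (eq (suc i) (s≤s z≤n) i<n))
      (λ c {i} i<n → trans (c i<n) (sym (eq (suc i) (s≤s z≤n) i<n)))))

  Z-zero : ∀ a κ {g} → (∀ s → g s ≡ 0ℤ) → Z a κ g ≡ 0ℤ
  Z-zero a κ eq = trans (sumL-cong (words n n) (λ w → trans (cong (λ z → ⟦ content? n κ w ⟧ *ᶻ (f (maj w) *ᶻ z)) (eq (imaj a w)))
    (trans (cong (⟦ content? n κ w ⟧ *ᶻ_) (R.zeroʳ _)) (R.zeroʳ _)))) (sumL-zero (words n n))

  -- Invariant once the inverse descents above a have been treated: the letters up to a are still
  -- single, and a + 1 carries whatever has been merged into it.
  State : ℕ → (ℕ → ℕ) → Set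
  State a κ = (∀ i → 1 ≤ i → i ≤ a → κ i ≡ 1) × 0 < κ (suc a) × suc a ≤ n

  state-break : ∀ {a κ} → State (suc a) κ → State a κ
  state-break {a} {κ} (once , _ , b≤n) = (λ i 1≤i i≤a → once i 1≤i (m≤n⇒m≤1+n i≤a)) ,
    subst (0 <_) (sym (once (suc a) (s≤s z≤n) ≤-refl)) (s≤s z≤n) , <⇒≤ b≤n

  state-merge : ∀ {a κ} → State (suc a) κ → State a (mergeContent (suc a) κ)
  state-merge {a} {κ} (once , occ , b≤n) =
    (λ i 1≤i i≤a → trans (mergeContent-≢ (suc a) κ (<⇒≢ (s≤s i≤a)) (<⇒≢ (m<n⇒m<1+n (s≤s i≤a)))) (once i 1≤i (m≤n⇒m≤1+n i≤a))) ,
    subst (0 <_) (sym (mergeContent-a (suc a) κ)) (<-≤-trans occ (m≤n+m _ _)) , <⇒≤ b≤n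

  -- Inclusion–exclusion at the possible inverse descent A = a + 1: it is either
  -- forced to count, or A and A + 1 are merged into one letter.
  Z-step : ∀ a κ g → State (suc a) κ →
    Z (suc a) κ g ≡ Z a κ (λ s → g (s + suc a)) +ᶻ Z a (mergeContent (suc a) κ) (λ s → g s -ᶻ g (s + suc a))
  Z-step a κ g (once , occ , b≤n) = trans (sumL-cong (words n n) expand)
    (trans (sumL-+ (words n n) _ _) (cong (Z a κ (λ s → g (s + A)) +ᶻ_)
      (trans (sumL-cong (words n n) (λ w → cong (_*ᶻ (f (maj w) *ᶻ h (imaj a w))) (sym (⟦⟧-× (content? n κ w) (¬? (desc? w))))))
        (sumW-reindex n n (λ w → content? n κ w ×-dec ¬? (desc? w)) (λ w → content? n κ′ w) merge split
          (λ w → f (maj w) *ᶻ h (imaj a w)) (λ w → f (maj w) *ᶻ h (imaj a w)) to from))))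
    where
    A = suc a
    B = suc A
    open Merge A
    κ′ = mergeContent A κ
    h : ℕ → ℤ
    h s = g s -ᶻ g (s + A)
    desc? : ∀ w → Dec (pos B w < pos A w)
    desc? w = pos B w <? pos A w
    A≤n : A ≤ n
    A≤n = <⇒≤ b≤n
    expand : ∀ w → ⟦ content? n κ w ⟧ *ᶻ (f (maj w) *ᶻ g (imaj (suc a) w)) ≡
      ⟦ content? n κ w ⟧ *ᶻ (f (maj w) *ᶻ g (imaj a w + A)) +ᶻ ⟦ content? n κ w ⟧ *ᶻ ⟦ ¬? (desc? w) ⟧ *ᶻ (f (maj w) *ᶻ h (imaj a w))
    expand w = trans (cong (λ z → ⟦ content? n κ w ⟧ *ᶻ (f (maj w) *ᶻ z)) value) (expand-step _ _ _ _ _)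
      where
      -- The descent is counted for every word and then corrected where it is absent; thus only
      -- words without the descent, the ones that can be merged, need separate treatment.
      value : g (imaj (suc a) w) ≡ g (imaj a w + A) +ᶻ ⟦ ¬? (desc? w) ⟧ *ᶻ h (imaj a w)
      value with pos B w <ᵇ pos A w
      ... | true  = trans (cong (λ z → g (imaj a w + z)) (*-identityˡ A)) (+ᶻ-minus-zero _ _)
      ... | false = trans (cong g (+-identityʳ (imaj a w))) (split-descent _ _)
    to : ∀ w → IsWord n n w → Content n κ w × ¬ pos B w < pos A w →
      IsWord n n (merge w) × Content n κ′ (merge w) × split (merge w) ≡ w × f (maj w) *ᶻ h (imaj a w) ≡ f (maj (merge w)) *ᶻ h (imaj a (merge w))
    to w isW (content , order) = merge-word (s≤s z≤n , A≤n) isW , content′ , split-merge st ,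
      cong₂ (λ x y → f x *ᶻ h y) (sym (majFrom-merge 1 st)) (sym (imaj-cong a same-pos))
      where
      st : Standard w
      st = ⇒standard w (trans (content A≤n) (once A (s≤s z≤n) ≤-refl)) (subst (0 <_) (sym (content b≤n)) occ) order
      same-pos : ∀ v → v ≤ suc a → pos v (merge w) ≡ pos v w
      same-pos v v≤A with v ≟ A
      ... | yes refl = pos-merge-a st
      ... | no v≢A   = pos-merge v≢A (<⇒≢ (s≤s v≤A)) w
      content′ : Content n κ′ (merge w)
      content′ {i} i<n with suc i ≟ A | suc i ≟ B
      ... | yes refl | _ = trans (count-merge-a w) (trans (cong₂ _+_ (content A≤n) (content b≤n)) (sym (mergeContent-a A κ)))
      ... | no _ | yes refl = trans (count-merge-b w) (sym (mergeContent-b A κ))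
      ... | no v≢A | no v≢B = trans (count-merge v≢A v≢B w) (trans (content i<n) (sym (mergeContent-≢ A κ v≢A v≢B)))
    from : ∀ w → IsWord n n w → Content n κ′ w → IsWord n n (split w) × (Content n κ (split w) × ¬ pos B (split w) < pos A (split w)) × merge (split w) ≡ w
    from w isW content′ = split-word w (s≤s z≤n , b≤n) isW , ((λ {i} → content {i}) , standard-order (subst (0 <_) (sym count-B) occ) st) , ms
      where
      noB : All (_≢ B) w
      noB = count≡0⇒ B w (trans (content′ b≤n) (mergeContent-b A κ))
      ms : merge (split w) ≡ w
      ms = merge-split w noB
      count-A : count A w ≡ 1 + κ B
      count-A = trans (content′ A≤n) (trans (mergeContent-a A κ) (cong (λ z → z + κ B) (once A (s≤s z≤n) ≤-refl)))
      st : Standard (split w)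
      st = split-standard w noB (subst (0 <_) (sym count-A) (s≤s z≤n))
      count-B : count B (split w) ≡ κ B
      count-B = suc-injective (trans (cong (λ z → z + count B (split w)) (sym (standard-once st)))
        (trans (sym (count-merge-a (split w))) (trans (cong (count A) ms) count-A)))
      content : Content n κ (split w)
      content {i} i<n with suc i ≟ A | suc i ≟ B
      ... | yes refl | _ = trans (standard-once st) (sym (once A (s≤s z≤n) ≤-refl))
      ... | no _ | yes refl = count-B
      ... | no v≢A | no v≢B = trans (sym (count-merge v≢A v≢B (split w))) (trans (cong (count (suc i)) ms)
            (trans (content′ i<n) (mergeContent-≢ A κ v≢A v≢B)))

-- Contents compatible with constant blocks

count-replicate : ∀ v d a → count v (replicate d a) ≡ d * count v (a ∷ [])
count-replicate v zero    a = refl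
count-replicate v (suc d) a = cong₂ _+_ (sym (+-identityʳ (if v ≡ᵇ a then 1 else 0))) (count-replicate v d a)

count-stretch : ∀ v d u → count v (stretch d u) ≡ d * count v u
count-stretch v d []      = sym (*-zeroʳ d)
count-stretch v d (a ∷ u) = trans (count-++ v (replicate d a) (stretch d u)) (trans (cong₂ _+_ (count-replicate v d a) (count-stretch v d u))
  (trans (sym (*-distribˡ-+ d (count v (a ∷ [])) (count v u))) (cong (λ z → d * (z + count v u)) (+-identityʳ (if v ≡ᵇ a then 1 else 0)))))

content-symmetric : ∀ n κ → Symmetric (λ w → ⟦ content? n κ w ⟧)
content-symmetric n κ u w same = ⟦⟧-cong (content? n κ u) (content? n κ w)
  (λ c {i} i<n → trans (sym (same (suc i))) (c i<n)) (λ c {i} i<n → trans (same (suc i)) (c i<n))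

-- The product of the operators 1 - yᵛ over v ≤ a not divisible by d, where
-- (y g) s = g (s + 1).
differences : ℕ → ℕ → (ℕ → ℤ) → ℕ → ℤ
differences d zero    g = g
differences d (suc a) g = if does (d ∣? suc a) then differences d a g else differences d a (λ s → g s -ᶻ g (s + suc a))

module Evaluation (n d k : ℕ) {{_ : NonZero d}} (n≡kd : n ≡ k * d) (f : ℕ → ℤ) (P : Primitive d f) where

  open Expansion n f

  stretched : (ℕ → ℕ) → ℤ
  stretched κ = sumW n k (λ u → ⟦ content? n κ (stretch d u) ⟧)

  -- With all inverse descents treated, g enters only through its value at 0, and the sum of f(maj
  -- w) falls to `blocks-sum`.
  Z-0 : ∀ κ g → Z 0 κ g ≡ stretched κ *ᶻ f 0 *ᶻ g 0
  Z-0 κ g = trans (sumL-cong (words n n) (λ w → trans (sym (R.*-assoc _ _ _)) (cong (λ z → ⟦ content? n κ w ⟧ *ᶻ f z *ᶻ g 0) (sym (+-identityʳ (maj w))))))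
    (trans (sumL-*ʳ (g 0) (words n n) _) (cong (_*ᶻ g 0)
      (trans (cong (λ l → sumW n l (λ w → ⟦ content? n κ w ⟧ *ᶻ f (maj w + 0))) n≡kd) (blocks-sum n d k P (content-symmetric n κ) 0))))

  stretched-∤ : ∀ κ v → 1 ≤ v → v ≤ n → ¬ d ∣ κ v → stretched κ ≡ 0ℤ
  stretched-∤ κ (suc i) _ i<n d∤ = trans (sumL-cong (words n k) (λ u → ⟦⟧-no (content? n κ (stretch d u))
    (λ c → d∤ (divides (count (suc i) u) (trans (sym (c i<n)) (trans (count-stretch (suc i) d u) (*-comm d (count (suc i) u))))))))
    (sumL-zero (words n k))

  -- Letters above a + 1 keep their multiplicities in every further branch, and at the end a word
  -- made of constant blocks has all multiplicities divisible by d.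
  Z-∤ : ∀ a κ g → State a κ → ∀ v → suc a < v → v ≤ n → ¬ d ∣ κ v → Z a κ g ≡ 0ℤ
  Z-∤ zero    κ g st v 1<v v≤n d∤ = trans (Z-0 κ g) (trans (cong (λ z → z *ᶻ f 0 *ᶻ g 0) (stretched-∤ κ v (<⇒≤ 1<v) v≤n d∤))
    (trans (cong (_*ᶻ g 0) (R.zeroˡ _)) (R.zeroˡ _)))
  Z-∤ (suc a) κ g st v a<v v≤n d∤ = trans (Z-step a κ g st) (trans (cong₂ _+ᶻ_
    (Z-∤ a κ (λ s → g (s + suc a)) (state-break st) v (<⇒≤ a<v) v≤n d∤)
    (Z-∤ a (mergeContent (suc a) κ) (λ s → g s -ᶻ g (s + suc a)) (state-merge st) v (<⇒≤ a<v) v≤n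
      (d∤ ∘ subst (d ∣_) (mergeContent-≢ (suc a) κ (>⇒≢ (<⇒≤ a<v)) (>⇒≢ a<v)))))
    (R.+-identityˡ 0ℤ))

  -- The number κ(a + 1) + a of letters not yet separated stays a multiple of d in every branch that
  -- can survive. Hence no descent is ever forced at e, because 0 < e < d; the letters are merged
  -- there, and 1 - yᵉ annihilates g.
  Z-smaller-period : ∀ e → 0 < e → e < d → ∀ a κ g → (∀ s → g (s + e) ≡ g s) → e ≤ a → State a κ → d ∣ κ (suc a) + a → Z a κ g ≡ 0ℤ
  Z-smaller-period e 0<e e<d zero    κ g per e≤a st dv = ⊥-elim (<⇒≱ 0<e e≤a)
  Z-smaller-period e 0<e e<d (suc a) κ g per e≤a st@(once , occ , b≤n) dv = trans (Z-step a κ g st) (trans (cong₂ _+ᶻ_ broken merged) (R.+-identityˡ 0ℤ))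
    where
    B = suc (suc a)
    h : ℕ → ℤ
    h s = g s -ᶻ g (s + suc a)
    swap : ∀ s x → s + e + x ≡ s + x + e
    swap s x = trans (+-assoc s e x) (trans (cong (λ z → s + z) (+-comm e x)) (sym (+-assoc s x e)))
    per-shift : ∀ s → g (s + e + suc a) ≡ g (s + suc a)
    per-shift s = trans (cong g (swap s (suc a))) (per (s + suc a))
    broken : Z a κ (λ s → g (s + suc a)) ≡ 0ℤ
    broken with d ∣? κ B
    ... | no d∤ = Z-∤ a κ (λ s → g (s + suc a)) (state-break st) B ≤-refl b≤n d∤
    -- Forcing the descent closes a part of κ B letters; once d divides it, d also divides the
    -- remaining a + 1.
    ... | yes d∣κB with ∣m+n∣m⇒∣n dv d∣κB
    ...   | d∣A with e ≤? a
    ...     | yes e≤a′ = Z-smaller-period e 0<e e<d a κ _ per-shift e≤a′ (state-break st)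
                (subst (λ z → d ∣ z + a) (sym (once (suc a) (s≤s z≤n) ≤-refl)) d∣A)
    ...     | no e≰a = ⊥-elim (<⇒≱ e<d (∣⇒≤ {{>-nonZero 0<e}} (subst (d ∣_) (sym (≤-antisym e≤a (≰⇒> e≰a))) d∣A)))
    merged : Z a (mergeContent (suc a) κ) h ≡ 0ℤ
    merged with e ≤? a
    ... | yes e≤a′ = Z-smaller-period e 0<e e<d a (mergeContent (suc a) κ) h (λ s → cong₂ _-ᶻ_ (per s) (per-shift s)) e≤a′ (state-merge st)
          (subst (d ∣_) sum≡ dv)
      where
      sum≡ : κ B + suc a ≡ mergeContent (suc a) κ (suc a) + a
      sum≡ = trans (+-suc (κ B) a) (cong (λ z → z + a) (sym (trans (mergeContent-a (suc a) κ) (cong (λ z → z + κ B) (once (suc a) (s≤s z≤n) ≤-refl)))))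
    -- Here e = a + 1, so the operator of this merge is exactly 1 - yᵉ.
    ... | no e≰a = Z-zero a (mergeContent (suc a) κ) (λ s → trans (cong (λ z → g s -ᶻ g (s + z)) (sym (≤-antisym e≤a (≰⇒> e≰a))))
          (trans (cong (g s -ᶻ_) (per s)) (x-x≡0 (g s))))

  -- The only surviving branch: after treating n - 1, …, a + 1 the letters above
  -- a are grouped into blocks of d consecutive ones.
  blockContent : ℕ → ℕ → ℕ
  blockContent a zero    = 0
  blockContent a (suc v) = if v <ᵇ a then 1 else if v ≡ᵇ a then d ∸ a % d else if v % d ≡ᵇ 0 then d else 0

  blockContent-< : ∀ {a v} → v < a → blockContent a (suc v) ≡ 1
  blockContent-< {a} {v} v<a = cong (λ t → if t then 1 else if v ≡ᵇ a then d ∸ a % d else if v % d ≡ᵇ 0 then d else 0) (T⇒≡ (<⇒<ᵇ v<a))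

  ≮⇒<ᵇ : ∀ {x y} → ¬ x < y → (x <ᵇ y) ≡ false
  ≮⇒<ᵇ {x} {y} ¬p with x <ᵇ y in e
  ... | true  = ⊥-elim (¬p (<ᵇ⇒< x y (subst T (sym e) tt)))
  ... | false = refl

  blockContent-≡ : ∀ a → blockContent a (suc a) ≡ d ∸ a % d
  blockContent-≡ a = trans (cong (λ t → if t then 1 else if a ≡ᵇ a then d ∸ a % d else if a % d ≡ᵇ 0 then d else 0) (≮⇒<ᵇ {a} (<-irrefl refl)))
    (cong (λ t → if t then d ∸ a % d else if a % d ≡ᵇ 0 then d else 0) (≡ᵇ-refl a))

  blockContent-> : ∀ {a v} → a < v → blockContent a (suc v) ≡ (if v % d ≡ᵇ 0 then d else 0)
  blockContent-> {a} {v} a<v = trans (cong (λ t → if t then 1 else if v ≡ᵇ a then d ∸ a % d else if v % d ≡ᵇ 0 then d else 0) (≮⇒<ᵇ (<⇒≯ a<v)))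
    (cong (λ t → if t then d ∸ a % d else if v % d ≡ᵇ 0 then d else 0) (≢⇒≡ᵇ (>⇒≢ a<v)))

  blockContent-state : ∀ a → suc a ≤ n → State a (blockContent a)
  blockContent-state a a<n = (λ { (suc i) _ i<a → blockContent-< i<a }) , subst (0 <_) (sym (blockContent-≡ a)) (m<n⇒0<n∸m (m%n<n a d)) , a<n

  -- A block has just been completed: letter a + 2 carries the full d, and letter a + 1 opens the
  -- next block with d - (d - 1) = 1 copy, just like a single letter.
  blockContent-∣ : ∀ a → d ∣ suc a → ∀ v → 1 ≤ v → v ≤ n → blockContent (suc a) v ≡ blockContent a v
  blockContent-∣ a d∣A (suc v) _ _ with <-cmp v a
  ... | tri< v<a _ _  = trans (blockContent-< (m<n⇒m<1+n v<a)) (sym (blockContent-< v<a))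
  ... | tri≈ _ refl _ = trans (blockContent-< (n<1+n v)) (sym (trans (blockContent-≡ v)
        (trans (cong (d ∸_) (%-pred-≡0 {v} {d} (n∣m⇒m%n≡0 (suc v) d d∣A))) (m∸[m∸n]≡n (>-nonZero⁻¹ d)))))
  ... | tri> _ _ a<v with v ≟ suc a
  ...   | yes refl = trans (blockContent-≡ (suc a)) (trans (cong (d ∸_) (n∣m⇒m%n≡0 (suc a) d d∣A))
          (sym (trans (blockContent-> a<v) (cong (λ z → if z ≡ᵇ 0 then d else 0) (n∣m⇒m%n≡0 (suc a) d d∣A)))))
  ...   | no v≢A = trans (blockContent-> (≤∧≢⇒< a<v (v≢A ∘ sym))) (sym (blockContent-> a<v))

  suc-% : ∀ a → ¬ d ∣ suc a → suc a % d ≡ suc (a % d)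
  suc-% a d∤A = trans (cong (λ z → suc z % d) (m≡m%n+[m/n]*n a d)) (trans ([m+kn]%n≡m%n (suc (a % d)) (a / d) d) (m<n⇒m%n≡m
    (≤∧≢⇒< (m%n<n a d) (λ e → d∤A (divides (suc (a / d)) (trans (cong suc (m≡m%n+[m/n]*n a d)) (cong (λ z → z + a / d * d) e)))))))

  -- Letter a + 1 joins the open block, whose size grows by one from d - (a + 1) mod d to d - a mod
  -- d.
  blockContent-∤ : ∀ a → ¬ d ∣ suc a → ∀ v → 1 ≤ v → v ≤ n → mergeContent (suc a) (blockContent (suc a)) v ≡ blockContent a v
  blockContent-∤ a d∤A (suc v) _ _ with <-cmp v a
  ... | tri< v<a _ _  = trans (mergeContent-≢ (suc a) (blockContent (suc a)) (<⇒≢ (s≤s v<a)) (<⇒≢ (m<n⇒m<1+n (s≤s v<a)))) (trans (blockContent-< (m<n⇒m<1+n v<a)) (sym (blockContent-< v<a)))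
  ... | tri≈ _ refl _ = trans (mergeContent-a (suc v) (blockContent (suc v))) (trans (cong₂ _+_ (blockContent-< (n<1+n v)) (trans (blockContent-≡ (suc v)) (cong (d ∸_) (suc-% v d∤A))))
        (sym (trans (blockContent-≡ v) (+-∸-assoc 1 (m%n<n v d)))))
  ... | tri> _ _ a<v with v ≟ suc a
  ...   | yes refl = trans (mergeContent-b (suc a) (blockContent (suc a))) (sym (trans (blockContent-> a<v) (cong (λ t → if t then d else 0) (≢⇒≡ᵇ (λ e → d∤A (m%n≡0⇒n∣m (suc a) d e))))))
  ...   | no v≢A = trans (mergeContent-≢ (suc a) (blockContent (suc a)) (>⇒≢ (s≤s a<v)) (v≢A ∘ suc-injective)) (trans (blockContent-> (≤∧≢⇒< a<v (v≢A ∘ sym))) (sym (blockContent-> a<v)))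

  -- If d ∣ a + 1, the shift by a + 1 fixes g: the merged branch carries the operator 0 and the
  -- forced branch leaves g alone. Otherwise forcing would freeze a multiplicity not divisible by d,
  -- so only the merged branch, with operator 1 - y^(a+1), survives.
  Z-blocks : ∀ a g → (∀ s → g (s + d) ≡ g s) → suc a ≤ n → Z a (blockContent a) g ≡ Z 0 (blockContent 0) (differences d a g)
  Z-blocks zero    g per a<n = refl
  Z-blocks (suc a) g per a<n = trans (Z-step a _ g st) go
    where
    st = blockContent-state (suc a) a<n
    h : ℕ → ℤ
    h s = g s -ᶻ g (s + suc a)
    swap : ∀ s x → s + d + x ≡ s + x + d
    swap s x = trans (+-assoc s d x) (trans (cong (λ z → s + z) (+-comm d x)) (sym (+-assoc s x d)))
    go : Z a (blockContent (suc a)) (λ s → g (s + suc a)) +ᶻ Z a (mergeContent (suc a) (blockContent (suc a))) h ≡ Z 0 (blockContent 0) (differences d (suc a) g)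
    go with d ∣? suc a
    ... | yes d∣A@(divides q e) = trans (cong₂ _+ᶻ_ (trans (Z-cong a (blockContent (suc a)) shift) (Z-content a g (blockContent-∣ a d∣A)))
            (Z-zero a (mergeContent (suc a) (blockContent (suc a))) (λ s → trans (cong (g s -ᶻ_) (shift s)) (x-x≡0 (g s)))))
          (trans (R.+-identityʳ _) (Z-blocks a g per (<⇒≤ a<n)))
      where
      shift : ∀ s → g (s + suc a) ≡ g s
      shift s = trans (cong g (trans (cong (λ z → s + z) e) (+-comm s (q * d)))) (periodic-* d per q s)
    ... | no d∤A = trans (cong₂ _+ᶻ_
            (Z-∤ a (blockContent (suc a)) (λ s → g (s + suc a)) (state-break st) (2 + a) ≤-refl a<n (λ q → <⇒≱ small (∣⇒≤ {{>-nonZero positive}} (subst (d ∣_) (blockContent-≡ (suc a)) q))))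
            (Z-content a h (blockContent-∤ a d∤A)))
          (trans (R.+-identityˡ _) (Z-blocks a h (λ s → cong₂ _-ᶻ_ (per s) (trans (cong g (swap s (suc a))) (per (s + suc a)))) (<⇒≤ a<n)))
      where
      positive : 0 < d ∸ suc a % d
      positive = m<n⇒0<n∸m (m%n<n (suc a) d)
      small : d ∸ suc a % d < d
      small = ∸-monoʳ-< {d} (n≢0⇒n>0 (λ e → d∤A (m%n≡0⇒n∣m (suc a) d e))) (<⇒≤ (m%n<n (suc a) d))

-- Evaluation of ∏ (1 - yᵃ) on primitive functions

opaque
  unfolding _+ᶻ_

  -ᶻ-congʳ-zero : ∀ x → x -ᶻ 0ℤ ≡ x
  -ᶻ-congʳ-zero = solve-∀

  *ᶻ-neg1 : ∀ x y → x -ᶻ y ≡ x +ᶻ -1ℤ *ᶻ y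
  *ᶻ-neg1 = solve-∀

sumN-∸ : ∀ n f g → sumN n (λ i → f i -ᶻ g i) ≡ sumN n f -ᶻ sumN n g
sumN-∸ n f g = trans (sumL-cong (upTo n) (λ i → *ᶻ-neg1 (f i) (g i))) (trans (sumL-+ (upTo n) _ _)
  (trans (cong (sumN n f +ᶻ_) (sumL-*ˡ -1ℤ (upTo n) g)) (sym (*ᶻ-neg1 _ _))))

-- ∏ (1 - y^(a + c)) over 1 ≤ a ≤ j
shiftedProduct : ℕ → ℕ → (ℕ → ℤ) → ℕ → ℤ
shiftedProduct c zero    g = g
shiftedProduct c (suc j) g = shiftedProduct c j (λ s → g s -ᶻ g (s + (suc j + c)))

shiftedProduct-cong : ∀ c j {g h} → (∀ s → g s ≡ h s) → ∀ s → shiftedProduct c j g s ≡ shiftedProduct c j h s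
shiftedProduct-cong c zero    eq = eq
shiftedProduct-cong c (suc j) eq = shiftedProduct-cong c j (λ s → cong₂ _-ᶻ_ (eq s) (eq (s + (suc j + c))))

shiftedProduct-∸ : ∀ c j g h s → shiftedProduct c j (λ s → g s -ᶻ h s) s ≡ shiftedProduct c j g s -ᶻ shiftedProduct c j h s
shiftedProduct-∸ c zero    g h s = refl
shiftedProduct-∸ c (suc j) g h s = trans (shiftedProduct-cong c j (λ s → interchange (g s) (h s) (g (s + (suc j + c))) (h (s + (suc j + c)))) s)
  (shiftedProduct-∸ c j _ _ s)
  where
  opaque
    unfolding _+ᶻ_
    interchange : ∀ x y z w → (x -ᶻ y) -ᶻ (z -ᶻ w) ≡ (x -ᶻ z) -ᶻ (y -ᶻ w)
    interchange = solve-∀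

shiftedProduct-zero : ∀ c j s → shiftedProduct c j (λ _ → 0ℤ) s ≡ 0ℤ
shiftedProduct-zero c zero    s = refl
shiftedProduct-zero c (suc j) s = trans (shiftedProduct-cong c j (λ _ → x-x≡0 0ℤ) s) (shiftedProduct-zero c j s)

module _ {d : ℕ} {g : ℕ → ℤ} (P : Primitive d g) where

  -- Averaging over c leaves only the constant term of the expanded product.
  average : ∀ j r t → r + j < d → 0 < r → sumN d (λ c → shiftedProduct c j (λ s → g (s + (r * c + t))) 0) ≡ 0ℤ
  average zero r t r<d 0<r = trans (sumL-cong (upTo d) (λ c → cong g (trans (+-comm (r * c) t) (cong (λ z → t + z) (*-comm r c)))))
    (cancel P r 0<r (subst (_< d) (+-identityʳ r) r<d) t)
  -- The top factor is either skipped or chosen; choosing it raises the coefficient of c from r to r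
  -- + 1. The bound r + j < d keeps every coefficient reached below d, where `cancel` applies.
  average (suc j) r t r+j<d 0<r = trans (sumL-cong (upTo d) (λ c → trans (shiftedProduct-∸ c j _ _ 0)
      (cong (shiftedProduct c j (λ s → g (s + (r * c + t))) 0 -ᶻ_) (shiftedProduct-cong c j (λ s → cong g (arrange s j c (r * c) t)) 0))))
    (trans (sumN-∸ d _ _) (trans (cong₂ _-ᶻ_ (average j r t (<-trans (+-monoʳ-< r (n<1+n j)) r+j<d) 0<r)
      (average j (suc r) (t + suc j) (subst (_< d) (+-suc r j) r+j<d) (s≤s z≤n))) (x-x≡0 0ℤ)))
    where
    open +-*-Solver
    arrange : ∀ s j c x t → s + (suc j + c) + (x + t) ≡ s + (c + x + (t + suc j))
    arrange = solve 5 (λ s j c x t → s :+ (con 1 :+ j :+ c) :+ (x :+ t) := s :+ (c :+ x :+ (t :+ (con 1 :+ j)))) refl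

  average-0 : ∀ j t → j < d → sumN d (λ c → shiftedProduct c j (λ s → g (s + t)) 0) ≡ + d *ᶻ g t
  average-0 zero    t j<d = sumN-const d (g t)
  average-0 (suc j) t j<d = trans (sumL-cong (upTo d) (λ c → trans (shiftedProduct-∸ c j _ _ 0)
      (cong (shiftedProduct c j (λ s → g (s + t)) 0 -ᶻ_) (shiftedProduct-cong c j (λ s → cong g (arrange s j c t)) 0))))
    (trans (sumN-∸ d _ _) (trans (cong₂ _-ᶻ_ (average-0 j t (<⇒≤ j<d)) (average j 1 (t + suc j) j<d (s≤s z≤n))) (-ᶻ-congʳ-zero _)))
    where
    open +-*-Solver
    arrange : ∀ s j c t → s + (suc j + c) + t ≡ s + (1 * c + (t + suc j))
    arrange = solve 4 (λ s j c t → s :+ (con 1 :+ j :+ c) :+ t := s :+ (con 1 :* c :+ (t :+ (con 1 :+ j)))) refl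

-- Some exponent a + c in the product equals d, and 1 - yᵈ is zero on a function of period d.
shiftedProduct-periodic : ∀ {d} c j {g} → (∀ s → g (s + d) ≡ g s) → 0 < c → c < d → d ≤ j + c → ∀ s → shiftedProduct c j g s ≡ 0ℤ
shiftedProduct-periodic {d} c zero    per 0<c c<d d≤c s = ⊥-elim (<⇒≱ c<d d≤c)
shiftedProduct-periodic {d} c (suc j) {g} per 0<c c<d d≤ s with d ≟ suc j + c
... | yes refl = trans (shiftedProduct-cong c j (λ s → trans (cong (g s -ᶻ_) (per s)) (x-x≡0 (g s))) s) (shiftedProduct-zero c j s)
... | no d≢    = shiftedProduct-periodic c j (λ s → cong₂ _-ᶻ_ (per s) (trans (cong g (swap s)) (per (s + (suc j + c))))) 0<c c<d (≤-pred (≤∧≢⇒< d≤ d≢)) s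
  where
  swap : ∀ s → s + d + (suc j + c) ≡ s + (suc j + c) + d
  swap s = trans (+-assoc s d _) (trans (cong (λ z → s + z) (+-comm d _)) (sym (+-assoc s _ d)))

-- This is ∏_{0<a<N} (1 - ζᵃ) = N for ζ of order N = `suc d`. Summing ∏_{0<a<N} (1 - ζ^(a+c)) over c
-- modulo N leaves N times the constant term 1, while every c other than 0 contributes a factor 1 -
-- ζᴺ = 0.
shiftedProduct-value : ∀ d {g} → Primitive (suc d) g → ∀ t → shiftedProduct 0 d (λ s → g (s + t)) 0 ≡ + suc d *ᶻ g t
shiftedProduct-value d {g} P t = trans (sym (trans (sumN-front d (λ c → shiftedProduct c d (λ s → g (s + t)) 0)) (trans
    (cong (shiftedProduct 0 d (λ s → g (s + t)) 0 +ᶻ_) (trans (sum₁-cong d (λ c 1≤c c≤d → shiftedProduct-periodic c d (periodic (primitive-shift t P)) 1≤c (s≤s c≤d)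
        (≤-trans (≤-reflexive (+-comm 1 d)) (+-monoʳ-≤ d 1≤c)) 0)) (sumL-zero (upTo d))))
    (R.+-identityʳ _))))
  (average-0 P d t (n<1+n d))

shiftedProduct-shift : ∀ c j g s t → shiftedProduct c j g (s + t) ≡ shiftedProduct c j (λ x → g (x + t)) s
shiftedProduct-shift c zero    g s t = refl
shiftedProduct-shift c (suc j) g s t = trans (shiftedProduct-shift c j _ s t)
  (shiftedProduct-cong c j (λ x → cong (λ z → g (x + t) -ᶻ g z) (trans (+-assoc x t _) (trans (cong (λ z → x + z) (+-comm t _)) (sym (+-assoc x _ t))))) s)

differences-cong : ∀ d a {g h} → (∀ s → g s ≡ h s) → ∀ s → differences d a g s ≡ differences d a h s
differences-cong d zero    eq = eq
differences-cong d (suc a) eq with does (d ∣? suc a)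
... | true  = differences-cong d a eq
... | false = differences-cong d a (λ s → cong₂ _-ᶻ_ (eq s) (eq (s + suc a)))

differences-∣ : ∀ d a g s → d ∣ suc a → differences d (suc a) g s ≡ differences d a g s
differences-∣ d a g s d∣A with d ∣? suc a
... | yes _  = refl
... | no d∤A = ⊥-elim (d∤A d∣A)

differences-∤ : ∀ d a g s → ¬ d ∣ suc a → differences d (suc a) g s ≡ differences d a (λ s → g s -ᶻ g (s + suc a)) s
differences-∤ d a g s d∤A with d ∣? suc a
... | yes d∣A = ⊥-elim (d∤A d∣A)
... | no _    = refl

-- On functions of period d an exponent j d + a acts as a, so the top r factors form the product
-- starting at exponent 1.
differences-block : ∀ d j r {g} → r < d → (∀ s → g (s + d) ≡ g s) → ∀ s → differences d (j * d + r) g s ≡ differences d (j * d) (shiftedProduct 0 r g) s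
differences-block d j zero    {g} r<d per s = cong (λ z → differences d z g s) (+-identityʳ (j * d))
differences-block d j (suc r) {g} r<d per s = trans (cong (λ z → differences d z g s) (+-suc (j * d) r))
  (trans (differences-∤ d (j * d + r) g s (λ q → <⇒≱ r<d (∣⇒≤ (∣m+n∣m⇒∣n (subst (d ∣_) (sym (+-suc (j * d) r)) q) (n∣m*n j)))))
  (trans (differences-cong d (j * d + r) (λ s → cong (g s -ᶻ_) (reduce s)) s)
    (differences-block d j r (<⇒≤ r<d) (λ s → cong₂ _-ᶻ_ (per s) (trans (cong g (swap s)) (per _))) s)))
  where
  reduce : ∀ s → g (s + suc (j * d + r)) ≡ g (s + (suc r + 0))
  reduce s = trans (cong g arrange) (periodic-* d per j (s + (suc r + 0)))
    where
    arrange : s + suc (j * d + r) ≡ j * d + (s + (suc r + 0))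
    arrange = solve 3 (λ s x r → s :+ (con 1 :+ (x :+ r)) := x :+ (s :+ (con 1 :+ r :+ con 0))) refl s (j * d) r
      where open +-*-Solver
  swap : ∀ s → s + d + (suc r + 0) ≡ s + (suc r + 0) + d
  swap s = trans (+-assoc s d _) (trans (cong (λ z → s + z) (+-comm d _)) (sym (+-assoc s _ d)))

primitive-scale : ∀ {d g} c → Primitive d g → Primitive d (λ s → c *ᶻ g s)
primitive-scale c P .periodic s = cong (c *ᶻ_) (periodic P s)
primitive-scale {d} c P .cancel k 0<k k<d s = trans (sumL-*ˡ c (upTo d) _) (trans (cong (c *ᶻ_) (cancel P k 0<k k<d s)) (R.zeroʳ c))

-- The exponents used are j + 1 full sets of nonzero residues modulo `suc d`, and each set
-- multiplies by `suc d`.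
differences-value : ∀ d j {g} → Primitive (suc d) g → ∀ s → differences (suc d) (j * suc d + d) g s ≡ + (suc d ^ suc j) *ᶻ g s
differences-value d j {g} P s = trans (differences-block (suc d) j d (n<1+n d) (periodic P) s)
  (trans (differences-cong (suc d) (j * suc d) (λ t → trans (shiftedProduct-shift 0 d g 0 t) (shiftedProduct-value d P t)) s) (below j))
  where
  below : ∀ j → differences (suc d) (j * suc d) (λ t → + suc d *ᶻ g t) s ≡ + (suc d ^ suc j) *ᶻ g s
  below zero    = cong (λ z → + z *ᶻ g s) (sym (*-identityʳ (suc d)))
  below (suc j) = trans (cong (λ z → differences (suc d) z (λ t → + suc d *ᶻ g t) s) (cong suc (+-comm d (j * suc d))))
    (trans (differences-∣ (suc d) (j * suc d + d) _ s (divides (suc j) (cong suc (+-comm (j * suc d) d))))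
    (trans (differences-value d j (primitive-scale (+ suc d) P) s)
    (trans (sym (R.*-assoc _ _ _)) (cong (_*ᶻ g s) (trans (sym (*-homo (suc d ^ suc j) (suc d))) (cong +_ (*-comm (suc d ^ suc j) (suc d))))))))

-- Counting words with multiplicities at most one

sum₁≡0 : ∀ n (χ : ℕ → ℕ) → sum₁ n (λ v → + χ v) ≡ 0ℤ → ∀ i → i < n → χ (suc i) ≡ 0
sum₁≡0 n χ total i i<n = n≤0⇒n≡0 (subst (χ (suc i) ≤_) (ℤ.+-injective (trans (sym (to-ℕ n)) total)) (part n i i<n))
  where
  sumℕ : ℕ → ℕ
  sumℕ zero    = 0
  sumℕ (suc n) = sumℕ n + χ (suc n)
  to-ℕ : ∀ n → sum₁ n (λ v → + χ v) ≡ + sumℕ n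
  to-ℕ zero    = refl
  to-ℕ (suc n) = trans (sumN-suc n (λ i → + χ (suc i))) (trans (cong (_+ᶻ + χ (suc n)) (to-ℕ n)) (sym (+-homo (sumℕ n) (χ (suc n)))))
  part : ∀ n i → i < n → χ (suc i) ≤ sumℕ n
  part (suc n) i i<1+n with i ≟ n
  ... | yes refl = m≤n+m _ _
  ... | no i≢n   = ≤-trans (part n i (≤∧≢⇒< (≤-pred i<1+n) i≢n)) (m≤m+n _ _)

content-at : ∀ {n κ w v} → Content n κ w → 1 ≤ v → v ≤ n → count v w ≡ κ v
content-at {v = suc v} c _ v<n = c v<n

-- The arrangements of k distinct letters, counted by the first letter: k + 1 choices, each leaving
-- k letters with the chosen one removed from χ.
content-1-sum : ∀ n k χ → (∀ v → χ v ≤ 1) → sum₁ n (λ v → + χ v) ≡ + k → sumW n k (λ u → ⟦ content? n χ u ⟧) ≡ + (k !)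
content-1-sum n zero χ χ≤1 total = trans (R.+-identityʳ _) (⟦⟧-yes (content? n χ []) (λ {i} i<n → sym (sum₁≡0 n χ total i i<n)))
content-1-sum n (suc k) χ χ≤1 total = trans (sumW-cons n k _) (trans (sum₁-cong n first)
  (trans (sumL-*ʳ (+ (k !)) (upTo n) _) (trans (cong (_*ᶻ + (k !)) total) (sym (*-homo (suc k) (k !))))))
  where
  first : ∀ a → 1 ≤ a → a ≤ n → sumW n k (λ u → ⟦ content? n χ (a ∷ u) ⟧) ≡ + χ a *ᶻ + (k !)
  first a 1≤a a≤n with χ a in χa
  ... | zero = trans (sumL-cong (words n k) (λ u → ⟦⟧-no (content? n χ (a ∷ u)) (impossible u))) (trans (sumL-zero (words n k)) (sym (R.zeroˡ _)))
    where
    impossible : ∀ u → ¬ Content n χ (a ∷ u)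
    impossible u c = 1+n≢0 (trans (sym (count-here a u)) (trans (content-at {κ = χ} {w = a ∷ u} c 1≤a a≤n) χa))
  ... | suc (suc x) = ⊥-elim (<⇒≱ (subst (1 <_) (sym χa) (s≤s (s≤s z≤n))) (χ≤1 a))
  ... | suc zero = trans (sumL-cong (words n k) (λ u → ⟦⟧-cong (content? n χ (a ∷ u)) (content? n χ′ u) (λ c {i} → to u c {i}) (λ c {i} → from u c {i})))
        (trans (content-1-sum n k χ′ χ′≤1 total′) (sym (R.*-identityˡ _)))
    where
    χ′ : ℕ → ℕ
    χ′ v = if v ≡ᵇ a then 0 else χ v
    χ′-a : χ′ a ≡ 0
    χ′-a = cong (λ t → if t then 0 else χ a) (≡ᵇ-refl a)
    χ′-≢ : ∀ {v} → v ≢ a → χ′ v ≡ χ v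
    χ′-≢ {v} v≢a = cong (λ t → if t then 0 else χ v) (≢⇒≡ᵇ v≢a)
    χ′≤1 : ∀ v → χ′ v ≤ 1
    χ′≤1 v with v ≡ᵇ a
    ... | true  = z≤n
    ... | false = χ≤1 v
    to : ∀ u → Content n χ (a ∷ u) → Content n χ′ u
    to u c {i} i<n with suc i ≟ a
    ... | yes refl = trans (suc-injective (trans (sym (count-here a u)) (trans (c i<n) χa))) (sym χ′-a)
    ... | no v≢a   = trans (sym (count-there u v≢a)) (trans (c i<n) (sym (χ′-≢ v≢a)))
    from : ∀ u → Content n χ′ u → Content n χ (a ∷ u)
    from u c {i} i<n with suc i ≟ a
    ... | yes refl = trans (count-here a u) (trans (cong suc (trans (c i<n) χ′-a)) (sym χa))
    ... | no v≢a   = trans (count-there u v≢a) (trans (c i<n) (χ′-≢ v≢a))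
    pointwise : ∀ v → + χ v ≡ + χ′ v +ᶻ ⟦ v ≟ a ⟧ *ᶻ 1ℤ
    pointwise v with v ≟ a
    ... | yes refl = trans (cong +_ χa) (sym (trans (cong₂ _+ᶻ_ (cong +_ χ′-a) (yes-* (v ≟ v) refl 1ℤ)) (R.+-identityˡ 1ℤ)))
    ... | no v≢a   = sym (trans (cong₂ _+ᶻ_ (cong +_ (χ′-≢ v≢a)) (no-* (v ≟ a) v≢a 1ℤ)) (R.+-identityʳ _))
    total′ : sum₁ n (λ v → + χ′ v) ≡ + k
    total′ = +ᶻ-cancelʳ _ _ 1ℤ (trans (cong (sum₁ n (λ v → + χ′ v) +ᶻ_) (sym (sum₁-δ n a (λ _ → 1ℤ) 1≤a a≤n)))
      (trans (sym (sumL-+ (upTo n) _ _)) (trans (sumL-cong (upTo n) (λ i → sym (pointwise (suc i)))) (trans total (trans (cong +_ (+-comm 1 k)) (+-homo k 1))))))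

module Diagonal (n d k : ℕ) {{_ : NonZero d}} (n≡kd : n ≡ k * d) (f : ℕ → ℤ) (P : Primitive d f) where

  open Evaluation n d k n≡kd f P

  -- Stretching multiplies a content by d, and `blockContent 0` is d times the indicator of the k
  -- letters 1, d + 1, 2 d + 1, ...; the words counted are the arrangements of these.
  stretched-blocks : stretched (blockContent 0) ≡ + (k !)
  stretched-blocks = trans (sumL-cong (words n k) (λ u → ⟦⟧-cong (content? n (blockContent 0) (stretch d u)) (content? n χ u)
      (λ c {i} i<n → *-cancelˡ-≡ (count (suc i) u) (χ (suc i)) d (trans (sym (count-stretch (suc i) d u)) (trans (c i<n) (block≡ i))))
      (λ c {i} i<n → trans (count-stretch (suc i) d u) (trans (cong (d *_) (c i<n)) (sym (block≡ i))))))
    (content-1-sum n k χ χ≤1 total)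
    where
    χ : ℕ → ℕ
    χ zero    = 0
    χ (suc v) = if v % d ≡ᵇ 0 then 1 else 0
    χ≤1 : ∀ v → χ v ≤ 1
    χ≤1 zero = z≤n
    χ≤1 (suc v) with v % d ≡ᵇ 0
    ... | true  = ≤-refl
    ... | false = z≤n
    block≡ : ∀ i → blockContent 0 (suc i) ≡ d * χ (suc i)
    block≡ zero    = trans (cong (d ∸_) 0%d) (sym (trans (cong (λ z → d * (if z ≡ᵇ 0 then 1 else 0)) 0%d) (*-identityʳ d)))
      where
      0%d : 0 % d ≡ 0
      0%d = n∣m⇒m%n≡0 0 d (d ∣0)
    block≡ (suc i) with suc i % d ≡ᵇ 0
    ... | true  = sym (*-identityʳ d)
    ... | false = sym (*-zeroʳ d)
    total : sum₁ n (λ v → + χ v) ≡ + k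
    total = trans (cong (λ N → sum₁ N (λ v → + χ v)) n≡kd) (trans (sumN-* k d (λ i → + χ (suc i)))
      (trans (sumL-cong (upTo k) (λ i → trans (sumN-cong d (λ j j<d → one i j j<d)) (sumN-δ d 0 (λ _ → 1ℤ) (>-nonZero⁻¹ d))))
        (trans (sumN-const k 1ℤ) (R.*-identityʳ _))))
      where
      one : ∀ i j → j < d → + χ (suc (i * d + j)) ≡ ⟦ j ≟ 0 ⟧ *ᶻ 1ℤ
      one i j j<d = trans (cong (λ z → + (if z ≡ᵇ 0 then 1 else 0)) (trans (cong (_% d) (+-comm (i * d) j)) (trans ([m+kn]%n≡m%n j i d) (m<n⇒m%n≡m j<d))))
        (trans (val j) (sym (R.*-identityʳ _)))
        where
        val : ∀ j → + (if j ≡ᵇ 0 then 1 else 0) ≡ ⟦ j ≟ 0 ⟧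
        val zero    = refl
        val (suc j) = refl

-- Sums over permutations for unequal and equal orders

one : ℕ → ℕ
one _ = 1

module _ (a : ℕ) {f g : ℕ → ℤ} where

  private
    n = suc a
    open Expansion n f

  -- The starting point a = n - 1 with all multiplicities 1 satisfies the invariant, since 1 + a = n
  -- is a multiple of d, and e < d ≤ n places e among the inverse descents still to be treated.
  Z-primitive-< : ∀ {d e} .{{_ : NonZero e}} → d ∣ n → Primitive d f → Primitive e g → e < d → Z a one g ≡ 0ℤ
  Z-primitive-< {d} {e} (divides k n≡) P Q e<d = Evaluation.Z-smaller-period n d k {{d≢0}} n≡ f P e (>-nonZero⁻¹ e) e<d a one g (periodic Q)
      (≤-pred (<-≤-trans e<d (∣⇒≤ (divides k n≡)))) ((λ _ _ _ → refl) , s≤s z≤n , ≤-refl) (divides k n≡)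
    where
    d≢0 : NonZero d
    d≢0 = nonZero-factorʳ k n≡

  -- The content of a permutation is `blockContent a` for a = n - 1: as n is a multiple of `suc d`,
  -- the last letter begins a block, still of size one. The surviving branch supplies the factorial
  -- from `stretched-blocks` and the power from `differences-value`.
  Z-primitive-≡ : ∀ d j → n ≡ suc j * suc d → Primitive (suc d) f → Primitive (suc d) g →
    Z a one g ≡ + (suc d ^ suc j * suc j !) *ᶻ (f 0 *ᶻ g 0)
  Z-primitive-≡ d j n≡ P Q = trans (Z-content a g blocks) (trans (Z-blocks a g (periodic Q) ≤-refl)
    (trans (Z-0 (blockContent 0) (differences (suc d) a g))
      (trans (cong₂ (λ x y → x *ᶻ f 0 *ᶻ y) (Diagonal.stretched-blocks n (suc d) (suc j) n≡ f P)
          (trans (cong (λ z → differences (suc d) z g 0) a≡) (differences-value d j Q 0)))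
        (trans (arrange (+ (suc j !)) (f 0) (+ (suc d ^ suc j)) (g 0)) (cong (_*ᶻ (f 0 *ᶻ g 0)) (sym (*-homo (suc d ^ suc j) (suc j !))))))))
    where
    open Evaluation n (suc d) (suc j) n≡ f P
    opaque
      unfolding _+ᶻ_
      arrange : ∀ x y z w → x *ᶻ y *ᶻ (z *ᶻ w) ≡ z *ᶻ x *ᶻ (y *ᶻ w)
      arrange = solve-∀
    a≡ : a ≡ j * suc d + d
    a≡ = trans (suc-injective n≡) (+-comm d (j * suc d))
    blocks : ∀ v → 1 ≤ v → v ≤ n → 1 ≡ blockContent a v
    blocks (suc v) _ (s≤s v≤a) with v ≟ a
    ... | no v≢a   = sym (blockContent-< (≤∧≢⇒< v≤a v≢a))
    ... | yes refl = sym (trans (blockContent-≡ v) (trans (cong (suc d ∸_) (trans (cong (_% suc d) (trans a≡ (+-comm (j * suc d) d)))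
          (trans ([m+kn]%n≡m%n d j (suc d)) (m<n⇒m%n≡m (n<1+n d))))) (m+n∸n≡m 1 d)))

-- Permutations and their inverses

sumL-filter : ∀ {A : Set} {P : A → Set} (P? : ∀ x → Dec (P x)) (xs : List A) Φ → sumL (filter P? xs) Φ ≡ sumL xs (λ x → ⟦ P? x ⟧ *ᶻ Φ x)
sumL-filter P? []       Φ = refl
sumL-filter P? (x ∷ xs) Φ with does (P? x)
... | true  = cong₂ _+ᶻ_ (sym (R.*-identityˡ (Φ x))) (sumL-filter P? xs Φ)
... | false = trans (sumL-filter P? xs Φ) (sym (trans (cong (_+ᶻ sumL xs (λ x → ⟦ P? x ⟧ *ᶻ Φ x)) (R.zeroˡ (Φ x))) (R.+-identityˡ _)))

count≡sum : ∀ v w → + count v w ≡ sumL w (λ x → ⟦ v ≟ x ⟧)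
count≡sum v []      = refl
count≡sum v (x ∷ w) = trans (+-homo (if v ≡ᵇ x then 1 else 0) (count v w)) (cong₂ _+ᶻ_ (val (v ≡ᵇ x)) (count≡sum v w))
  where
  val : ∀ t → + (if t then 1 else 0) ≡ (if t then 1ℤ else 0ℤ)
  val true  = refl
  val false = refl

sum-count : ∀ n w → All (InRange n) w → sum₁ n (λ v → + count v w) ≡ + length w
sum-count n w r = trans (sumL-cong (upTo n) (λ i → count≡sum (suc i) w)) (trans (sumL-swap (upTo n) w _) (go w r))
  where
  go : ∀ w → All (InRange n) w → sumL w (λ x → sum₁ n (λ v → ⟦ v ≟ x ⟧)) ≡ + length w
  go []      []                = refl
  go (x ∷ w) ((1≤x , x≤n) ∷ r) = trans (cong₂ _+ᶻ_ (trans (sumL-cong (upTo n) (λ i → sym (R.*-identityʳ _))) (sum₁-δ n x (λ _ → 1ℤ) 1≤x x≤n)) (go w r))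
    (sym (+-homo 1 (length w)))

∈ᵇ⇒count : ∀ v w → T (v ∈ᵇ w) → 0 < count v w
∈ᵇ⇒count v (x ∷ w) t with v ≡ᵇ x
... | true  = s≤s z≤n
... | false = ∈ᵇ⇒count v w t

count⇒∈ᵇ : ∀ v w → 0 < count v w → T (v ∈ᵇ w)
count⇒∈ᵇ v (x ∷ w) p with v ≡ᵇ x
... | true  = tt
... | false = count⇒∈ᵇ v w p

-- Pigeonhole: the multiplicities sum to n and each is at least 1, so their excesses over 1 sum to
-- 0.
isPerm⇒ : ∀ n w → IsWord n n w → isPerm n w ≡ true → Content n one w
isPerm⇒ n w (l , r) eq {i} i<n = trans (sym (m+[n∸m]≡n (occurs i i<n))) (cong suc (sum₁≡0 n (λ v → count v w ∸ 1) excess i i<n))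
  where
  occurs : ∀ i → i < n → 1 ≤ count (suc i) w
  occurs i i<n = ∈ᵇ⇒count (suc i) w (All.lookup (All.all⁺ (λ k → k ∈ᵇ w) (oneTo n) (subst T (sym eq) tt)) (∈-oneTo⁺ (s≤s z≤n) i<n))
  excess : sum₁ n (λ v → + (count v w ∸ 1)) ≡ 0ℤ
  excess = +ᶻ-cancelʳ _ _ (+ n *ᶻ 1ℤ) (trans (cong (sum₁ n (λ v → + (count v w ∸ 1)) +ᶻ_) (sym (sumN-const n 1ℤ)))
    (trans (sym (sumL-+ (upTo n) _ _)) (trans (sumN-cong n (λ i i<n → trans (sym (+-homo (count (suc i) w ∸ 1) 1)) (cong +_ (m∸n+n≡m (occurs i i<n)))))
    (trans (sum-count n w r) (trans (cong +_ l) (sym (trans (R.+-identityˡ _) (R.*-identityʳ _))))))))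

⇒isPerm : ∀ n w → Content n one w → isPerm n w ≡ true
⇒isPerm n w c = T⇒≡ (All.all⁻ (λ k → k ∈ᵇ w) (All.tabulate (λ {v} v∈ → let (1≤v , v≤n) = ∈-oneTo⁻ {n} v∈ in
  count⇒∈ᵇ v w (subst (0 <_) (sym (content-at {n} {one} {w} c 1≤v v≤n)) (s≤s z≤n)))))

sum-S : ∀ n Φ → sumL (S n) Φ ≡ sumW n n (λ w → ⟦ content? n one w ⟧ *ᶻ Φ w)
sum-S n Φ = trans (sumL-filter (λ w → Data.Bool._≟_ (isPerm n w) true) (words n n) Φ)
  (sumW-cong n n (λ w isW → cong (_*ᶻ Φ w) (⟦⟧-cong (Data.Bool._≟_ (isPerm n w) true) (content? n one w) (λ e {i} → isPerm⇒ n w isW e {i}) (⇒isPerm n w))))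

majFrom-snoc : ∀ i u x y → majFrom i (u ++ x ∷ y ∷ []) ≡ majFrom i (u ++ x ∷ []) + descent x y * (i + length u)
majFrom-snoc i []          x y = trans (majFrom-∷∷ i x y []) (trans (+-identityʳ _) (cong (descent x y *_) (sym (+-identityʳ i))))
majFrom-snoc i (z ∷ [])    x y = trans (majFrom-∷∷ i z x (y ∷ [])) (trans (cong (λ t → descent z x * i + t) (majFrom-snoc (suc i) [] x y))
  (trans (sym (+-assoc (descent z x * i) 0 _)) (cong₂ _+_ (sym (majFrom-∷∷ i z x [])) (cong (descent x y *_) (sym (+-suc i 0))))))
majFrom-snoc i (z ∷ t ∷ u) x y = trans (majFrom-∷∷ i z t (u ++ x ∷ y ∷ [])) (trans (cong (λ r → descent z t * i + r) (majFrom-snoc (suc i) (t ∷ u) x y))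
  (trans (sym (+-assoc (descent z t * i) _ _)) (cong₂ _+_ (sym (majFrom-∷∷ i z t (u ++ x ∷ []))) (cong (descent x y *_) (sym (+-suc i (suc (length u))))))))

inv≡ : ∀ n w → inv n w ≡ applyUpTo (λ i → pos (suc i) w) n
inv≡ n w = trans (cong (map (λ k → pos k w)) (oneTo≡ n)) (trans (sym (List.map-∘ (upTo n))) (List.map-upTo _ n))

-- `imaj` grows by its largest inverse descent, so the inverse word is taken apart from its right
-- end.
maj-inv : ∀ a w → maj (inv (suc a) w) ≡ imaj a w
maj-inv a w = trans (cong maj (inv≡ (suc a) w)) (go a)
  where
  h : ℕ → ℕ
  h i = pos (suc i) w
  go : ∀ a → maj (applyUpTo h (suc a)) ≡ imaj a w
  go zero    = refl
  go (suc a) = trans (cong maj (trans (sym (List.applyUpTo-∷ʳ h (suc a))) (trans (cong (_++ h (suc a) ∷ []) (sym (List.applyUpTo-∷ʳ h a)))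
      (List.++-assoc (applyUpTo h a) (h a ∷ []) (h (suc a) ∷ [])))))
    (trans (majFrom-snoc 1 (applyUpTo h a) (h a) (h (suc a))) (cong₂ _+_ (trans (cong maj (List.applyUpTo-∷ʳ h a)) (go a))
      (cong (λ z → descent (h a) (h (suc a)) * suc z) (List.length-applyUpTo h a))))

-- zero-based
nth : List ℕ → ℕ → ℕ
nth []      i       = 0
nth (x ∷ w) zero    = x
nth (x ∷ w) (suc i) = nth w i

applyUpTo-nth : ∀ w → applyUpTo (nth w) (length w) ≡ w
applyUpTo-nth []      = refl
applyUpTo-nth (x ∷ w) = cong (x ∷_) (applyUpTo-nth w)

pos-nth : ∀ v w → 0 < count v w → ∃ λ i → i < length w × pos v w ≡ suc i × nth w i ≡ v
pos-nth v (x ∷ w) occ with v ≟ x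
... | yes refl = 0 , s≤s z≤n , pos-here v w , refl
... | no v≢x with pos-nth v w (subst (0 <_) (count-there w v≢x) occ)
...   | i , i<l , e , e′ = suc i , s≤s i<l , trans (pos-there w v≢x) (cong suc e) , e′

count-nth : ∀ w i → i < length w → 0 < count (nth w i) w
count-nth (x ∷ w) zero    i<l = subst (0 <_) (sym (count-here x w)) (s≤s z≤n)
count-nth (x ∷ w) (suc i) (s≤s i<l) = <-≤-trans (count-nth w i i<l) (m≤n+m _ _)

nth-pos : ∀ w i → i < length w → count (nth w i) w ≡ 1 → pos (nth w i) w ≡ suc i
nth-pos (x ∷ w) zero    i<l       once = pos-here x w
nth-pos (x ∷ w) (suc i) (s≤s i<l) once with nth w i ≟ x
... | yes refl = ⊥-elim (<⇒≢ (s≤s (count-nth w i i<l)) (sym (trans (sym (count-here x w)) once)))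
... | no y≢x   = trans (pos-there w y≢x) (cong suc (nth-pos w i i<l (trans (sym (count-there w y≢x)) once)))

pos-applyUpTo : ∀ (h : ℕ → ℕ) n i → i < n → (∀ j → j < i → h j ≢ h i) → pos (h i) (applyUpTo h n) ≡ suc i
pos-applyUpTo h (suc n) zero    i<n       new = pos-here (h 0) (applyUpTo (h ∘ suc) n)
pos-applyUpTo h (suc n) (suc i) (s≤s i<n) new = trans (pos-there (applyUpTo (h ∘ suc) n) (new 0 (s≤s z≤n) ∘ sym)) (cong suc (pos-applyUpTo (h ∘ suc) n i i<n (λ j j<i → new (suc j) (s≤s j<i))))

applyUpTo-congᵇ : ∀ {f g : ℕ → ℕ} n → (∀ i → i < n → f i ≡ g i) → applyUpTo f n ≡ applyUpTo g n
applyUpTo-congᵇ zero    eq = refl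
applyUpTo-congᵇ (suc n) eq = cong₂ _∷_ (eq 0 (s≤s z≤n)) (applyUpTo-congᵇ n (λ i i<n → eq (suc i) (s≤s i<n)))

module _ (n : ℕ) (w : List ℕ) (isW : IsWord n n w) (perm : Content n one w) where

  private
    l : length w ≡ n
    l = proj₁ isW
    nth-range : ∀ w → All (InRange n) w → ∀ i → i < length w → InRange n (nth w i)
    nth-range (x ∷ w) (r ∷ rs) zero    _         = r
    nth-range (x ∷ w) (r ∷ rs) (suc i) (s≤s i<l) = nth-range w rs i i<l
    in-range : ∀ i → i < n → InRange n (nth w i)
    in-range i i<n = nth-range w (proj₂ isW) i (subst (i <_) (sym l) i<n)
    pos∘nth : ∀ i → i < n → pos (nth w i) w ≡ suc i
    pos∘nth i i<n = nth-pos w i (subst (i <_) (sym l) i<n) (content-at {n} {one} {w} perm (proj₁ (in-range i i<n)) (proj₂ (in-range i i<n)))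
    nth∘pos : ∀ v → v < n → ∃ λ i → i < n × pos (suc v) w ≡ suc i × nth w i ≡ suc v
    nth∘pos v v<n with pos-nth (suc v) w (subst (0 <_) (sym (perm v<n)) (s≤s z≤n))
    ... | i , i<l , e , e′ = i , subst (i <_) l i<l , e , e′
    h : ℕ → ℕ
    h i = pos (suc i) w
    h-injective : ∀ {u v} → u < n → v < n → h u ≡ h v → u ≡ v
    h-injective {u} {v} u<n v<n e with nth∘pos u u<n | nth∘pos v v<n
    ... | i , _ , e₁ , e₂ | j , _ , e₃ , e₄ = suc-injective (trans (sym e₂) (trans (cong (nth w) (suc-injective (trans (sym e₁) (trans e e₃)))) e₄))

  inv-isWord : IsWord n n (inv n w)
  inv-isWord = subst (IsWord n n) (sym (inv≡ n w)) (List.length-applyUpTo h n , All.applyUpTo⁺₁ h n range)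
    where
    range : ∀ {i} → i < n → InRange n (h i)
    range {i} i<n with nth∘pos i i<n
    ... | j , j<n , e , _ = subst (InRange n) (sym e) (s≤s z≤n , j<n)

  -- The value i + 1 is taken by the position function only at the letter that stands in place i + 1
  -- of `w`.
  inv-content : Content n one (inv n w)
  inv-content {i} i<n = ℤ.+-injective (trans (count≡sum (suc i) (inv n w)) (trans (sumL-map (λ k → pos k w) (oneTo n) _) (trans (sumL-oneTo n _)
    (trans (sum₁-cong n (λ v 1≤v v≤n → trans (⟦⟧-cong (suc i ≟ pos v w) (v ≟ nth w i) (to v 1≤v v≤n) (λ { refl → sym (pos∘nth i i<n) })) (sym (R.*-identityʳ _))))
      (sum₁-δ n (nth w i) (λ _ → 1ℤ) (proj₁ (in-range i i<n)) (proj₂ (in-range i i<n)))))))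
    where
    to : ∀ v → 1 ≤ v → v ≤ n → suc i ≡ pos v w → v ≡ nth w i
    to (suc v) _ v<n e with nth∘pos v v<n
    ... | j , _ , e₁ , e₂ = trans (sym e₂) (cong (nth w) (sym (suc-injective (trans e e₁))))

  inv-inv : inv n (inv n w) ≡ w
  inv-inv = trans (inv≡ n (inv n w)) (trans (applyUpTo-congᵇ n position) (trans (cong (applyUpTo (nth w)) (sym l)) (applyUpTo-nth w)))
    where
    position : ∀ i → i < n → pos (suc i) (inv n w) ≡ nth w i
    position i i<n with nth w i in e | in-range i i<n
    -- The letter `suc v` stands at place `suc i` of `w`, so the inverse has `suc i` at place
    -- `suc v`; injectivity of positions makes this its first occurrence, the one that `pos` finds.
    ... | suc v | _ , v<n = trans (cong₂ pos (sym hv) (inv≡ n w)) (pos-applyUpTo h n v v<n (λ j j<v eq → <⇒≢ j<v (h-injective (<-trans j<v v<n) v<n eq)))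
      where
      hv : h v ≡ suc i
      hv = trans (cong (λ z → pos z w) (sym e)) (pos∘nth i i<n)

-- Exchanges the roles of maj and imaj, so that the larger of two orders can always be placed on the
-- side of maj.
sum-inverse : ∀ a (F : ℕ → ℕ → ℤ) → sumW (suc a) (suc a) (λ w → ⟦ content? (suc a) one w ⟧ *ᶻ F (maj w) (imaj a w)) ≡
  sumW (suc a) (suc a) (λ w → ⟦ content? (suc a) one w ⟧ *ᶻ F (imaj a w) (maj w))
sum-inverse a F = sumW-reindex n n (content? n one) (content? n one) (inv n) (inv n) (λ w → F (maj w) (imaj a w)) (λ w → F (imaj a w) (maj w))
  (λ w isW c → inv-isWord n w isW c , (λ {i} → inv-content n w isW c {i}) , inv-inv n w isW c ,
    cong₂ F (trans (cong maj (sym (inv-inv n w isW c))) (maj-inv a (inv n w))) (sym (maj-inv a w)))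
  (λ w isW c → inv-isWord n w isW c , (λ {i} → inv-content n w isW c {i}) , inv-inv n w isW c)
  where
  n = suc a

-- The double sum over divisors

%≡⇒∣ : ∀ n x i .{{_ : NonZero n}} → i ≤ n → x % n ≡ i % n → n ∣ x + (n ∸ i)
%≡⇒∣ n x i i≤n eq = m%n≡0⇒n∣m _ n (trans (%-distribˡ-+ x (n ∸ i) n) (trans (cong (λ z → (z + (n ∸ i) % n) % n) eq)
  (trans (sym (%-distribˡ-+ i (n ∸ i) n)) (trans (cong (_% n) (m+[n∸m]≡n i≤n)) (n%n≡0 n)))))

∣⇒%≡ : ∀ n x i .{{_ : NonZero n}} → i ≤ n → n ∣ x + (n ∸ i) → x % n ≡ i % n
∣⇒%≡ n x i i≤n n∣ = trans (sym ([m+n]%n≡m%n x n)) (trans (cong (_% n) (trans (cong (λ z → x + z) (sym (m∸n+n≡m i≤n))) (sym (+-assoc x (n ∸ i) i)))) (%-remove-+ˡ i n∣))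

-- Residues are subtracted by adding n - i. After evaluation the argument is n - i instead of i,
-- which `C` does not distinguish because it depends only on the gcd with d.
gcd-∸ : ∀ n d i → d ∣ n → i ≤ n → gcd (n ∸ i) d ≡ gcd i d
gcd-∸ n d i d∣n i≤n = ∣-antisym
  (gcd-greatest (∣m+n∣m⇒∣n (subst (gcd (n ∸ i) d ∣_) (sym (m∸n+n≡m i≤n)) (∣-trans (gcd[m,n]∣n (n ∸ i) d) d∣n)) (gcd[m,n]∣m (n ∸ i) d)) (gcd[m,n]∣n (n ∸ i) d))
  (gcd-greatest (∣m+n∣m⇒∣n (subst (gcd i d ∣_) (sym (m+[n∸m]≡n i≤n)) (∣-trans (gcd[m,n]∣n i d) d∣n)) (gcd[m,n]∣m i d)) (gcd[m,n]∣n i d))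

weight : ℕ → ℕ → ℕ
weight n d = d ^ (n div d) * (n div d) !

opaque
  unfolding _+ᶻ_

  regroup : ∀ n c x y → n *ᶻ n *ᶻ (c *ᶻ (x *ᶻ y)) ≡ c *ᶻ ((n *ᶻ x) *ᶻ (n *ᶻ y))
  regroup = solve-∀

  regroup₂ : ∀ c d x e y → c *ᶻ ((d *ᶻ x) *ᶻ (e *ᶻ y)) ≡ d *ᶻ (e *ᶻ (c *ᶻ (x *ᶻ y)))
  regroup₂ = solve-∀

module _ (a i j : ℕ) (i≤n : i ≤ suc a) (j≤n : j ≤ suc a) where

  private
    n = suc a
    i′ = n ∸ i
    j′ = n ∸ j

  m≡sum : + m n n n i j ≡ sumW n n (λ w → ⟦ content? n one w ⟧ *ᶻ (⟦ n ∣? (maj w + i′) ⟧ *ᶻ ⟦ n ∣? (imaj a w + j′) ⟧))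
  m≡sum = trans (length-filter dec (S n)) (trans (sum-S n (λ w → ⟦ dec w ⟧))
    (sumL-cong (words n n) (λ w → cong (⟦ content? n one w ⟧ *ᶻ_) (trans (⟦⟧-cong (dec w) ((n ∣? (maj w + i′)) ×-dec (n ∣? (imaj a w + j′))) (to w) (from w))
      (⟦⟧-× (n ∣? (maj w + i′)) (n ∣? (imaj a w + j′)))))))
    where
    cond : List ℕ → Bool
    cond w = (maj w % n ≡ᵇ i % n) ∧ (maj (inv n w) % n ≡ᵇ j % n)
    dec : ∀ w → Dec (cond w ≡ true)
    dec w = Data.Bool._≟_ (cond w) true
    to : ∀ w → cond w ≡ true → n ∣ maj w + i′ × n ∣ imaj a w + j′
    to w e with maj w % n ≡ᵇ i % n in e₁
    ... | true = %≡⇒∣ n (maj w) i i≤n (≡ᵇ⇒≡ _ _ (subst T (sym e₁) tt)) ,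
          subst (λ z → n ∣ z + j′) (maj-inv a w) (%≡⇒∣ n (maj (inv n w)) j j≤n (≡ᵇ⇒≡ _ _ (subst T (sym e) tt)))
    from : ∀ w → n ∣ maj w + i′ × n ∣ imaj a w + j′ → cond w ≡ true
    from w (p , q) = cong₂ _∧_ (T⇒≡ (≡⇒≡ᵇ (maj w % n) (i % n) (∣⇒%≡ n (maj w) i i≤n p)))
      (T⇒≡ (≡⇒≡ᵇ (maj (inv n w) % n) (j % n) (∣⇒%≡ n (maj (inv n w)) j j≤n (subst (λ z → n ∣ z + j′) (sym (maj-inv a w)) q))))

  W : ℕ → ℕ → ℤ
  W d e = sumW n n (λ w → ⟦ content? n one w ⟧ *ᶻ (C d (maj w + i′) *ᶻ C e (imaj a w + j′)))

  -- Each of the two congruence indicators absorbs one factor n and is expanded over the divisors of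
  -- n by `complete`.
  n²m≡ΣW : + n *ᶻ + n *ᶻ + m n n n i j ≡ sumD n (λ d → sumD n (W d))
  n²m≡ΣW = trans (cong (+ n *ᶻ + n *ᶻ_) m≡sum) (trans (sym (sumL-*ˡ (+ n *ᶻ + n) (words n n) _))
    (trans (sumL-cong (words n n) (λ w → trans (regroup (+ n) ⟦ content? n one w ⟧ _ _) (trans (cong (⟦ content? n one w ⟧ *ᶻ_)
        (cong₂ _*ᶻ_ (sym (complete n (maj w + i′))) (sym (complete n (imaj a w + j′))))) (distribute w))))
    (trans (sumL-swap (words n n) (upTo n) _) (sumL-cong (upTo n) (λ d → trans (sumL-swap (words n n) (upTo n) _)
      (trans (sumL-cong (upTo n) (λ e → trans (sumL-*ˡ ⟦ suc d ∣? n ⟧ (words n n) _) (cong (⟦ suc d ∣? n ⟧ *ᶻ_) (sumL-*ˡ ⟦ suc e ∣? n ⟧ (words n n) _))))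
        (sumL-*ˡ ⟦ suc d ∣? n ⟧ (upTo n) _)))))))
    where
    distribute : ∀ w → ⟦ content? n one w ⟧ *ᶻ (sumD n (λ d → C d (maj w + i′)) *ᶻ sumD n (λ e → C e (imaj a w + j′))) ≡
      sum₁ n (λ d → sum₁ n (λ e → ⟦ d ∣? n ⟧ *ᶻ (⟦ e ∣? n ⟧ *ᶻ (⟦ content? n one w ⟧ *ᶻ (C d (maj w + i′) *ᶻ C e (imaj a w + j′))))))
    distribute w = trans (cong (⟦ content? n one w ⟧ *ᶻ_) (sym (sumL-*ʳ _ (upTo n) _))) (trans (sym (sumL-*ˡ _ (upTo n) _))
      (sumL-cong (upTo n) (λ d → trans (cong (⟦ content? n one w ⟧ *ᶻ_) (sym (sumL-*ˡ _ (upTo n) _))) (trans (sym (sumL-*ˡ _ (upTo n) _))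
        (sumL-cong (upTo n) (λ e → regroup₂ ⟦ content? n one w ⟧ ⟦ suc d ∣? n ⟧ (C (suc d) (maj w + i′)) ⟦ suc e ∣? n ⟧ (C (suc e) (imaj a w + j′))))))))

  V : ℕ → ℤ
  V d = + weight n d *ᶻ (C d i *ᶻ C d j)

  -- Distinct orders are orthogonal, with permutations inverted when d < e so that the larger order
  -- accompanies maj. For e = d the primitive functions are evaluated at 0, where the shifts leave
  -- `C d (n - i)` and `C d (n - j)`.
  W-value : ∀ d e → 1 ≤ d → 1 ≤ e → d ∣ n → e ∣ n → W d e ≡ ⟦ e ≟ d ⟧ *ᶻ V d
  W-value d@(suc d′) e@(suc e′) _ _ d∣n e∣n with <-cmp d e
  ... | tri< d<e d≢e _ = trans (sum-inverse a (λ x y → C d (x + i′) *ᶻ C e (y + j′))) (trans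
        (sumL-cong (words n n) (λ w → cong (⟦ content? n one w ⟧ *ᶻ_) (R.*-comm _ _)))
        (trans (Z-primitive-< a {λ s → C e (s + j′)} {λ s → C d (s + i′)} e∣n (primitive-shift j′ (primitive-C e)) (primitive-shift i′ (primitive-C d)) d<e)
          (sym (no-* (e ≟ d) (d≢e ∘ sym) (V d)))))
  ... | tri> _ d≢e e<d = trans (Z-primitive-< a {λ s → C d (s + i′)} {λ s → C e (s + j′)} d∣n (primitive-shift i′ (primitive-C d)) (primitive-shift j′ (primitive-C e)) e<d)
        (sym (no-* (e ≟ d) (d≢e ∘ sym) (V d)))
  ... | tri≈ _ refl _ with d∣n
  ...   | divides (suc k) n≡ = trans (Z-primitive-≡ a {λ s → C d (s + i′)} {λ s → C d (s + j′)} d′ k n≡ (primitive-shift i′ (primitive-C d)) (primitive-shift j′ (primitive-C d)))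
          (trans (cong₂ _*ᶻ_ (cong (λ q → + (d ^ q * q !)) (sym n/d)) (cong₂ _*ᶻ_ (C-cong {d} {i′} {i} (gcd-∸ n d i d∣n i≤n)) (C-cong {d} {j′} {j} (gcd-∸ n d j d∣n j≤n))))
            (sym (yes-* (d ≟ d) refl (V d))))
    where
    n/d : n div d ≡ suc k
    n/d = trans (cong (_div d) (trans n≡ (*-comm (suc k) d))) (*-div d (suc k))

  n²m≡ΣV : + n *ᶻ + n *ᶻ + m n n n i j ≡ sumD n V
  n²m≡ΣV = trans n²m≡ΣW (sum₁-cong n (λ d 1≤d d≤n → ⟦⟧*-cong (d ∣? n) (λ d∣n → trans
    (sum₁-cong n (λ e 1≤e e≤n → trans (⟦⟧*-cong (e ∣? n) (λ e∣n → W-value d e 1≤d 1≤e d∣n e∣n))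
      (trans (sym (R.*-assoc _ _ _)) (trans (cong (_*ᶻ V d) (R.*-comm _ _)) (R.*-assoc _ _ _)))))
    (trans (sum₁-δ n d (λ e → ⟦ e ∣? n ⟧ *ᶻ V d) 1≤d d≤n) (yes-* (d ∣? n) d∣n (V d))))))

-- From integers to the rational formula

÷ℕ-exact : ∀ z q .{{_ : NonZero q}} → (z ℤ.* + q) ÷ℕ q ≡ z ℚ./ 1
÷ℕ-exact z (suc q) = ℚ.fromℚᵘ-cong {mkℚᵘ (z ℤ.* + suc q) q} {mkℚᵘ z 0} (*≡* (ℤ.*-identityʳ _))

/1-+ : ∀ y z → (y ℚ./ 1) ℚ.+ (z ℚ./ 1) ≡ (y ℤ.+ z) ℚ./ 1
/1-+ y z = ℚ.toℚᵘ-injective (ℚᵘ.≃-trans (ℚ.toℚᵘ-homo-+ (y ℚ./ 1) (z ℚ./ 1)) (ℚᵘ.≃-trans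
  (ℚᵘ.+-cong (ℚ.toℚᵘ-fromℚᵘ (mkℚᵘ y 0)) (ℚ.toℚᵘ-fromℚᵘ (mkℚᵘ z 0)))
  (ℚᵘ.≃-trans (*≡* (cong (ℤ._* + 1) (cong₂ ℤ._+_ (ℤ.*-identityʳ y) (ℤ.*-identityʳ z)))) (ℚᵘ.≃-sym (ℚ.toℚᵘ-fromℚᵘ (mkℚᵘ (y ℤ.+ z) 0))))))

÷ℕ-*-cancel : ∀ q z .{{_ : NonZero q}} → (1ℤ ÷ℕ q) ℚ.* ((+ q ℤ.* z) ℚ./ 1) ≡ z ℚ./ 1
÷ℕ-*-cancel (suc q) z = ℚ.toℚᵘ-injective (ℚᵘ.≃-trans (ℚ.toℚᵘ-homo-* (1ℤ ℚ./ suc q) ((+ suc q ℤ.* z) ℚ./ 1)) (ℚᵘ.≃-trans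
  (ℚᵘ.*-cong (ℚ.toℚᵘ-fromℚᵘ (mkℚᵘ 1ℤ q)) (ℚ.toℚᵘ-fromℚᵘ (mkℚᵘ (+ suc q ℤ.* z) 0)))
  (ℚᵘ.≃-trans (*≡* identity) (ℚᵘ.≃-sym (ℚ.toℚᵘ-fromℚᵘ (mkℚᵘ z 0))))))
  where
  identity : (1ℤ ℤ.* (+ suc q ℤ.* z)) ℤ.* + 1 ≡ z ℤ.* + suc (q * 1)
  identity = trans (ℤ.*-identityʳ _) (trans (ℤ.*-identityˡ _) (trans (ℤ.*-comm (+ suc q) z) (cong (λ x → z ℤ.* + suc x) (sym (*-identityʳ q)))))

opaque
  unfolding _+ᶻ_

  Σℚ-exact : ∀ (F : ℕ → ℚ) (v : ℕ → ℤ) {ds} → All (λ d → F d ≡ v d ℚ./ 1) ds → Σℚ (map F ds) ≡ sumL ds v ℚ./ 1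
  Σℚ-exact F v []                = refl
  Σℚ-exact F v (_∷_ {d} {ds} e es) = trans (cong₂ ℚ._+_ e (Σℚ-exact F v es)) (/1-+ (v d) (sumL ds v))

  cancel-square : ∀ n .{{_ : NonZero n}} M N → + n *ᶻ + n *ᶻ M ≡ N → (1ℤ ÷ℕ (n * n)) ℚ.* (N ℚ./ 1) ≡ M ℚ./ 1
  cancel-square n M N refl = trans (cong (λ z → (1ℤ ÷ℕ (n * n)) ℚ.* ((z ℤ.* M) ℚ./ 1)) (sym (ℤ.pos-* n n))) (÷ℕ-*-cancel (n * n) M {{m*n≢0 n n}})

  -- The product of two instances of Hölder's formula with denominators cleared. It shows that each
  -- fraction in the formula is an integer, namely the value of `V` at that divisor.
  term-numerator : ∀ x φd φa φb c c′ μa μb → c *ᶻ + φa ≡ + φd *ᶻ μa → c′ *ᶻ + φb ≡ + φd *ᶻ μb →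
    + (x * (φd * φd)) ℤ.* μa ℤ.* μb ≡ (+ x *ᶻ (c *ᶻ c′)) ℤ.* + (φa * φb)
  term-numerator x φd φa φb c c′ μa μb e e′ = trans (cong (λ z → z ℤ.* μa ℤ.* μb) (trans (ℤ.pos-* x (φd * φd)) (cong (+ x ℤ.*_) (ℤ.pos-* φd φd))))
    (trans (left (+ x) (+ φd) μa μb) (trans (cong₂ (λ y z → + x ℤ.* (y ℤ.* z)) (sym e) (sym e′))
    (trans (right (+ x) c (+ φa) c′ (+ φb)) (cong ((+ x ℤ.* (c ℤ.* c′)) ℤ.*_) (sym (ℤ.pos-* φa φb))))))
    where
    left : ∀ x p y z → x ℤ.* (p ℤ.* p) ℤ.* y ℤ.* z ≡ x ℤ.* ((p ℤ.* y) ℤ.* (p ℤ.* z))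
    left = solve-∀
    right : ∀ x c p c′ q → x ℤ.* ((c ℤ.* p) ℤ.* (c′ ℤ.* q)) ≡ (x ℤ.* (c ℤ.* c′)) ℤ.* (p ℤ.* q)
    right = solve-∀

theorem4p1 : (n i j : ℕ) → 1 ≤ n → 1 ≤ i → i ≤ n → 1 ≤ j → j ≤ n →
    (+ m n n n i j) Data.Rational./ 1 ≡ rhs n i j
theorem4p1 n@(suc a) i j 1≤n 1≤i i≤n 1≤j j≤n = sym (trans (cong (ℚ._*_ ((+ 1) ÷ℕ (n * n))) (Σℚ-exact _ (V a i j i≤n j≤n) (All.tabulate exact)))
  (cancel-square n (+ m n n n i j) _ (trans (n²m≡ΣV a i j i≤n j≤n) (sym divisor-sum))))
  where
  exact : ∀ {d} → d ∈ divisors n → _ ≡ V a i j i≤n j≤n d ℚ./ 1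
  exact {d} d∈ = trans (cong (_÷ℕ (φ x * φ y)) (term-numerator (weight n d) (φ d) (φ x) (φ y) (C d i) (C d j) (μ x) (μ y) (C-φ d i {{d≢0}}) (C-φ d j {{d≢0}})))
      (÷ℕ-exact (V a i j i≤n j≤n d) (φ x * φ y) {{m*n≢0 (φ x) (φ y) {{φ-nonZero x {{cofactor-nonZero d i {{d≢0}}}}}} {{φ-nonZero y {{cofactor-nonZero d j {{d≢0}}}}}}}})
    where
    x = cofactor d i
    y = cofactor d j
    d≢0 : NonZero d
    d≢0 = >-nonZero (proj₁ (∈-oneTo⁻ {n} (proj₁ (∈-filter⁻ (λ d → Data.Bool._≟_ (d ∣ᵇ n) true) {xs = oneTo n} d∈))))
  divisor-sum : sumL (divisors n) (V a i j i≤n j≤n) ≡ sumD n (V a i j i≤n j≤n)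
  divisor-sum = trans (sumL-filter (λ d → Data.Bool._≟_ (d ∣ᵇ n) true) (oneTo n) _) (trans (sumL-oneTo n _)
    (sumL-cong (upTo n) (λ d → cong (_*ᶻ V a i j i≤n j≤n (suc d)) (⟦⟧-cong (Data.Bool._≟_ (suc d ∣ᵇ n) true) (suc d ∣? n) (∣ᵇ⇒∣ (suc d) n) (∣⇒∣ᵇ (suc d) n)))))
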